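{- Let $q_1,q_2$ be PIBQFs with topographs $T_1,T_2$ and rivers $R_1,R_2$. The intersection number $\mathrm{Int}(q_1,q_2)$ is equal to the number of ways to superimpose the topographs $T_1,T_2$ onto each other so that the rivers $R_1$ and $R_2$ meet and cross, modulo the periods of the rivers.
   Context: Forms. Write $[A,B,C]$ for the integral form $Ax^2+Bxy+Cy^2$, of discriminant $D=B^2-4AC$. A PIBQF is such a form with $\gcd(A,B,C)=1$ and $D>0$ not a perfect square. $\Gamma=\mathrm{PSL}(2,\mathbb Z)$ acts on forms (on the right) by $(\gamma\circ q)(x,y)=q(ax+by,cx+dy)$ for $\gamma=\begin{pmatrix}a&b\\c&d\end{pmatrix}$; forms in one orbit are called equivalent. The first root of $q$ is $q_f=\frac{ -B+\sqrt D}{2A}$, the second is $q_s=\frac{ -B-\sqrt D}{2A}$; $\ell_q$ is the oriented geodesic in the upper half plane $\mathbb H$ from $q_s$ to $q_f$. The invariant automorph is $\gamma_q=\begin{pmatrix}\frac{T-BU}{2} & -CU \\ A U & \frac{T+BU}{2}\end{pmatrix}$, with $(T,U)$ the smallest positive integer solution of $t^2-Du^2=4$; it preserves $\ell_q$, so $\ell_q$ projects to a closed geodesic $\tilde\ell_q$ in $\Gamma\backslash\mathbb H$. Intersection number. $\mathrm{Int}(q_1,q_2)$ is the (unsigned) number of transverse intersections of $\tilde\ell_{q_1}$ with $\tilde\ell_{q_2}$, counted as follows: fix any $z\in\ell_{q_2}$ and let $\dot\ell$ be the half-open segment of $\ell_{q_2}$ from $z$ (included) to $\gamma_{q_2}z$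 (excluded); $\mathrm{Int}(q_1,q_2)$ is the number of pairs $(\ell,P)$ with $\ell$ an oriented geodesic that is a $\Gamma$-translate of $\ell_{q_1}$ and $P$ a transverse intersection point of $\ell$ with $\dot\ell$ (independent of $z$). Topograph. Let $G$ be the infinite $3$-regular tree drawn in the oriented plane. For an oriented edge $e$ pointing to a vertex $V$, let $\bar e$ be its reversal and let $\mathrm{left}(e)$ be the edge obtained by travelling along $e$ to $V$ and taking the left branch, oriented away from $V$. With $S=\begin{pmatrix}0&1\\-1&0\end{pmatrix}$ and $T=\begin{pmatrix}1&1\\0&1\end{pmatrix}$, the topograph of a form $q$ is $G$ together with the unique assignment $e\mapsto f(e)$ of forms to oriented edges such that $f(e_0)=q$ for a chosen base oriented edge $e_0$, $f(\bar e)=S\circ f(e)$ and $f(\mathrm{left}(e))=T\circ f(e)$. The forms appearing are exactly the forms equivalent to $q$, and equivalent forms give isomorphic topographs. If $f(e)=[A,B,C]$ then $A$ is the number written in the region of the plane to the left of $e$ and $C$ the number in the region to the right (this is consistent). River. For a PIBQF $q$, the river is the set of edges whose form $[A,B,C]$ satisfies $AC<0$; it is a bi-infinite path separating the regions with positive numbers from those with negative numbers, and its sequence of left/right turns is periodic. The river flows in the direction which has the positive regions on its left. Superimposing. A superimposition of $T_1,T_2$ is an identification of the underlying plane trees by an isomorphism $\varphi$ from the tree of $T_2$ to the tree of $T_1$ preserving the cyclic (planar) orientation at every vertex; it is determined by identifying an oriented edge of $T_2$ with one of $T_1$. The rivers meet and cross if $R_1$ and $\varphi(R_2)$ share a finite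 nonempty path and $\varphi(R_2)$ joins this path from one side of $R_1$ and leaves it on the other side of $R_1$. "Modulo the periods of the rivers" means that $\varphi$ is identified with $\tau_1^a\varphi\tau_2^b$ for all $a,b\in\mathbb Z$, where $\tau_i$ is the automorphism of $T_i$ (preserving planar orientation and all forms $f$) translating along $R_i$ by one least period of its left/right turn sequence. -}

module Defs where

open import Algebra.Bundles using (CommutativeRing)
import Algebra.Properties.Monoid.Mult as Mult
open import Data.Fin.Base using (Fin)
open import Data.Integer.Base as ℤ using (ℤ; +_; -[1+_]; 0ℤ; 1ℤ; -1ℤ; _/ℕ_)
open import Data.Integer.GCD using (gcd)
import Data.Integer.Properties as ℤₚ
open import Data.Integer.Tactic.RingSolver using (solve-∀)
open import Data.List.Base using (List; []; _∷_)
open import Data.Nat.Base as ℕ using (ℕ)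
open import Data.Nat.GeneralisedArithmetic using (fold)
open import Data.Product.Base using (Σ; Σ-syntax; ∃-syntax; _×_; _,_; proj₁; proj₂)
open import Data.Sum.Base using (_⊎_)
open import Function.Base using (_on_)
open import Function.Bundles using (_↔_; Bijection; module Inverse)
open import Level using (Level; 0ℓ; _⊔_) renaming (suc to lsuc)
open import Relation.Binary.Bundles using (Setoid)
import Relation.Binary.Construct.On as On
import Relation.Binary.Construct.StrictToNonStrict as NonStrict
open import Relation.Binary.Construct.Closure.ReflexiveTransitive using (Star)
open import Relation.Binary.Core using (Rel)
open import Relation.Binary.PropositionalEquality
  using (_≡_; _≢_; refl; sym; trans; cong; cong₂; setoid; module ≡-Reasoning)
open import Relation.Binary.Structures using (IsEquivalence; IsStrictTotalOrder)
open import Relation.Nullary.Negation.Core using (¬_)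

HasCardinality : ∀ {a ℓ} → Setoid a ℓ → ℕ → Set (a ⊔ ℓ)
HasCardinality S n = Bijection (setoid (Fin n)) S

module _ where
  open import Data.Integer.Base using (_+_; _*_; _-_; -_; _<_; _≤_)

  infix 4 [_,_,_]
  record Form : Set where
    constructor [_,_,_]
    field
      A B C : ℤ

  record Matrix : Set where
    constructor mat
    field
      a b c d : ℤ

  det : Matrix → ℤ
  det (mat a b c d) = a * d - b * c

  -- The coefficients of q(ax + by, cx + dy).
  infixr 8 _∘_
  _∘_ : Matrix → Form → Form
  mat a b c d ∘ [ A , B , C ] =
    [ A * (a * a) + B * (a * c) + C * (c * c)
    , + 2 * A * (a * b) + B * (a * d + b * c) + + 2 * C * (c * d)
    , A * (b * b) + B * (b * d) + C * (d * d)
    ]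

  S T : Matrix
  S = mat 0ℤ 1ℤ -1ℤ 0ℤ
  T = mat 1ℤ 1ℤ 0ℤ 1ℤ

  disc : Form → ℤ
  disc [ A , B , C ] = B * B - + 4 * A * C

  record PIBQF : Set where
    field
      form      : Form
    open Form form public
    D : ℤ
    D = disc form
    field
      coprime   : gcd (gcd A B) C ≡ 1ℤ
      D>0       : 0ℤ < D
      nonsquare : ∀ n → n * n ≢ D

  record PellSolution (D t u : ℤ) : Set where
    field
      t>0  : 0ℤ < t
      u>0  : 0ℤ < u
      pell : t * t - D * (u * u) ≡ + 4

  record SmallestPellSolution (D : ℤ) : Set where
    field
      t u      : ℤ
      solution : PellSolution D t u
      smallest : ∀ {t′ u′} → PellSolution D t′ u′ → t ≤ t′ × u ≤ u′

  -- Both divisions are exact, because t ≡ Bu (mod 2).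
  automorph : (q : PIBQF) → SmallestPellSolution (PIBQF.D q) → Matrix
  automorph q s = mat ((t - B * u) /ℕ 2) (- (C * u)) (A * u) ((t + B * u) /ℕ 2)
    where
    open PIBQF q using (A; B; C)
    open SmallestPellSolution s using (t; u)

-- Everything below is stated over an arbitrary Archimedean ordered field with
-- square roots of positive elements; the real numbers of classical mathematics
-- are one.  Completeness is not needed.  Outside their domains _⁻¹ and √ are
-- unconstrained.

record RealField c ℓ₁ ℓ₂ : Set (lsuc (c ⊔ ℓ₁ ⊔ ℓ₂)) where
  field
    commutativeRing : CommutativeRing c ℓ₁
  open CommutativeRing commutativeRing public hiding (_≉_)
  open Mult +-monoid public using () renaming (_×_ to _·_)

  infix  4 _<_ _≉_
  infix 9 _⁻¹

  _≉_ : Rel Carrier ℓ₁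
  x ≉ y = ¬ (x ≈ y)

  field
    _<_                : Rel Carrier ℓ₂
    isStrictTotalOrder : IsStrictTotalOrder _≈_ _<_
    0<1                : 0# < 1#
    +-monoˡ-<          : ∀ {x y} z → x < y → x + z < y + z
    *-pos              : ∀ {x y} → 0# < x → 0# < y → 0# < x * y
    _⁻¹                : Carrier → Carrier
    *-inverseʳ         : ∀ {x} → x ≉ 0# → x * x ⁻¹ ≈ 1#
    √                  : Carrier → Carrier
    √-pos              : ∀ {x} → 0# < x → 0# < √ x
    √-square           : ∀ {x} → 0# < x → √ x * √ x ≈ x
    archimedean        : ∀ x → ∃[ n ] x < n · 1#

  open NonStrict _≈_ _<_ public using (_≤_)

  fromℤ : ℤ → Carrier
  fromℤ (+ n)    = n · 1#
  fromℤ -[1+ n ] = - (ℕ.suc n · 1#)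

module Geometry {c ℓ₁ ℓ₂} (ℝ : RealField c ℓ₁ ℓ₂) where
  open RealField ℝ renaming (refl to ≈-refl; sym to ≈-sym; trans to ≈-trans)

  record ℂ : Set c where
    constructor _+i_
    field
      re im : Carrier
  open ℂ public

  infix 4 _≈ᶜ_
  _≈ᶜ_ : Rel ℂ ℓ₁
  z ≈ᶜ w = re z ≈ re w × im z ≈ im w

  -- An oriented geodesic is given by its two ends.  The ends of the geodesics
  -- below are irrational, so neither ∞ nor vertical half-lines are needed.
  record OrientedGeodesic : Set c where
    constructor _⇝_
    field
      source target : Carrier

  infix 4 _≈ᵍ_
  _≈ᵍ_ : Rel OrientedGeodesic ℓ₁
  (s ⇝ t) ≈ᵍ (s′ ⇝ t′) = s ≈ s′ × t ≈ t′

  -- The half circle in the upper half plane with diameter [s , t].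
  infix 4 _∈_
  _∈_ : ℂ → OrientedGeodesic → Set (ℓ₁ ⊔ ℓ₂)
  (x +i y) ∈ (s ⇝ t) = 0# < y × (x - s) * (x - t) + y * y ≈ 0#

  möbius : Matrix → Carrier → Carrier
  möbius (mat a b c d) x = (fromℤ a * x + fromℤ b) * (fromℤ c * x + fromℤ d) ⁻¹

  -- (az + b)/(cz + d), for a matrix of determinant one.
  möbiusᶜ : Matrix → ℂ → ℂ
  möbiusᶜ (mat a b c d) (x +i y) = (((a′ * x + b′) * r + a′ * c′ * (y * y)) * N ⁻¹) +i (y * N ⁻¹)
    where
    a′ = fromℤ a
    b′ = fromℤ b
    c′ = fromℤ c
    d′ = fromℤ d
    r = c′ * x + d′
    N = r * r + (c′ * y) * (c′ * y)

  möbiusᵍ : Matrix → OrientedGeodesic → OrientedGeodesic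
  möbiusᵍ γ (s ⇝ t) = möbius γ s ⇝ möbius γ t

  IsTranslate : OrientedGeodesic → OrientedGeodesic → Set ℓ₁
  IsTranslate ℓ ℓ′ = Σ[ γ ∈ Matrix ] det γ ≡ 1ℤ × ℓ′ ≈ᵍ möbiusᵍ γ ℓ

  module _ (q : PIBQF) where
    open PIBQF q using (A; B; D)

    firstRoot secondRoot : Carrier
    firstRoot  = (- fromℤ B + √ (fromℤ D)) * fromℤ (+ 2 ℤ.* A) ⁻¹
    secondRoot = (- fromℤ B - √ (fromℤ D)) * fromℤ (+ 2 ℤ.* A) ⁻¹

    geodesic : OrientedGeodesic
    geodesic = secondRoot ⇝ firstRoot

  -- The segment from z (included) to w (excluded) of a geodesic ℓ through z and
  -- w: on a half circle, arcs are determined by real parts.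
  record InSegment (ℓ : OrientedGeodesic) (z w P : ℂ) : Set (ℓ₁ ⊔ ℓ₂) where
    field
      on-geodesic : P ∈ ℓ
      between     : (re z ≤ re P × re P < re w) ⊎ (re w < re P × re P ≤ re z)

  -- The gradient at x + iy of (x - s)(x - t) + y².
  normal : OrientedGeodesic → ℂ → Carrier × Carrier
  normal (s ⇝ t) (x +i y) = (x - s) + (x - t) , y + y

  TransverseAt : ℂ → OrientedGeodesic → OrientedGeodesic → Set ℓ₁
  TransverseAt P ℓ ℓ′ = n₁ * n₂′ - n₂ * n₁′ ≉ 0#
    where
    n₁  = proj₁ (normal ℓ P)
    n₂  = proj₂ (normal ℓ P)
    n₁′ = proj₁ (normal ℓ′ P)
    n₂′ = proj₂ (normal ℓ′ P)

  record Intersection (q₁ q₂ : PIBQF) (z w : ℂ) : Set (c ⊔ ℓ₁ ⊔ ℓ₂) where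
    field
      ℓ            : OrientedGeodesic
      P            : ℂ
      is-translate : IsTranslate (geodesic q₁) ℓ
      on-translate : P ∈ ℓ
      on-segment   : InSegment (geodesic q₂) z w P
      transverse   : TransverseAt P ℓ (geodesic q₂)

  intersections : (q₁ q₂ : PIBQF) (z w : ℂ) → Setoid (c ⊔ ℓ₁ ⊔ ℓ₂) ℓ₁
  intersections q₁ q₂ z w = record
    { Carrier = Intersection q₁ q₂ z w
    ; _≈_ = λ I J → Intersection.ℓ I ≈ᵍ Intersection.ℓ J × Intersection.P I ≈ᶜ Intersection.P J
    ; isEquivalence = record
      { refl  = (≈-refl , ≈-refl) , (≈-refl , ≈-refl)
      ; sym   = λ { ((p , q) , (r , s)) → (≈-sym p , ≈-sym q) , (≈-sym r , ≈-sym s) }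
      ; trans = λ { ((p , q) , (r , s)) ((p′ , q′) , (r′ , s′)) →
                  (≈-trans p p′ , ≈-trans q q′) , (≈-trans r r′ , ≈-trans s s′) }
      }
    }

  -- Int(q₁ , q₂) = n.
  IntersectionNumber : PIBQF → PIBQF → ℕ → Set (c ⊔ ℓ₁ ⊔ ℓ₂)
  IntersectionNumber q₁ q₂ n =
    (s : SmallestPellSolution (PIBQF.D q₂)) (z : ℂ) → z ∈ geodesic q₂ →
    HasCardinality (intersections q₁ q₂ z (möbiusᶜ (automorph q₂ s) z)) n

data Turn : Set where
  L R : Turn

data Orientation : Set where
  forward backward : Orientation

opposite : Orientation → Orientation
opposite forward  = backward
opposite backward = forward

-- Oriented edges, relative to a root edge.  `away o w` is reached by traversing
-- the root edge in direction o and then making the turns w, the last turn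
-- being the head of w; `toward o t w` is the reversal of `away o (t ∷ w)`.  The
-- reversal of the root edge `away o []` is `away (opposite o) []`.
data Edge : Set where
  away   : Orientation → List Turn → Edge
  toward : Orientation → Turn → List Turn → Edge

bar : Edge → Edge
bar (away o [])      = away (opposite o) []
bar (away o (t ∷ w)) = toward o t w
bar (toward o t w)   = away o (t ∷ w)

-- The edge `toward o L w` ends where `away o w` ends, and arrives there from
-- the left branch of the latter: on its left is the right branch.
left : Edge → Edge
left (away o w)     = away o (L ∷ w)
left (toward o L w) = away o (R ∷ w)
left (toward o R w) = bar (away o w)

-- There are three edges at each vertex, so the left branch seen from the left
-- branch is the right branch.
right : Edge → Edge
right e = left (bar (left e))

turn : Turn → Edge → Edge
turn L = left
turn R = right

Next : Rel Edge 0ℓ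
Next e e′ = ∃[ t ] e′ ≡ turn t e

record PlaneIso : Set where
  field
    edges    : Edge ↔ Edge
  open Inverse edges public using (to; from; strictlyInverseˡ; strictlyInverseʳ)
  field
    to-bar  : ∀ e → to (bar e) ≡ bar (to e)
    to-left : ∀ e → to (left e) ≡ left (to e)

infixr 8 _^_
_^_ : PlaneIso → ℤ → Edge → Edge
(τ ^ + n) e      = fold e (PlaneIso.to τ) n
(τ ^ -[1+ n ]) e = fold e (PlaneIso.from τ) (ℕ.suc n)

record Topograph (q : Form) : Set where
  field
    f      : Edge → Form
    base   : Edge
    f-base : f base ≡ q
    f-bar  : ∀ e → f (bar e) ≡ S ∘ f e
    f-left : ∀ e → f (left e) ≡ T ∘ f e

  leftRegion rightRegion : Edge → ℤ
  leftRegion  e = Form.A (f e)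
  rightRegion e = Form.C (f e)

  OnRiver : Edge → Set
  OnRiver e = leftRegion e ℤ.* rightRegion e ℤ.< 0ℤ

  Flowing : Edge → Set
  Flowing e = 0ℤ ℤ.< leftRegion e × rightRegion e ℤ.< 0ℤ

  OnPositiveSide OnNegativeSide : Edge → Set
  OnPositiveSide e = 0ℤ ℤ.< leftRegion e × 0ℤ ℤ.< rightRegion e
  OnNegativeSide e = leftRegion e ℤ.< 0ℤ × rightRegion e ℤ.< 0ℤ

IsPeriod : (ℤ → Turn) → ℕ → Set
IsPeriod t p = 0 ℕ.< p × (∀ i → t (i ℤ.+ + p) ≡ t i)

IsLeastPeriod : (ℤ → Turn) → ℕ → Set
IsLeastPeriod t p = IsPeriod t p × (∀ {p′} → IsPeriod t p′ → p ℕ.≤ p′)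

record River {q : Form} (𝒯 : Topograph q) : Set where
  open Topograph 𝒯
  field
    edge    : ℤ → Edge
    turns   : ℤ → Turn
    flowing : ∀ i → Flowing (edge i)
    flow    : ∀ i → edge (ℤ.suc i) ≡ turn (turns i) (edge i)

record PeriodTranslation {q : Form} {𝒯 : Topograph q} (ℛ : River 𝒯) : Set where
  open Topograph 𝒯
  open River ℛ
  field
    τ               : PlaneIso
    preserves-forms : ∀ e → f (PlaneIso.to τ e) ≡ f e
    period          : ℕ
    leastPeriod     : IsLeastPeriod turns period
    translates      : ∀ i → PlaneIso.to τ (edge i) ≡ edge (i ℤ.+ + period)

module _ {q₁ q₂ : Form} (𝒯₁ : Topograph q₁) (𝒯₂ : Topograph q₂) where
  private
    module 𝒯₁ = Topograph 𝒯₁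
    module 𝒯₂ = Topograph 𝒯₂

  -- The isomorphism goes from the tree of 𝒯₂ to that of 𝒯₁.
  module _ (φ : PlaneIso) where

    OnImage : Edge → Set
    OnImage e = 𝒯₂.OnRiver (PlaneIso.from φ e)

    Shared : Edge → Set
    Shared e = 𝒯₁.OnRiver e × OnImage e

    -- Both `entry` and `exit` point away from the shared path.
    record Crosses : Set where
      field
        first last     : Edge
        first-shared   : Shared first
        path           : Star (λ e e′ → Next e e′ × Shared e′) first last
        entry exit     : Edge
        before-first   : Next (bar first) entry
        after-last     : Next last exit
        entry-on-image : OnImage entry
        exit-on-image  : OnImage exit
        sides          : (𝒯₁.OnPositiveSide entry × 𝒯₁.OnNegativeSide exit)
                       ⊎ (𝒯₁.OnNegativeSide entry × 𝒯₁.OnPositiveSide exit)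

  CrossingSuperimposition : Set
  CrossingSuperimposition = Σ PlaneIso Crosses

module _ (τ : PlaneIso) where
  private
    open PlaneIso τ

    ^-suc : ∀ i e → (τ ^ ℤ.suc i) e ≡ to ((τ ^ i) e)
    ^-suc (+ n)              e = refl
    ^-suc -[1+ ℕ.zero ]      e = sym (strictlyInverseˡ e)
    ^-suc -[1+ ℕ.suc n ]     e = sym (strictlyInverseˡ _)

    ^-pred : ∀ i e → (τ ^ ℤ.pred i) e ≡ from ((τ ^ i) e)
    ^-pred (+ ℕ.zero)  e = refl
    ^-pred (+ ℕ.suc n) e = sym (strictlyInverseʳ _)
    ^-pred -[1+ n ]    e = refl

    ^-+ℕ : ∀ n j e → (τ ^ (+ n ℤ.+ j)) e ≡ fold ((τ ^ j) e) to n
    ^-+ℕ ℕ.zero    j e = cong (λ k → (τ ^ k) e) (ℤₚ.+-identityˡ j)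
    ^-+ℕ (ℕ.suc n) j e = begin
      (τ ^ (+ ℕ.suc n ℤ.+ j)) e   ≡⟨ cong (λ k → (τ ^ k) e) (ℤₚ.suc-+ n j) ⟩
      (τ ^ ℤ.suc (+ n ℤ.+ j)) e   ≡⟨ ^-suc (+ n ℤ.+ j) e ⟩
      to ((τ ^ (+ n ℤ.+ j)) e)    ≡⟨ cong to (^-+ℕ n j e) ⟩
      to (fold ((τ ^ j) e) to n)  ∎
      where open ≡-Reasoning

    ^-−ℕ : ∀ n j e → (τ ^ (ℤ.- (+ n) ℤ.+ j)) e ≡ fold ((τ ^ j) e) from n
    ^-−ℕ ℕ.zero    j e = cong (λ k → (τ ^ k) e) (ℤₚ.+-identityˡ j)
    ^-−ℕ (ℕ.suc n) j e = begin
      (τ ^ (-[1+ n ] ℤ.+ j)) e            ≡⟨ cong (λ k → (τ ^ (k ℤ.+ j)) e) (ℤₚ.neg-suc n) ⟩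
      (τ ^ (ℤ.pred (ℤ.- (+ n)) ℤ.+ j)) e  ≡⟨ cong (λ k → (τ ^ k) e) (ℤₚ.pred-+ (ℤ.- (+ n)) j) ⟩
      (τ ^ ℤ.pred (ℤ.- (+ n) ℤ.+ j)) e    ≡⟨ ^-pred (ℤ.- (+ n) ℤ.+ j) e ⟩
      from ((τ ^ (ℤ.- (+ n) ℤ.+ j)) e)    ≡⟨ cong from (^-−ℕ n j e) ⟩
      from (fold ((τ ^ j) e) from n)      ∎
      where open ≡-Reasoning

  ^-+ : ∀ i j e → (τ ^ (i ℤ.+ j)) e ≡ (τ ^ i) ((τ ^ j) e)
  ^-+ (+ n)    = ^-+ℕ n
  ^-+ -[1+ n ] = ^-−ℕ (ℕ.suc n)

  ^-neg : ∀ i e → (τ ^ (ℤ.- i)) ((τ ^ i) e) ≡ e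
  ^-neg i e = trans (sym (^-+ (ℤ.- i) i e)) (cong (λ k → (τ ^ k) e) (ℤₚ.+-inverseˡ i))

  ^-neg′ : ∀ i e → (τ ^ i) ((τ ^ (ℤ.- i)) e) ≡ e
  ^-neg′ i e = trans (sym (^-+ i (ℤ.- i) e)) (cong (λ k → (τ ^ k) e) (ℤₚ.+-inverseʳ i))

SameModulo : PlaneIso → PlaneIso → Rel PlaneIso 0ℓ
SameModulo τ₁ τ₂ φ φ′ =
  ∃[ a ] ∃[ b ] ∀ e → PlaneIso.to φ′ e ≡ (τ₁ ^ a) (PlaneIso.to φ ((τ₂ ^ b) e))

sameModulo-isEquivalence : ∀ τ₁ τ₂ → IsEquivalence (SameModulo τ₁ τ₂)
sameModulo-isEquivalence τ₁ τ₂ = record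
  { refl  = 0ℤ , 0ℤ , λ _ → refl
  ; sym   = λ {φ} {φ′} (a , b , h) → ℤ.- a , ℤ.- b , λ e → sym (begin
      (τ₁ ^ (ℤ.- a)) (to φ′ ((τ₂ ^ (ℤ.- b)) e))
        ≡⟨ cong (τ₁ ^ (ℤ.- a)) (h _) ⟩
      (τ₁ ^ (ℤ.- a)) ((τ₁ ^ a) (to φ ((τ₂ ^ b) ((τ₂ ^ (ℤ.- b)) e))))
        ≡⟨ ^-neg τ₁ a _ ⟩
      to φ ((τ₂ ^ b) ((τ₂ ^ (ℤ.- b)) e))
        ≡⟨ cong (to φ) (^-neg′ τ₂ b e) ⟩
      to φ e ∎)
  ; trans = λ {φ} {φ′} {φ″} (a , b , h) (a′ , b′ , h′) → a′ ℤ.+ a , b ℤ.+ b′ , λ e → begin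
      to φ″ e
        ≡⟨ h′ e ⟩
      (τ₁ ^ a′) (to φ′ ((τ₂ ^ b′) e))
        ≡⟨ cong (τ₁ ^ a′) (h _) ⟩
      (τ₁ ^ a′) ((τ₁ ^ a) (to φ ((τ₂ ^ b) ((τ₂ ^ b′) e))))
        ≡⟨ sym (^-+ τ₁ a′ a _) ⟩
      (τ₁ ^ (a′ ℤ.+ a)) (to φ ((τ₂ ^ b) ((τ₂ ^ b′) e)))
        ≡⟨ cong (λ x → (τ₁ ^ (a′ ℤ.+ a)) (to φ x)) (sym (^-+ τ₂ b b′ e)) ⟩
      (τ₁ ^ (a′ ℤ.+ a)) (to φ ((τ₂ ^ (b ℤ.+ b′)) e)) ∎
  }
  where
  open ≡-Reasoning
  open PlaneIso using (to)

crossings : ∀ {q₁ q₂} {𝒯₁ : Topograph q₁} {𝒯₂ : Topograph q₂} {ℛ₁ : River 𝒯₁} {ℛ₂ : River 𝒯₂} →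
            PeriodTranslation ℛ₁ → PeriodTranslation ℛ₂ → Setoid 0ℓ 0ℓ
crossings {𝒯₁ = 𝒯₁} {𝒯₂} P₁ P₂ = record
  { Carrier       = CrossingSuperimposition 𝒯₁ 𝒯₂
  ; _≈_           = SameModulo τ₁ τ₂ on proj₁
  ; isEquivalence = On.isEquivalence proj₁ (sameModulo-isEquivalence τ₁ τ₂)
  }
  where
  τ₁ = PeriodTranslation.τ P₁
  τ₂ = PeriodTranslation.τ P₂

private
  open import Data.Integer.Base using (_+_; _*_; _-_; -_)

  form-≡ : ∀ {A A′ B B′ C C′} → A ≡ A′ → B ≡ B′ → C ≡ C′ → [ A , B , C ] ≡ [ A′ , B′ , C′ ]
  form-≡ refl refl refl = refl

  S-coefficients : ∀ A B C → S ∘ [ A , B , C ] ≡ [ C , - B , A ]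
  S-coefficients A B C = form-≡ (eqᴬ A B C) (eqᴮ A B C) (eqᶜ A B C)
    where
    eqᴬ : ∀ A B C → A * (0ℤ * 0ℤ) + B * (0ℤ * -1ℤ) + C * (-1ℤ * -1ℤ) ≡ C
    eqᴬ = solve-∀
    eqᴮ : ∀ A B C → + 2 * A * (0ℤ * 1ℤ) + B * (0ℤ * 0ℤ + 1ℤ * -1ℤ) + + 2 * C * (-1ℤ * 0ℤ) ≡ - B
    eqᴮ = solve-∀
    eqᶜ : ∀ A B C → A * (1ℤ * 1ℤ) + B * (1ℤ * 0ℤ) + C * (0ℤ * 0ℤ) ≡ A
    eqᶜ = solve-∀

  T-coefficients : ∀ A B C → T ∘ [ A , B , C ] ≡ [ A , + 2 * A + B , A + B + C ]
  T-coefficients A B C = form-≡ (eqᴬ A B C) (eqᴮ A B C) (eqᶜ A B C)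
    where
    eqᴬ : ∀ A B C → A * (1ℤ * 1ℤ) + B * (1ℤ * 0ℤ) + C * (0ℤ * 0ℤ) ≡ A
    eqᴬ = solve-∀
    eqᴮ : ∀ A B C → + 2 * A * (1ℤ * 1ℤ) + B * (1ℤ * 1ℤ + 1ℤ * 0ℤ) + + 2 * C * (0ℤ * 1ℤ) ≡ + 2 * A + B
    eqᴮ = solve-∀
    eqᶜ : ∀ A B C → A * (1ℤ * 1ℤ) + B * (1ℤ * 1ℤ) + C * (1ℤ * 1ℤ) ≡ A + B + C
    eqᶜ = solve-∀

  TS-coefficients : ∀ A B C → T ∘ S ∘ [ A , B , C ] ≡ [ C , + 2 * C - B , C - B + A ]
  TS-coefficients A B C = trans (cong (T ∘_) (S-coefficients A B C)) (T-coefficients C (- B) A)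

  S² : ∀ q → q ≡ S ∘ S ∘ q
  S² [ A , B , C ] = sym (begin
    S ∘ S ∘ [ A , B , C ]  ≡⟨ cong (S ∘_) (S-coefficients A B C) ⟩
    S ∘ [ C , - B , A ]    ≡⟨ S-coefficients C (- B) A ⟩
    [ A , - - B , C ]      ≡⟨ cong (λ b → [ A , b , C ]) (ℤₚ.neg-involutive B) ⟩
    [ A , B , C ]          ∎)
    where open ≡-Reasoning

  [TS]²T : ∀ q → S ∘ q ≡ T ∘ S ∘ T ∘ S ∘ T ∘ q
  [TS]²T [ A , B , C ] = sym (begin
    T ∘ S ∘ T ∘ S ∘ T ∘ [ A , B , C ]
      ≡⟨ cong (λ q → T ∘ S ∘ T ∘ S ∘ q) (T-coefficients A B C) ⟩
    T ∘ S ∘ T ∘ S ∘ [ A , + 2 * A + B , A + B + C ]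
      ≡⟨ cong (λ q → T ∘ S ∘ q) (TS-coefficients A (+ 2 * A + B) (A + B + C)) ⟩
    T ∘ S ∘ [ A + B + C , + 2 * (A + B + C) - (+ 2 * A + B) , A + B + C - (+ 2 * A + B) + A ]
      ≡⟨ cong₂ (λ b c → T ∘ S ∘ [ A + B + C , b , c ]) (eq₁ A B C) (eq₂ A B C) ⟩
    T ∘ S ∘ [ A + B + C , B + + 2 * C , C ]
      ≡⟨ TS-coefficients (A + B + C) (B + + 2 * C) C ⟩
    [ C , + 2 * C - (B + + 2 * C) , C - (B + + 2 * C) + (A + B + C) ]
      ≡⟨ cong₂ (λ b a → [ C , b , a ]) (eq₃ B C) (eq₄ A B C) ⟩
    [ C , - B , A ]
      ≡⟨ sym (S-coefficients A B C) ⟩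
    S ∘ [ A , B , C ] ∎)
    where
    open ≡-Reasoning
    eq₁ : ∀ A B C → + 2 * (A + B + C) - (+ 2 * A + B) ≡ B + + 2 * C
    eq₁ = solve-∀
    eq₂ : ∀ A B C → A + B + C - (+ 2 * A + B) + A ≡ C
    eq₂ = solve-∀
    eq₃ : ∀ B C → + 2 * C - (B + + 2 * C) ≡ - B
    eq₃ = solve-∀
    eq₄ : ∀ A B C → C - (B + + 2 * C) + (A + B + C) ≡ A
    eq₄ = solve-∀

topograph : ∀ q → Topograph q
topograph q = record
  { f = f ; base = away forward [] ; f-base = refl ; f-bar = f-bar ; f-left = f-left }
  where
  outward : Orientation → List Turn → Form
  outward forward  []    = q
  outward backward []    = S ∘ q
  outward o      (L ∷ w) = T ∘ outward o w
  outward o      (R ∷ w) = T ∘ S ∘ T ∘ outward o w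

  f : Edge → Form
  f (away o w)     = outward o w
  f (toward o t w) = S ∘ outward o (t ∷ w)

  f-bar : ∀ e → f (bar e) ≡ S ∘ f e
  f-bar (away forward [])  = refl
  f-bar (away backward []) = S² q
  f-bar (away o (t ∷ w))   = refl
  f-bar (toward o t w)     = S² (outward o (t ∷ w))

  f-left : ∀ e → f (left e) ≡ T ∘ f e
  f-left (away forward w)      = refl
  f-left (away backward w)     = refl
  f-left (toward forward L w)  = refl
  f-left (toward backward L w) = refl
  f-left (toward forward R w)  = trans (f-bar (away forward w)) ([TS]²T (outward forward w))
  f-left (toward backward R w) = trans (f-bar (away backward w)) ([TS]²T (outward backward w))

{-# OPTIONS --safe #-}

-- Superimposing the two topographs by φ puts two labellings f and g of the edges
-- of one tree side by side, and the Jacobian determinants of f(e) and g(e) are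
-- again the labels of a topograph.  Its discriminant is four times the resultant
-- of the two forms, so that it is negative precisely when the roots of the forms
-- interlace, that is when the geodesics of f(e) and g(e) intersect.
--
-- If it is negative, the middle coefficient of the (definite) Jacobian grows
-- along the river of f, which forces g to pass from one sign through mixed signs
-- to the other sign: the rivers meet and cross.  Conversely, the sign of the
-- value of g at a root of f does not change along the river of f, and if the
-- rivers cross then these signs at the two roots of f are opposite.
--
-- Modulo the periods, a crossing superimposition is determined by the last shared
-- edge of the rivers and their relative direction, which makes the crossings
-- finite in number.  On the other side, φ corresponds to the form of q₁ seen from
-- the base edge of q₂, hence to a translate of the geodesic of q₁, and changing φ
-- by a period of q₂ applies a generator of the stabilizer of q₂ to the translate.
-- By minimality of the Pell solution this generator is the invariant automorph of
-- q₂ or its inverse, up to sign; it moves the intersection point along the geodesic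
-- of q₂ so as to multiply a quotient of distances by a constant greater than one.
-- Hence exactly one of the translates meets the given segment.

module Submission where

open import Defs
import Algebra.Properties.Monoid.Mult as MonoidMult
import Algebra.Properties.Ring as RingProperties
import Algebra.Properties.Semiring.Mult as SemiringMult
import Algebra.Solver.Ring as RingSolver
open import Algebra.Solver.Ring.AlmostCommutativeRing using (fromCommutativeRing; _-Raw-AlmostCommutative⟶_)
open import Data.Fin.Base as Fin using (Fin; zero; suc; toℕ; fromℕ<)
import Data.Fin.Properties as Finₚ
open import Data.Integer.Base as ℤ using (ℤ; +_; -[1+_]; 0ℤ; 1ℤ; -1ℤ)
import Data.Integer.DivMod as ℤᵈ
open import Data.Integer.GCD using (gcd)
import Data.Integer.Properties as ℤₚ
open import Data.Integer.Tactic.RingSolver using (solve-∀)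
open import Data.List.Base using (List; []; _∷_; _++_)
open import Data.Maybe.Base using (Maybe; just; nothing)
open import Data.Nat.Base as ℕ using (ℕ)
import Data.Nat.GCD as ℕᵍ
open import Data.Nat.GeneralisedArithmetic using (fold)
import Data.Nat.Properties as ℕₚ
open import Data.Product.Base using (Σ-syntax; ∃-syntax; _×_; _,_; proj₁; proj₂)
open import Data.Sum.Base using (_⊎_; inj₁; inj₂)
open import Function.Bundles using (_⇔_; mk⇔; mk↔ₛ′; module Bijection; module Equivalence)
open import Level using (_⊔_)
open import Relation.Binary.Construct.Closure.ReflexiveTransitive as Star using (Star; _◅_; _◅◅_)
open import Relation.Binary.Definitions using (tri<; tri≈; tri>)
open import Relation.Binary.PropositionalEquality hiding ([_])
import Relation.Binary.Reasoning.Setoid as SetoidReasoning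
open import Relation.Binary.Structures using (IsEquivalence; module IsStrictTotalOrder)
open import Relation.Nullary.Decidable using (Dec; yes; no; _×-dec_; ¬?)
open import Relation.Nullary.Negation using (¬_; contradiction)
open import Relation.Unary using (Decidable)

-- Two obstacles shape the proof. The translation of a river is known only through its turns, the
-- invariant automorph only through the size of a Pell solution. They are compared indirectly: the
-- automorph, written as a word in `S` and `T`, takes the base edge to an edge with the same form,
-- so it is a power of the translation up to sign; and no automorph has a multiplier strictly
-- between 1 and that of the smallest Pell solution. A comparison of geometric sequences then
-- settles the matter on the level of positions. Next, the field is merely Archimedean, so positions
-- on a geodesic are not parametrised by logarithms. They are quotients of squared distances from
-- the two ends, and lying on the half-open segment becomes a condition `X ≤ W < ρX`. The squares
-- are the reason why `ρ` is the fourth power of an eigenvalue. The number itself is produced on the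
-- tree, where everything is decidable: a unique last shared edge in each crossing leaves `2 p₁ p₂`
-- candidates to be tested by signs of integers. The intersections on the segment of an arbitrary
-- `z` are matched with the crossings, which yields the independence of `z` at once.

-- Binary quadratic forms: action, discriminant and Jacobian.

module FormAction where
  open import Data.Integer.Base using (_+_; _*_; _-_; -_)

  form-≡ : ∀ {A A′ B B′ C C′} → A ≡ A′ → B ≡ B′ → C ≡ C′ → [ A , B , C ] ≡ [ A′ , B′ , C′ ]
  form-≡ refl refl refl = refl

  matrix-≡ : ∀ {a a′ b b′ c c′ d d′} → a ≡ a′ → b ≡ b′ → c ≡ c′ → d ≡ d′ → mat a b c d ≡ mat a′ b′ c′ d′
  matrix-≡ refl refl refl refl = refl

  infixl 7 _⊗_
  _⊗_ : Matrix → Matrix → Matrix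
  mat a b c d ⊗ mat a′ b′ c′ d′ =
    mat (a * a′ + b * c′) (a * b′ + b * d′) (c * a′ + d * c′) (c * b′ + d * d′)

  det-⊗ : ∀ M N → det (M ⊗ N) ≡ det M * det N
  det-⊗ (mat a b c d) (mat a′ b′ c′ d′) = eq a b c d a′ b′ c′ d′
    where
    eq : ∀ a b c d a′ b′ c′ d′ →
         (a * a′ + b * c′) * (c * b′ + d * d′) - (a * b′ + b * d′) * (c * a′ + d * c′) ≡
         (a * d - b * c) * (a′ * d′ - b′ * c′)
    eq = solve-∀

  -- _∘_ computes on neutral forms, so that nested applications explode during
  -- conversion checking.
  infixr 8 _•_
  opaque
    _•_ : Matrix → Form → Form
    _•_ = _∘_

    •-∘ : ∀ M q → M • q ≡ M ∘ q
    •-∘ M q = refl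

  opaque
    unfolding _•_

    -- Substitution is a right action, so composition reverses the order of the matrices; words of
    -- generators are translated into products accordingly.
    •-• : ∀ M N q → M • N • q ≡ (N ⊗ M) • q
    •-• (mat a′ b′ c′ d′) (mat a b c d) [ A , B , C ] =
      form-≡ (value a b c d A B C a′ c′) (middle a b c d A B C a′ b′ c′ d′) (value a b c d A B C b′ d′)
      where
      value : ∀ a b c d A B C x y →
        (A * (a * a) + B * (a * c) + C * (c * c)) * (x * x)
          + (+ 2 * A * (a * b) + B * (a * d + b * c) + + 2 * C * (c * d)) * (x * y)
          + (A * (b * b) + B * (b * d) + C * (d * d)) * (y * y)
        ≡ A * ((a * x + b * y) * (a * x + b * y)) + B * ((a * x + b * y) * (c * x + d * y))
          + C * ((c * x + d * y) * (c * x + d * y))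
      value = solve-∀
      middle : ∀ a b c d A B C a′ b′ c′ d′ →
        + 2 * (A * (a * a) + B * (a * c) + C * (c * c)) * (a′ * b′)
          + (+ 2 * A * (a * b) + B * (a * d + b * c) + + 2 * C * (c * d)) * (a′ * d′ + b′ * c′)
          + + 2 * (A * (b * b) + B * (b * d) + C * (d * d)) * (c′ * d′)
        ≡ + 2 * A * ((a * a′ + b * c′) * (a * b′ + b * d′))
          + B * ((a * a′ + b * c′) * (c * b′ + d * d′) + (a * b′ + b * d′) * (c * a′ + d * c′))
          + + 2 * C * ((c * a′ + d * c′) * (c * b′ + d * d′))
      middle = solve-∀

    identity-• : ∀ q → mat 1ℤ 0ℤ 0ℤ 1ℤ • q ≡ q
    identity-• [ A , B , C ] = form-≡ (eqᴬ A B C) (eqᴮ A B C) (eqᶜ A B C)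
      where
      eqᴬ : ∀ A B C → A * (1ℤ * 1ℤ) + B * (1ℤ * 0ℤ) + C * (0ℤ * 0ℤ) ≡ A
      eqᴬ = solve-∀
      eqᴮ : ∀ A B C → + 2 * A * (1ℤ * 0ℤ) + B * (1ℤ * 1ℤ + 0ℤ * 0ℤ) + + 2 * C * (0ℤ * 1ℤ) ≡ B
      eqᴮ = solve-∀
      eqᶜ : ∀ A B C → A * (0ℤ * 0ℤ) + B * (0ℤ * 1ℤ) + C * (1ℤ * 1ℤ) ≡ C
      eqᶜ = solve-∀

    negation-• : ∀ M q → (mat -1ℤ 0ℤ 0ℤ -1ℤ ⊗ M) • q ≡ M • q
    negation-• M q = trans (sym (•-• M (mat -1ℤ 0ℤ 0ℤ -1ℤ) q)) (cong (M •_) (neg q))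
      where
      eqᴬ : ∀ A B C → A * (-1ℤ * -1ℤ) + B * (-1ℤ * 0ℤ) + C * (0ℤ * 0ℤ) ≡ A
      eqᴬ = solve-∀
      eqᴮ : ∀ A B C → + 2 * A * (-1ℤ * 0ℤ) + B * (-1ℤ * -1ℤ + 0ℤ * 0ℤ) + + 2 * C * (0ℤ * -1ℤ) ≡ B
      eqᴮ = solve-∀
      eqᶜ : ∀ A B C → A * (0ℤ * 0ℤ) + B * (0ℤ * -1ℤ) + C * (-1ℤ * -1ℤ) ≡ C
      eqᶜ = solve-∀
      neg : ∀ q → mat -1ℤ 0ℤ 0ℤ -1ℤ • q ≡ q
      neg [ A , B , C ] = form-≡ (eqᴬ A B C) (eqᴮ A B C) (eqᶜ A B C)

    S-• : ∀ A B C → S • [ A , B , C ] ≡ [ C , - B , A ]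
    S-• A B C = form-≡ (eqᴬ A B C) (eqᴮ A B C) (eqᶜ A B C)
      where
      eqᴬ : ∀ A B C → A * (0ℤ * 0ℤ) + B * (0ℤ * -1ℤ) + C * (-1ℤ * -1ℤ) ≡ C
      eqᴬ = solve-∀
      eqᴮ : ∀ A B C → + 2 * A * (0ℤ * 1ℤ) + B * (0ℤ * 0ℤ + 1ℤ * -1ℤ) + + 2 * C * (-1ℤ * 0ℤ) ≡ - B
      eqᴮ = solve-∀
      eqᶜ : ∀ A B C → A * (1ℤ * 1ℤ) + B * (1ℤ * 0ℤ) + C * (0ℤ * 0ℤ) ≡ A
      eqᶜ = solve-∀

    T-• : ∀ A B C → T • [ A , B , C ] ≡ [ A , + 2 * A + B , A + B + C ]
    T-• A B C = form-≡ (eqᴬ A B C) (eqᴮ A B C) (eqᶜ A B C)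
      where
      eqᴬ : ∀ A B C → A * (1ℤ * 1ℤ) + B * (1ℤ * 0ℤ) + C * (0ℤ * 0ℤ) ≡ A
      eqᴬ = solve-∀
      eqᴮ : ∀ A B C → + 2 * A * (1ℤ * 1ℤ) + B * (1ℤ * 1ℤ + 1ℤ * 0ℤ) + + 2 * C * (0ℤ * 1ℤ) ≡ + 2 * A + B
      eqᴮ = solve-∀
      eqᶜ : ∀ A B C → A * (1ℤ * 1ℤ) + B * (1ℤ * 1ℤ) + C * (1ℤ * 1ℤ) ≡ A + B + C
      eqᶜ = solve-∀

  TST-• : ∀ A B C → T • S • T • [ A , B , C ] ≡ [ A + B + C , B + + 2 * C , C ]
  TST-• A B C = begin
    T • S • T • [ A , B , C ]                         ≡⟨ cong (λ q → T • S • q) (T-• A B C) ⟩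
    T • S • [ A , + 2 * A + B , A + B + C ]           ≡⟨ cong (T •_) (S-• A (+ 2 * A + B) (A + B + C)) ⟩
    T • [ A + B + C , - (+ 2 * A + B) , A ]           ≡⟨ T-• (A + B + C) (- (+ 2 * A + B)) A ⟩
    [ A + B + C , + 2 * (A + B + C) + - (+ 2 * A + B) , A + B + C + - (+ 2 * A + B) + A ]
      ≡⟨ form-≡ refl (eq₁ A B C) (eq₂ A B C) ⟩
    [ A + B + C , B + + 2 * C , C ] ∎
    where
    open ≡-Reasoning
    eq₁ : ∀ A B C → + 2 * (A + B + C) + - (+ 2 * A + B) ≡ B + + 2 * C
    eq₁ = solve-∀
    eq₂ : ∀ A B C → A + B + C + - (+ 2 * A + B) + A ≡ C
    eq₂ = solve-∀

  disc-S : ∀ q → disc (S • q) ≡ disc q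
  disc-S [ A , B , C ] = trans (cong disc (S-• A B C)) (eq A B C)
    where
    eq : ∀ A B C → - B * - B - + 4 * C * A ≡ B * B - + 4 * A * C
    eq = solve-∀

  disc-T : ∀ q → disc (T • q) ≡ disc q
  disc-T [ A , B , C ] = trans (cong disc (T-• A B C)) (eq A B C)
    where
    eq : ∀ A B C → (+ 2 * A + B) * (+ 2 * A + B) - + 4 * A * (A + B + C) ≡ B * B - + 4 * A * C
    eq = solve-∀

  -- The Jacobian determinant of two forms; its discriminant is 4 times their
  -- resultant.
  jac : Form → Form → Form
  jac [ a , b , c ] [ A , B , C ] = [ a * B - A * b , + 2 * (a * C - A * c) , b * C - B * c ]

  -- The Jacobian determinant is covariant under substitutions of determinant one. Checking the two
  -- generators makes it a labelling of the tree.
  jac-S : ∀ q q′ → jac (S • q) (S • q′) ≡ S • jac q q′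
  jac-S [ a , b , c ] [ A , B , C ] =
    trans (cong₂ jac (S-• a b c) (S-• A B C)) (trans
      (form-≡ (eqᴬ b c B C) (eqᴮ a c A C) (eqᶜ a b A B))
      (sym (S-• (a * B - A * b) (+ 2 * (a * C - A * c)) (b * C - B * c))))
    where
    eqᴬ : ∀ b c B C → c * - B - C * - b ≡ b * C - B * c
    eqᴬ = solve-∀
    eqᶜ : ∀ a b A B → - b * A - - B * a ≡ a * B - A * b
    eqᶜ = solve-∀
    eqᴮ : ∀ a c A C → + 2 * (c * A - C * a) ≡ - (+ 2 * (a * C - A * c))
    eqᴮ = solve-∀

  jac-T : ∀ q q′ → jac (T • q) (T • q′) ≡ T • jac q q′
  jac-T [ a , b , c ] [ A , B , C ] =
    trans (cong₂ jac (T-• a b c) (T-• A B C)) (trans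
      (form-≡ (eqᴬ a b A B) (eqᴮ a b c A B C) (eqᶜ a b c A B C))
      (sym (T-• (a * B - A * b) (+ 2 * (a * C - A * c)) (b * C - B * c))))
    where
    eqᴬ : ∀ a b A B → a * (+ 2 * A + B) - A * (+ 2 * a + b) ≡ a * B - A * b
    eqᴬ = solve-∀
    eqᴮ : ∀ a b c A B C → + 2 * (a * (A + B + C) - A * (a + b + c)) ≡
                          + 2 * (a * B - A * b) + + 2 * (a * C - A * c)
    eqᴮ = solve-∀
    eqᶜ : ∀ a b c A B C → (+ 2 * a + b) * (A + B + C) - (+ 2 * A + B) * (a + b + c) ≡
                          a * B - A * b + + 2 * (a * C - A * c) + (b * C - B * c)
    eqᶜ = solve-∀

  -- The roots of the two forms interlace.
  Crossing : Form → Form → Set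
  Crossing q q′ = disc (jac q q′) ℤ.< 0ℤ

  negate : Form → Form
  negate [ A , B , C ] = [ - A , - B , - C ]

  negate-S : ∀ q → negate (S • q) ≡ S • negate q
  negate-S [ A , B , C ] = trans (cong negate (S-• A B C)) (sym (S-• (- A) (- B) (- C)))

  negate-T : ∀ q → negate (T • q) ≡ T • negate q
  negate-T [ A , B , C ] = trans (cong negate (T-• A B C))
    (trans (form-≡ refl (eqᴮ A B) (eqᶜ A B C)) (sym (T-• (- A) (- B) (- C))))
    where
    eqᴮ : ∀ A B → - (+ 2 * A + B) ≡ + 2 * - A + - B
    eqᴮ = solve-∀
    eqᶜ : ∀ A B C → - (A + B + C) ≡ - A + - B + - C
    eqᶜ = solve-∀

  -- The resultant is quadratic in either form, so crossing is insensitive to their signs; this is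
  -- what allows all later sign normalisations.
  disc-jac-negateˡ : ∀ q q′ → disc (jac (negate q) q′) ≡ disc (jac q q′)
  disc-jac-negateˡ [ a , b , c ] [ A , B , C ] = eq a b c A B C
    where
    eq : ∀ a b c A B C →
      (+ 2 * (- a * C - A * - c)) * (+ 2 * (- a * C - A * - c)) - + 4 * (- a * B - A * - b) * (- b * C - B * - c)
      ≡ (+ 2 * (a * C - A * c)) * (+ 2 * (a * C - A * c)) - + 4 * (a * B - A * b) * (b * C - B * c)
    eq = solve-∀

  disc-jac-negateʳ : ∀ q q′ → disc (jac q (negate q′)) ≡ disc (jac q q′)
  disc-jac-negateʳ [ a , b , c ] [ A , B , C ] = eq a b c A B C
    where
    eq : ∀ a b c A B C →
      (+ 2 * (a * - C - - A * c)) * (+ 2 * (a * - C - - A * c)) - + 4 * (a * - B - - A * b) * (b * - C - - B * c)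
      ≡ (+ 2 * (a * C - A * c)) * (+ 2 * (a * C - A * c)) - + 4 * (a * B - A * b) * (b * C - B * c)
    eq = solve-∀

-- The planar tree, its isomorphisms and its labellings.

module Tree where
  open FormAction

  -- `bar` and `left` correspond to `S` and `T`. A word of moves, its last letter acting first, acts
  -- compatibly on edges and on forms, and any oriented edge leads to any other by some word, so
  -- facts about the tree become facts about words.
  data Move : Set where
    flip ahead : Move

  move : Move → Edge → Edge
  move flip  = bar
  move ahead = left

  moveᶠ : Move → Form → Form
  moveᶠ flip  = S •_
  moveᶠ ahead = T •_

  act : List Move → Edge → Edge
  act []      e = e
  act (m ∷ v) e = move m (act v e)

  actᶠ : List Move → Form → Form
  actᶠ []      q = q
  actᶠ (m ∷ v) q = moveᶠ m (actᶠ v q)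

  act-++ : ∀ v w e → act (v ++ w) e ≡ act v (act w e)
  act-++ []      w e = refl
  act-++ (m ∷ v) w e = cong (move m) (act-++ v w e)

  actᶠ-++ : ∀ v w q → actᶠ (v ++ w) q ≡ actᶠ v (actᶠ w q)
  actᶠ-++ []      w q = refl
  actᶠ-++ (m ∷ v) w q = cong (moveᶠ m) (actᶠ-++ v w q)

  bar-involutive : ∀ e → bar (bar e) ≡ e
  bar-involutive (away forward [])  = refl
  bar-involutive (away backward []) = refl
  bar-involutive (away o (t ∷ w))   = refl
  bar-involutive (toward o t w)     = refl

  -- Reversing and then turning left rotates the three edges that leave a vertex; this is the
  -- relation of order three in the modular group.
  left-bar-cubed : ∀ e → left (bar (left (bar (left (bar e))))) ≡ e
  left-bar-cubed (away forward [])  = refl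
  left-bar-cubed (away backward []) = refl
  left-bar-cubed (away o (L ∷ w))   = cong left (bar-involutive (away o w))
  left-bar-cubed (away o (R ∷ w))   = cong (λ e → left (bar (left e))) (bar-involutive (away o w))
  left-bar-cubed (toward o L w)     = refl
  left-bar-cubed (toward o R w)     = refl

  left-bar-right : ∀ e → left (bar (right e)) ≡ bar e
  left-bar-right e = begin
    left (bar (left (bar (left e))))             
        ≡⟨ cong (λ x → left (bar (left (bar (left x))))) (bar-involutive e) ⟨
    left (bar (left (bar (left (bar (bar e))))))  ≡⟨ left-bar-cubed (bar e) ⟩
    bar e                                         ∎
    where open ≡-Reasoning

  right-bar-right : ∀ e → right (bar (right e)) ≡ left e
  right-bar-right e = cong left (trans (cong bar (left-bar-right e)) (bar-involutive e))

  -- `left` is a reversal followed by the rotation of order three about a vertex. Its inverse is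
  -- therefore the square of that rotation followed by a reversal.
  unleft : List Move
  unleft = flip ∷ ahead ∷ flip ∷ ahead ∷ flip ∷ []

  act-unleft : ∀ e → act unleft (left e) ≡ e
  act-unleft e = trans (cong bar (left-bar-right e)) (bar-involutive e)

  turnWord : Turn → List Move
  turnWord L = ahead ∷ []
  turnWord R = ahead ∷ flip ∷ ahead ∷ []

  act-turnWord : ∀ t e → act (turnWord t) e ≡ turn t e
  act-turnWord L e = refl
  act-turnWord R e = refl

  root : Edge
  root = away forward []

  turn-away : ∀ t o w → turn t (away o w) ≡ away o (t ∷ w)
  turn-away L o w = refl
  turn-away R o w = refl

  from-root-away : ∀ o w → ∃[ v ] act v root ≡ away o w
  from-root-away forward  []      = [] , refl
  from-root-away backward []      = flip ∷ [] , refl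
  from-root-away o        (t ∷ w) with v , eq ← from-root-away o w =
    turnWord t ++ v , trans (act-++ (turnWord t) v root)
      (trans (act-turnWord t _) (trans (cong (turn t) eq) (turn-away t o w)))

  from-root : ∀ e → ∃[ v ] act v root ≡ e
  from-root (away o w)     = from-root-away o w
  from-root (toward o t w) with v , eq ← from-root-away o (t ∷ w) = flip ∷ v , cong bar eq

  undo : List Move → List Move
  undo []          = []
  undo (flip ∷ v)  = undo v ++ flip ∷ []
  undo (ahead ∷ v) = undo v ++ unleft

  act-undo : ∀ v e → act (undo v) (act v e) ≡ e
  act-undo []          e = refl
  act-undo (flip ∷ v)  e = trans (act-++ (undo v) (flip ∷ []) _)
    (trans (cong (act (undo v)) (bar-involutive _)) (act-undo v e))
  act-undo (ahead ∷ v) e = trans (act-++ (undo v) unleft _)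
    (trans (cong (act (undo v)) (act-unleft _)) (act-undo v e))

  connected : ∀ e e′ → ∃[ v ] act v e ≡ e′
  connected e e′ with v , refl ← from-root e | w , refl ← from-root e′ =
    w ++ undo v , trans (act-++ w (undo v) _) (cong (act w) (act-undo v root))

  module _ (φ : PlaneIso) where
    open PlaneIso φ

    to-move : ∀ m e → to (move m e) ≡ move m (to e)
    to-move flip  = to-bar
    to-move ahead = to-left

    to-act : ∀ v e → to (act v e) ≡ act v (to e)
    to-act []      e = refl
    to-act (m ∷ v) e = trans (to-move m _) (cong (move m) (to-act v e))

    to-turn : ∀ t e → to (turn t e) ≡ turn t (to e)
    to-turn t e = trans (cong to (sym (act-turnWord t e))) (trans (to-act (turnWord t) e) (act-turnWord t _))

    from-move : ∀ m e → from (move m e) ≡ move m (from e)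
    from-move m e = begin
      from (move m e)              ≡⟨ cong (λ x → from (move m x)) (strictlyInverseˡ e) ⟨
      from (move m (to (from e)))  ≡⟨ cong from (to-move m (from e)) ⟨
      from (to (move m (from e)))  ≡⟨ strictlyInverseʳ _ ⟩
      move m (from e)              ∎
      where open ≡-Reasoning

    to-from : ∀ {e e′} → to e ≡ e′ → from e′ ≡ e
    to-from refl = strictlyInverseʳ _

  -- Isomorphisms commute with moves, and moves are transitive on oriented edges, so the image of
  -- one edge determines all others.
  to-≗ : ∀ φ ψ {e} → PlaneIso.to φ e ≡ PlaneIso.to ψ e → ∀ e′ → PlaneIso.to φ e′ ≡ PlaneIso.to ψ e′
  to-≗ φ ψ {e} eq e′ with v , refl ← connected e e′ =
    trans (to-act φ v e) (trans (cong (act v) eq) (sym (to-act ψ v e)))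

  -- The extension of `root ↦ e` to the whole tree: an edge is encoded by its turns from the root,
  -- and the same turns are made starting from `e`.
  developAway : Edge → List Turn → Orientation → Edge
  developAway e []      forward  = e
  developAway e []      backward = bar e
  developAway e (t ∷ w) o        = turn t (developAway e w o)

  develop : Edge → Edge → Edge
  develop e (away o w)     = developAway e w o
  develop e (toward o t w) = bar (turn t (developAway e w o))

  develop-bar : ∀ e x → develop e (bar x) ≡ bar (develop e x)
  develop-bar e (away forward [])  = refl
  develop-bar e (away backward []) = sym (bar-involutive e)
  develop-bar e (away o (t ∷ w))   = refl
  develop-bar e (toward o t w)     = sym (bar-involutive _)

  develop-left : ∀ e x → develop e (left x) ≡ left (develop e x)
  develop-left e (away forward w)  = refl
  develop-left e (away backward w) = refl
  develop-left e (toward o L w)    = refl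
  develop-left e (toward o R w)    = trans (develop-bar e (away o w)) (sym (left-bar-right _))

  develop-act : ∀ e v x → develop e (act v x) ≡ act v (develop e x)
  develop-act e []          x = refl
  develop-act e (flip ∷ v)  x = trans (develop-bar e (act v x)) (cong bar (develop-act e v x))
  develop-act e (ahead ∷ v) x = trans (develop-left e (act v x)) (cong left (develop-act e v x))

  -- A word leading from `e` to `root`, applied to `root`, yields the edge that `develop e` sends to
  -- `root`; developing from it inverts `develop e`.
  developed : Edge → Edge
  developed e = act (proj₁ (connected e root)) root

  develop-developed : ∀ e x → develop e (develop (developed e) x) ≡ x
  develop-developed e x with w , refl ← from-root x = begin
    develop e (develop (developed e) (act w root))
      ≡⟨ cong (develop e) (develop-act (developed e) w root) ⟩
    develop e (act w (developed e))
      ≡⟨ develop-act e w (developed e) ⟩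
    act w (develop e (act (proj₁ (connected e root)) root))
      ≡⟨ cong (act w) (develop-act e (proj₁ (connected e root)) root) ⟩
    act w (act (proj₁ (connected e root)) e)
      ≡⟨ cong (act w) (proj₂ (connected e root)) ⟩
    act w root ∎
    where open ≡-Reasoning

  -- `develop (developed e)` has `develop e` as a left inverse and, by the previous lemma applied to
  -- `developed e`, also a right inverse; the two must coincide.
  developed-develop : ∀ e x → develop (developed e) (develop e x) ≡ x
  developed-develop e x = begin
    develop e′ (develop e x)                           
        ≡⟨ cong (λ y → develop e′ (develop e y)) (develop-developed e′ x) ⟨
    develop e′ (develop e (develop e′ (develop e″ x)))  ≡⟨ cong (develop e′) (develop-developed e (develop e″ x)) ⟩
    develop e′ (develop e″ x)                           ≡⟨ develop-developed e′ x ⟩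
    x                                                   ∎
    where
    open ≡-Reasoning
    e′ = developed e
    e″ = developed e′

  fromRoot : Edge → PlaneIso
  fromRoot e = record
    { edges   = mk↔ₛ′ (develop e) (develop (developed e)) (develop-developed e) (developed-develop e)
    ; to-bar  = develop-bar e
    ; to-left = develop-left e
    }

  inverse : PlaneIso → PlaneIso
  inverse φ = record
    { edges   = mk↔ₛ′ from to strictlyInverseʳ strictlyInverseˡ
    ; to-bar  = from-move φ flip
    ; to-left = from-move φ ahead
    }
    where open PlaneIso φ

  infixr 9 _∙_
  _∙_ : PlaneIso → PlaneIso → PlaneIso
  φ ∙ ψ = record
    { edges   = mk↔ₛ′ (λ e → φ.to (ψ.to e)) (λ e → ψ.from (φ.from e))
                  (λ e → trans (cong φ.to (ψ.strictlyInverseˡ _)) (φ.strictlyInverseˡ e))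
                  (λ e → trans (cong ψ.from (φ.strictlyInverseʳ _)) (ψ.strictlyInverseʳ e))
    ; to-bar  = λ e → trans (cong φ.to (ψ.to-bar e)) (φ.to-bar _)
    ; to-left = λ e → trans (cong φ.to (ψ.to-left e)) (φ.to-left _)
    }
    where
    module φ = PlaneIso φ
    module ψ = PlaneIso ψ

  carry : Edge → Edge → PlaneIso
  carry e e′ = fromRoot e′ ∙ inverse (fromRoot e)

  to-carry : ∀ e e′ → PlaneIso.to (carry e e′) e ≡ e′
  to-carry e e′ = cong (develop e′) (developed-develop e root)

  power : PlaneIso → ℤ → PlaneIso
  power τ k = record
    { edges   = mk↔ₛ′ (τ ^ k) (τ ^ (ℤ.- k)) (^-neg′ τ k) (^-neg τ k)
    ; to-bar  = commutes flip k
    ; to-left = commutes ahead k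
    }
    where
    fold-commutes : ∀ (g : Edge → Edge) m → (∀ e → g (move m e) ≡ move m (g e)) →
                    ∀ n e → fold (move m e) g n ≡ move m (fold e g n)
    fold-commutes g m h ℕ.zero    e = refl
    fold-commutes g m h (ℕ.suc n) e = trans (cong g (fold-commutes g m h n e)) (h _)

    commutes : ∀ m k e → (τ ^ k) (move m e) ≡ move m ((τ ^ k) e)
    commutes m (+ n)    = fold-commutes _ m (to-move τ m) n
    commutes m -[1+ n ] = fold-commutes _ m (from-move τ m) (ℕ.suc n)

  -- A topograph with its base forgotten. The notion is closed under pullback, Jacobian and change
  -- of sign, so the sign arguments apply to all of these at once.
  record Labelling : Set where
    field
      f      : Edge → Form
      f-bar  : ∀ e → f (bar e) ≡ S • f e
      f-left : ∀ e → f (left e) ≡ T • f e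

    f-act : ∀ v e → f (act v e) ≡ actᶠ v (f e)
    f-act []          e = refl
    f-act (flip ∷ v)  e = trans (f-bar _) (cong (S •_) (f-act v e))
    f-act (ahead ∷ v) e = trans (f-left _) (cong (T •_) (f-act v e))

    f-right : ∀ e → f (right e) ≡ T • S • T • f e
    f-right = f-act (turnWord R)

    invariant : ∀ {a} {X : Set a} (h : Form → X) → (∀ q → h (S • q) ≡ h q) → (∀ q → h (T • q) ≡ h q) →
                ∀ e e′ → h (f e) ≡ h (f e′)
    invariant h h-S h-T e e′ with v , refl ← connected e e′ = sym (trans (cong h (f-act v e)) (go v (f e)))
      where
      go : ∀ v q → h (actᶠ v q) ≡ h q
      go []          q = refl
      go (flip ∷ v)  q = trans (h-S _) (go v q)
      go (ahead ∷ v) q = trans (h-T _) (go v q)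

    f-disc : ∀ e e′ → disc (f e) ≡ disc (f e′)
    f-disc = invariant disc disc-S disc-T

  labelling : ∀ {q} → Topograph q → Labelling
  labelling 𝒯 = record
    { f      = f
    ; f-bar  = λ e → trans (f-bar e) (sym (•-∘ S (f e)))
    ; f-left = λ e → trans (f-left e) (sym (•-∘ T (f e)))
    }
    where open Topograph 𝒯

  pullback : Labelling → PlaneIso → Labelling
  pullback 𝒻 φ = record
    { f      = λ e → f (to e)
    ; f-bar  = λ e → trans (cong f (to-bar e)) (f-bar _)
    ; f-left = λ e → trans (cong f (to-left e)) (f-left _)
    }
    where
    open Labelling 𝒻
    open PlaneIso φ

  jacobian : Labelling → Labelling → Labelling
  jacobian 𝒻 ℊ = record
    { f      = λ e → jac (𝒻.f e) (ℊ.f e)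
    ; f-bar  = λ e → trans (cong₂ jac (𝒻.f-bar e) (ℊ.f-bar e)) (jac-S (𝒻.f e) (ℊ.f e))
    ; f-left = λ e → trans (cong₂ jac (𝒻.f-left e) (ℊ.f-left e)) (jac-T (𝒻.f e) (ℊ.f e))
    }
    where
    module 𝒻 = Labelling 𝒻
    module ℊ = Labelling ℊ

  negation : Labelling → Labelling
  negation 𝒻 = record
    { f      = λ e → negate (f e)
    ; f-bar  = λ e → trans (cong negate (f-bar e)) (negate-S (f e))
    ; f-left = λ e → trans (cong negate (f-left e)) (negate-T (f e))
    }
    where open Labelling 𝒻

-- Generation of the modular group by `S` and `T`.

module ModularGroup where
  open FormAction
  open Tree
  open import Data.Integer.Base using (_+_; _*_; _-_; -_)

  opaque
    matrixOf : ∀ v → Σ[ M ∈ Matrix ] det M ≡ 1ℤ × (∀ q → actᶠ v q ≡ M • q)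
    matrixOf []      = mat 1ℤ 0ℤ 0ℤ 1ℤ , refl , λ q → sym (identity-• q)
    matrixOf (m ∷ v) with M , det≡1 , eq ← matrixOf v =
      M ⊗ generator m ,
      trans (det-⊗ M (generator m)) (cong₂ _*_ det≡1 (det-generator m)) ,
      λ q → trans (cong (moveᶠ m) (eq q)) (trans (moveᶠ≡ m (M • q)) (•-• (generator m) M q))
      where
      generator : Move → Matrix
      generator flip  = S
      generator ahead = T
      det-generator : ∀ m → det (generator m) ≡ 1ℤ
      det-generator flip  = refl
      det-generator ahead = refl
      moveᶠ≡ : ∀ m q → moveᶠ m q ≡ generator m • q
      moveᶠ≡ flip  q = refl
      moveᶠ≡ ahead q = refl

  ActsAsWord : Matrix → Set
  ActsAsWord M = ∃[ v ] ∀ q → actᶠ v q ≡ M • q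

  shear : ℤ → Matrix
  shear k = mat 1ℤ k 0ℤ 1ℤ

  shear-+ : ∀ j k q → shear j • shear k • q ≡ shear (j ℤ.+ k) • q
  shear-+ j k q = trans (•-• (shear j) (shear k) q) (cong (_• q) (matrix-≡ (e₁ k) (e₂ j k) (e₃ k) (e₄ j)))
    where
    e₁ : ∀ k → 1ℤ * 1ℤ + k * 0ℤ ≡ 1ℤ
    e₁ = solve-∀
    e₂ : ∀ j k → 1ℤ * j + k * 1ℤ ≡ j + k
    e₂ = solve-∀
    e₃ : ∀ (k : ℤ) → 0ℤ * 1ℤ + 1ℤ * 0ℤ ≡ 0ℤ
    e₃ = solve-∀
    e₄ : ∀ j → 0ℤ * j + 1ℤ * 1ℤ ≡ 1ℤ
    e₄ = solve-∀

  module _ where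
    open ≡-Reasoning

    actᶠ-unleft : ∀ q → actᶠ unleft q ≡ shear -1ℤ • q
    actᶠ-unleft q = begin
      S • T • S • T • S • q      ≡⟨ cong (λ q → S • T • S • q) (•-• T S q) ⟩
      S • T • S • (S ⊗ T) • q    ≡⟨ cong (λ q → S • T • q) (•-• S (S ⊗ T) q) ⟩
      S • T • (S ⊗ T ⊗ S) • q    ≡⟨ cong (S •_) (•-• T (S ⊗ T ⊗ S) q) ⟩
      S • (S ⊗ T ⊗ S ⊗ T) • q    ≡⟨ •-• S (S ⊗ T ⊗ S ⊗ T) q ⟩
      (S ⊗ T ⊗ S ⊗ T ⊗ S) • q    ≡⟨ cong (_• q) {S ⊗ T ⊗ S ⊗ T ⊗ S} {shear -1ℤ} refl ⟩
      shear -1ℤ • q              ∎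

    shear-word : ∀ k → ActsAsWord (shear k)
    shear-word (+ ℕ.zero)      = [] , λ q → sym (identity-• q)
    shear-word (+ ℕ.suc n)     with v , eq ← shear-word (+ n) = ahead ∷ v , λ q → begin
      T • actᶠ v q                 ≡⟨ cong (T •_) (eq q) ⟩
      T • shear (+ n) • q          ≡⟨ cong (_• shear (+ n) • q) {T} {shear 1ℤ} refl ⟩
      shear 1ℤ • shear (+ n) • q   ≡⟨ shear-+ 1ℤ (+ n) q ⟩
      shear (1ℤ ℤ.+ + n) • q       ≡⟨ cong (λ k → shear k • q) {1ℤ ℤ.+ + n} {+ ℕ.suc n} refl ⟩
      shear (+ ℕ.suc n) • q        ∎
    shear-word -[1+ ℕ.zero ]   = unleft , actᶠ-unleft
    shear-word -[1+ ℕ.suc n ]  with v , eq ← shear-word -[1+ n ] = unleft ++ v , λ q → begin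
      actᶠ (unleft ++ v) q            ≡⟨ actᶠ-++ unleft v q ⟩
      actᶠ unleft (actᶠ v q)          ≡⟨ cong (actᶠ unleft) (eq q) ⟩
      actᶠ unleft (shear -[1+ n ] • q)    ≡⟨ actᶠ-unleft (shear -[1+ n ] • q) ⟩
      shear -1ℤ • shear -[1+ n ] • q  ≡⟨ shear-+ -1ℤ -[1+ n ] q ⟩
      shear (-1ℤ ℤ.+ -[1+ n ]) • q    ≡⟨ cong (λ k → shear k • q) { -1ℤ ℤ.+ -[1+ n ]} { -[1+ ℕ.suc n ]} refl ⟩
      shear -[1+ ℕ.suc n ] • q        ∎

  unit : ∀ i j → i * j ≡ 1ℤ → (i ≡ 1ℤ × j ≡ 1ℤ) ⊎ (i ≡ -1ℤ × j ≡ -1ℤ)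
  unit i j eq with ∣i∣≡1 ← ℕₚ.m*n≡1⇒m≡1 ℤ.∣ i ∣ ℤ.∣ j ∣ (trans (sym (ℤₚ.abs-* i j)) (cong ℤ.∣_∣ eq)) with i | ∣i∣≡1
  ... | + .1        | refl = inj₁ (refl , trans (sym (ℤₚ.*-identityˡ j)) eq)
  ... | -[1+ .0 ]   | refl = inj₂
      (refl , trans (sym (ℤₚ.neg-involutive j)) (cong (λ i → - i) (trans (sym (ℤₚ.-1*i≡-i j)) eq)))

  euclid-det : ∀ a b c k r → (k * a - b) * c - a * - r ≡ a * (r + k * c) - b * c
  euclid-det = solve-∀

  -- One division step: up to sign the matrix factors as a matrix with lower left entry `- r`, then
  -- `S`, then a shear by the quotient `k`. The sign is invisible to forms.
  euclid-step : ∀ a b c d k r → d ≡ + r + k * c →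
    (det (mat (k * a - b) a (- + r) c) ≡ 1ℤ → ActsAsWord (mat (k * a - b) a (- + r) c)) →
    det (mat a b c d) ≡ 1ℤ → ActsAsWord (mat a b c d)
  euclid-step a b c .(+ r + k * c) k r refl rec eq
    with v , eqᵛ ← rec (trans (euclid-det a b c k (+ r)) eq) | w , eqʷ ← shear-word k =
    w ++ flip ∷ v , λ q → begin
      actᶠ (w ++ flip ∷ v) q       ≡⟨ actᶠ-++ w (flip ∷ v) q ⟩
      actᶠ w (S • actᶠ v q)        ≡⟨ eqʷ (S • actᶠ v q) ⟩
      shear k • S • actᶠ v q       ≡⟨ cong (λ q → shear k • S • q) (eqᵛ q) ⟩
      shear k • S • M′ • q         ≡⟨ cong (shear k •_) (•-• S M′ q) ⟩
      shear k • (M′ ⊗ S) • q       ≡⟨ •-• (shear k) (M′ ⊗ S) q ⟩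
      (M′ ⊗ S ⊗ shear k) • q       ≡⟨ cong (_• q)
          (matrix-≡ (e₁ a b c k) (e₂ a b c k (+ r)) (e₃ a c (+ r)) (e₄ b c k (+ r))) ⟩
      (-I ⊗ M) • q                 ≡⟨ negation-• M q ⟩
      M • q                        ∎
    where
    open ≡-Reasoning
    M = mat a b c (+ r + k * c)
    M′ = mat (k * a - b) a (- + r) c
    -I = mat -1ℤ 0ℤ 0ℤ -1ℤ
    e₁ : ∀ a b c k → ((k * a - b) * 0ℤ + a * -1ℤ) * 1ℤ + ((k * a - b) * 1ℤ + a * 0ℤ) * 0ℤ ≡ -1ℤ * a + 0ℤ * c
    e₁ = solve-∀
    e₂ : ∀ a b c k r → ((k * a - b) * 0ℤ + a * -1ℤ) * k + ((k * a - b) * 1ℤ + a * 0ℤ) * 1ℤ ≡ -1ℤ * b + 0ℤ *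
        (r + k * c)
    e₂ = solve-∀
    e₃ : ∀ a c r → (- r * 0ℤ + c * -1ℤ) * 1ℤ + (- r * 1ℤ + c * 0ℤ) * 0ℤ ≡ 0ℤ * a + -1ℤ * c
    e₃ = solve-∀
    e₄ : ∀ b c k r → (- r * 0ℤ + c * -1ℤ) * k + (- r * 1ℤ + c * 0ℤ) * 1ℤ ≡ 0ℤ * b + -1ℤ * (r + k * c)
    e₄ = solve-∀

  remainder< : ∀ n c d .{{_ : ℤ.NonZero c}} → ℤ.∣ c ∣ ℕ.< ℕ.suc n → ℤ.∣ - + (d ℤ.% c) ∣ ℕ.< n
  remainder< n c d c<n =
    ℕₚ.<-≤-trans (subst (ℕ._< ℤ.∣ c ∣) (sym (ℤₚ.∣-i∣≡∣i∣ (+ (d ℤ.% c)))) (ℤᵈ.n%d<d d c)) (ℕₚ.≤-pred c<n)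

  -- Euclid's algorithm on the bottom row.
  word-bounded : ∀ n a b c d → ℤ.∣ c ∣ ℕ.< n → det (mat a b c d) ≡ 1ℤ → ActsAsWord (mat a b c d)
  word-bounded (ℕ.suc n) a b (+ ℕ.zero) d _ eq with unit a d (trans (e a b d) eq)
    where
    e : ∀ a b d → a * d ≡ a * d - b * 0ℤ
    e = solve-∀
  ... | inj₁ (refl , refl) = shear-word b
  ... | inj₂ (refl , refl) with v , eq′ ← shear-word (- b) =
    v , λ q → trans (eq′ q) (trans (sym (negation-• (shear (- b)) q)) (cong (_• q) (matrix-≡ refl (e b) refl refl)))
    where
    e : ∀ b → -1ℤ * - b + 0ℤ * 1ℤ ≡ b
    e = solve-∀
  word-bounded (ℕ.suc n) a b c@(+ ℕ.suc _) d c<n eq =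
    euclid-step a b c d (d ℤ./ c) (d ℤ.% c) (ℤᵈ.a≡a%n+[a/n]*n d c)
      (λ eq′ → word-bounded n _ _ _ _ (remainder< n c d c<n) eq′) eq
  word-bounded (ℕ.suc n) a b c@(-[1+ _ ]) d c<n eq =
    euclid-step a b c d (d ℤ./ c) (d ℤ.% c) (ℤᵈ.a≡a%n+[a/n]*n d c)
      (λ eq′ → word-bounded n _ _ _ _ (remainder< n c d c<n) eq′) eq

  opaque
    word : ∀ M → det M ≡ 1ℤ → ActsAsWord M
    word (mat a b c d) = word-bounded (ℕ.suc ℤ.∣ c ∣) a b c d ℕₚ.≤-refl

-- Induction and growth over the integers.

module IntegerSequences where
  open FormAction
  open Tree
  open import Data.Integer.Base using (_+_; _*_; _-_; -_; _<_; _≤_)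

  +-suc : ∀ i n → i + + ℕ.suc n ≡ ℤ.suc (i + + n)
  +-suc i n = eq i (+ n)
    where
    eq : ∀ i n → i + (1ℤ + n) ≡ 1ℤ + (i + n)
    eq = solve-∀

  +-suc-shift : ∀ i n → i + + ℕ.suc n ≡ ℤ.suc i + + n
  +-suc-shift i n = trans (+-suc i n) (sym (ℤₚ.+-assoc 1ℤ i (+ n)))

  ≤⇒+ : ∀ {i j} → i ≤ j → ∃[ n ] j ≡ i + + n
  ≤⇒+ {i} {j} i≤j = ℤ.∣ j - i ∣ , sym (trans (cong (λ k → i + k) (ℤₚ.0≤i⇒+∣i∣≡i (ℤₚ.i≤j⇒0≤j-i i≤j))) (eq i j))
    where
    eq : ∀ i j → i + (j - i) ≡ j
    eq = solve-∀

  ascend : ∀ {ℓ} (P : ℤ → Set ℓ) {i} → P i → (∀ j → P j → P (ℤ.suc j)) → ∀ n → P (i + + n)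
  ascend P {i} p step ℕ.zero    = subst P (sym (ℤₚ.+-identityʳ i)) p
  ascend P {i} p step (ℕ.suc n) = subst P (sym (+-suc i n)) (step _ (ascend P p step n))

  ascend-≤ : ∀ {ℓ} (P : ℤ → Set ℓ) {i} → P i → (∀ j → P j → P (ℤ.suc j)) → ∀ {j} → i ≤ j → P j
  ascend-≤ P p step i≤j with n , refl ← ≤⇒+ i≤j = ascend P p step n

  everywhere : ∀ {ℓ} (P : ℤ → Set ℓ) {i} → P i → (∀ j → P j → P (ℤ.suc j)) → (∀ j → P (ℤ.suc j) → P j) → ∀ j → P j
  everywhere P {i} p up down j with ℤₚ.≤-total i j
  ... | inj₁ i≤j = ascend-≤ P p up i≤j
  ... | inj₂ j≤i with n , refl ← ≤⇒+ j≤i = descend n p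
    where
    descend : ∀ n → P (j + + n) → P j
    descend ℕ.zero    p = subst P (ℤₚ.+-identityʳ j) p
    descend (ℕ.suc n) p = descend n (down _ (subst P (+-suc j n) p))

  module _ (g : ℤ → ℤ) (g-increasing : ∀ i → g i < g (ℤ.suc i)) where

    growth : ∀ i n → g i + + n ≤ g (i + + n)
    growth i ℕ.zero    = ℤₚ.≤-reflexive (trans (ℤₚ.+-identityʳ (g i)) (cong g (sym (ℤₚ.+-identityʳ i))))
    growth i (ℕ.suc n) = begin
      g i + + ℕ.suc n       ≡⟨ +-suc (g i) n ⟩
      ℤ.suc (g i + + n)     ≤⟨ ℤₚ.suc-mono (growth i n) ⟩
      ℤ.suc (g (i + + n))   ≤⟨ ℤₚ.i<j⇒suc[i]≤j (g-increasing (i + + n)) ⟩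
      g (ℤ.suc (i + + n))   ≡⟨ cong g (+-suc i n) ⟨
      g (i + + ℕ.suc n)     ∎
      where open ℤₚ.≤-Reasoning

    unbounded : ∀ K → ∃[ i ] ∃[ n ] K < - g i × K < g (i + + n)
    unbounded K = - + N , N ℕ.+ N , low , high
      where
      -- An increasing integer sequence gains at least one per step, so this many steps from 0 in
      -- either direction outweigh both `g 0ℤ` and `K`.
      N = ℕ.suc (ℤ.∣ K ∣ ℕ.+ ℤ.∣ g 0ℤ ∣)

      i≤∣i∣ : ∀ i → i ≤ + ℤ.∣ i ∣
      i≤∣i∣ (+ n)    = ℤₚ.≤-refl
      i≤∣i∣ -[1+ n ] = ℤ.-≤+

      K+x<N : ∀ x → ℤ.∣ x ∣ ≡ ℤ.∣ g 0ℤ ∣ → K + x < + N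
      K+x<N x eq = ℤₚ.≤-<-trans (ℤₚ.+-mono-≤ (i≤∣i∣ K) (i≤∣i∣ x))
        (ℤ.+<+ (ℕ.s≤s (ℕₚ.≤-reflexive (cong (ℤ.∣ K ∣ ℕ.+_) eq))))

      high : K < g (- + N + + (N ℕ.+ N))
      high = subst (λ j → K < g j) (e₁ (+ N)) (ℤₚ.<-≤-trans
        (subst₂ _<_ (e₂ K (g 0ℤ)) (ℤₚ.+-comm (+ N) (g 0ℤ))
            (ℤₚ.+-monoˡ-< (g 0ℤ) (K+x<N (- g 0ℤ) (ℤₚ.∣-i∣≡∣i∣ (g 0ℤ)))))
        (growth 0ℤ N))
        where
        e₁ : ∀ n → 0ℤ + n ≡ - n + (n + n)
        e₁ = solve-∀
        e₂ : ∀ K x → (K + - x) + x ≡ K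
        e₂ = solve-∀

      low : K < - g (- + N)
      low = ℤₚ.<-≤-trans
        (subst (_< + N + - g 0ℤ) (e₁ K (g 0ℤ)) (ℤₚ.+-monoˡ-< (- g 0ℤ) (K+x<N (g 0ℤ) refl)))
        (subst₂ _≤_ (e₂ (+ N) (g (- + N)) (g 0ℤ)) (e₃ (g (- + N)) (g 0ℤ)) (ℤₚ.+-monoˡ-≤ (- g (- + N) + - g 0ℤ)
          (subst (λ j → g (- + N) + + N ≤ g j) (ℤₚ.+-inverseˡ (+ N)) (growth (- + N) N))))
        where
        e₁ : ∀ K x → (K + x) + - x ≡ K
        e₁ = solve-∀
        e₂ : ∀ n x y → x + n + (- x + - y) ≡ n + - y
        e₂ = solve-∀
        e₃ : ∀ x y → y + (- x + - y) ≡ - x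
        e₃ = solve-∀

    strictly-monotone : ∀ {i j} → i < j → g i < g j
    strictly-monotone {i} {j} i<j with n , refl ← ≤⇒+ (ℤₚ.i<j⇒suc[i]≤j i<j) =
      ℤₚ.<-≤-trans (g-increasing i) (ℤₚ.≤-trans (ℤₚ.i≤i+j (g (ℤ.suc i)) (+ n)) (growth (ℤ.suc i) n))

    injective : ∀ {i j} → g i ≡ g j → i ≡ j
    injective {i} {j} eq with ℤₚ.<-cmp i j
    ... | tri< i<j _ _ = contradiction eq (ℤₚ.<⇒≢ (strictly-monotone i<j))
    ... | tri≈ _ i≡j _ = i≡j
    ... | tri> _ _ i>j = contradiction (sym eq) (ℤₚ.<⇒≢ (strictly-monotone i>j))

-- Signs of the regions and the climbing principle.

module Signs where
  open FormAction
  open Tree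
  open import Data.Integer.Base using (_+_; _*_; _-_; -_; _<_; _≤_)

  0<+ : ∀ {i j} → 0ℤ < i → 0ℤ < j → 0ℤ < i + j
  0<+ = ℤₚ.+-mono-<

  0<* : ∀ {i j} → 0ℤ < i → 0ℤ < j → 0ℤ < i * j
  0<* {i} {j} 0<i 0<j = subst (_< i * j) (ℤₚ.*-zeroʳ i) (ℤₚ.*-monoˡ-<-pos i {{ℤ.positive 0<i}} 0<j)

  0<- : ∀ {i} → i < 0ℤ → 0ℤ < - i
  0<- = ℤₚ.neg-mono-<

  -<0 : ∀ {i} → 0ℤ < i → - i < 0ℤ
  -<0 = ℤₚ.neg-mono-<

  0<-⁻¹ : ∀ {i} → 0ℤ < - i → i < 0ℤ
  0<-⁻¹ {i} h = subst (_< 0ℤ) (ℤₚ.neg-involutive i) (-<0 h)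

  by : ∀ {i j} → i ≡ j → 0ℤ < i → 0ℤ < j
  by refl h = h

  sign-of : ∀ i → i ≢ 0ℤ → 0ℤ < i ⊎ i < 0ℤ
  sign-of i i≢0 with ℤₚ.<-cmp 0ℤ i
  ... | tri< 0<i _ _ = inj₁ 0<i
  ... | tri≈ _ 0≡i _ = contradiction (sym 0≡i) i≢0
  ... | tri> _ _ i<0 = inj₂ i<0

  ±⇒*<0 : ∀ {i j} → 0ℤ < i → j < 0ℤ → i * j < 0ℤ
  ±⇒*<0 {i} {j} 0<i j<0 = 0<-⁻¹ (by (sym (ℤₚ.neg-distribʳ-* i j)) (0<* 0<i (0<- j<0)))

  ∓⇒*<0 : ∀ {i j} → i < 0ℤ → 0ℤ < j → i * j < 0ℤ
  ∓⇒*<0 {i} {j} i<0 0<j = subst (_< 0ℤ) (ℤₚ.*-comm j i) (±⇒*<0 0<j i<0)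

  −−⇒0<* : ∀ {i j} → i < 0ℤ → j < 0ℤ → 0ℤ < i * j
  −−⇒0<* {i} {j} i<0 j<0 = by (eq i j) (0<* (0<- i<0) (0<- j<0))
    where
    eq : ∀ i j → - i * - j ≡ i * j
    eq = solve-∀

  0≤i*i : ∀ i → 0ℤ ≤ i * i
  0≤i*i (+ n)    = subst (0ℤ ≤_) (ℤₚ.pos-* n n) (ℤ.+≤+ ℕ.z≤n)
  0≤i*i -[1+ n ] = ℤ.+≤+ ℕ.z≤n

  0<i*i : ∀ {i} → i ≢ 0ℤ → 0ℤ < i * i
  0<i*i {i} i≢0 with sign-of i i≢0
  ... | inj₁ 0<i = 0<* 0<i 0<i
  ... | inj₂ i<0 = −−⇒0<* i<0 i<0

  0<2 : 0ℤ < + 2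
  0<2 = ℤ.+<+ (ℕ.s≤s ℕ.z≤n)

  0<4 : 0ℤ < + 4
  0<4 = ℤ.+<+ (ℕ.s≤s ℕ.z≤n)

  0<⇒≢0 : ∀ {i} → 0ℤ < i → i ≢ 0ℤ
  0<⇒≢0 h refl = ℤₚ.<-irrefl refl h

module SignPatterns where
  open FormAction
  open Tree
  open import Data.Integer.Base using (_+_; _*_; _-_; -_; _<_; _≤_)
  open Form
  open Signs

  other : Turn → Turn
  other L = R
  other R = L

  -- The third region at the vertex carries `A + B + C`. A left turn keeps the region on the left, a
  -- right turn the one on the right, and the new region takes the other place.
  turnᶠ : Turn → Form → Form
  turnᶠ L [ A , B , C ] = [ A , + 2 * A + B , A + B + C ]
  turnᶠ R [ A , B , C ] = [ A + B + C , B + + 2 * C , C ]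

  flipᶠ : Form → Form
  flipᶠ [ A , B , C ] = [ C , - B , A ]

  -- A vanishing outer coefficient would make the discriminant the square of `B`, so this condition
  -- keeps zero out of every region.
  Anisotropic : Form → Set
  Anisotropic q = ∀ n → n * n ≢ disc q

  -- `Mixed` edges lie on the river; `Up` edges follow its flow and `Down` edges oppose it.
  -- `Climbing` is the hypothesis of Conway's climbing lemma and persists under every further turn.
  Mixed Up Down Positive Climbing : Form → Set
  Mixed    q = A q * C q < 0ℤ
  Up       q = 0ℤ < A q × C q < 0ℤ
  Down     q = A q < 0ℤ × 0ℤ < C q
  Positive q = 0ℤ < A q × 0ℤ < C q
  Climbing q = 0ℤ < A q × 0ℤ < B q × 0ℤ < C q

  Negative : Form → Set
  Negative q = A q < 0ℤ × C q < 0ℤ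

  module _ {q} (aniso : Anisotropic q) where

    A≢0 : A q ≢ 0ℤ
    A≢0 refl = aniso (B q) (eq (B q) (C q))
      where
      eq : ∀ B C → B * B ≡ B * B - + 4 * 0ℤ * C
      eq = solve-∀

    C≢0 : C q ≢ 0ℤ
    C≢0 refl = aniso (B q) (eq (A q) (B q))
      where
      eq : ∀ A B → B * B ≡ B * B - + 4 * A * 0ℤ
      eq = solve-∀

    data Pattern : Set where
      up       : Up q → Pattern
      down     : Down q → Pattern
      positive : Positive q → Pattern
      negative : Negative q → Pattern

    pattern-of : Pattern
    pattern-of with sign-of (A q) A≢0 | sign-of (C q) C≢0
    ... | inj₁ 0<A | inj₁ 0<C = positive (0<A , 0<C)
    ... | inj₁ 0<A | inj₂ C<0 = up (0<A , C<0)
    ... | inj₂ A<0 | inj₁ 0<C = down (A<0 , 0<C)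
    ... | inj₂ A<0 | inj₂ C<0 = negative (A<0 , C<0)

  up⇒mixed : ∀ q → Up q → Mixed q
  up⇒mixed q (0<A , C<0) = ±⇒*<0 0<A C<0

  down⇒mixed : ∀ q → Down q → Mixed q
  down⇒mixed q (A<0 , 0<C) = ∓⇒*<0 A<0 0<C

  positive⇒¬mixed : ∀ q → Positive q → ¬ Mixed q
  positive⇒¬mixed q (0<A , 0<C) mixed = ℤₚ.<-asym (0<* 0<A 0<C) mixed

  negative⇒¬mixed : ∀ q → Negative q → ¬ Mixed q
  negative⇒¬mixed q (A<0 , C<0) mixed = ℤₚ.<-asym (−−⇒0<* A<0 C<0) mixed

  mixed⇒up⊎down : ∀ q → Mixed q → Up q ⊎ Down q
  mixed⇒up⊎down q mixed with ℤₚ.<-cmp (A q) 0ℤ | ℤₚ.<-cmp (C q) 0ℤ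
  ... | tri< A<0 _ _ | tri< C<0 _ _ = contradiction mixed (negative⇒¬mixed q (A<0 , C<0))
  ... | tri< A<0 _ _ | tri> _ _ 0<C = inj₂ (A<0 , 0<C)
  ... | tri> _ _ 0<A | tri< C<0 _ _ = inj₁ (0<A , C<0)
  ... | tri> _ _ 0<A | tri> _ _ 0<C = contradiction mixed (positive⇒¬mixed q (0<A , 0<C))
  ... | tri≈ _ A≡0 _ | _            = contradiction (cong (_* C q) A≡0) (ℤₚ.<⇒≢ mixed)
  ... | tri< _ _ _   | tri≈ _ C≡0 _ = contradiction (trans (cong (A q *_) C≡0) (ℤₚ.*-zeroʳ (A q))) (ℤₚ.<⇒≢ mixed)
  ... | tri> _ _ _   | tri≈ _ C≡0 _ = contradiction (trans (cong (A q *_) C≡0) (ℤₚ.*-zeroʳ (A q))) (ℤₚ.<⇒≢ mixed)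

  mixed-negate : ∀ q → Mixed q → Mixed (negate q)
  mixed-negate [ A , B , C ] = subst (_< 0ℤ) (eq A C)
    where
    eq : ∀ A C → A * C ≡ - A * - C
    eq = solve-∀

  mixed-negate⁻¹ : ∀ q → Mixed (negate q) → Mixed q
  mixed-negate⁻¹ [ A , B , C ] = subst (_< 0ℤ) (eq A C)
    where
    eq : ∀ A C → - A * - C ≡ A * C
    eq = solve-∀

  mixed-flip : ∀ q → Mixed q → Mixed (flipᶠ q)
  mixed-flip [ A , B , C ] = subst (_< 0ℤ) (ℤₚ.*-comm A C)

  climbing⇒positive : ∀ q → Climbing q → Positive q
  climbing⇒positive q (0<A , _ , 0<C) = 0<A , 0<C

  climbing-turn : ∀ t q → Climbing q → Climbing (turnᶠ t q)
  climbing-turn L q (0<A , 0<B , 0<C) = 0<A , 0<+ (0<* 0<2 0<A) 0<B , 0<+ (0<+ 0<A 0<B) 0<C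
  climbing-turn R q (0<A , 0<B , 0<C) = 0<+ (0<+ 0<A 0<B) 0<C , 0<+ 0<B (0<* 0<2 0<C) , 0<C

  -- The new middle coefficient is `A + (A + B + C) - C`, where `C` belongs to the negative region
  -- left behind; all three summands are positive.
  leave-L : ∀ q → C q < 0ℤ → Positive (turnᶠ L q) → Climbing (turnᶠ L q)
  leave-L q C<0 (0<A , 0<M) = 0<A , by (eq (A q) (B q) (C q)) (0<+ (0<+ 0<M (0<- C<0)) 0<A) , 0<M
    where
    eq : ∀ A B C → A + B + C + - C + A ≡ + 2 * A + B
    eq = solve-∀

  leave-R : ∀ q → A q < 0ℤ → Positive (turnᶠ R q) → Climbing (turnᶠ R q)
  leave-R q A<0 (0<M , 0<C) = 0<M , by (eq (A q) (B q) (C q)) (0<+ (0<+ 0<M (0<- A<0)) 0<C) , 0<C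
    where
    eq : ∀ A B C → A + B + C + - A + C ≡ B + + 2 * C
    eq = solve-∀

  leave : ∀ t q → Mixed q → Positive (turnᶠ t q) → Climbing (turnᶠ t q)
  leave t q mixed pos with t | mixed⇒up⊎down q mixed
  ... | L | inj₁ (_ , C<0)   = leave-L q C<0 pos
  ... | L | inj₂ (A<0 , _)   = contradiction (proj₁ pos) (ℤₚ.<-asym A<0)
  ... | R | inj₁ (_ , C<0)   = contradiction (proj₂ pos) (ℤₚ.<-asym C<0)
  ... | R | inj₂ (A<0 , _)   = leave-R q A<0 pos

  turn-negate : ∀ t q → turnᶠ t (negate q) ≡ negate (turnᶠ t q)
  turn-negate L [ A , B , C ] = form-≡ refl (eq₁ A B) (eq₂ A B C)
    where
    eq₁ : ∀ A B → + 2 * - A + - B ≡ - (+ 2 * A + B)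
    eq₁ = solve-∀
    eq₂ : ∀ A B C → - A + - B + - C ≡ - (A + B + C)
    eq₂ = solve-∀
  turn-negate R [ A , B , C ] = form-≡ (eq₂ A B C) (eq₁ B C) refl
    where
    eq₁ : ∀ B C → - B + + 2 * - C ≡ - (B + + 2 * C)
    eq₁ = solve-∀
    eq₂ : ∀ A B C → - A + - B + - C ≡ - (A + B + C)
    eq₂ = solve-∀

  negative⇒positive-negate : ∀ q → Negative q → Positive (negate q)
  negative⇒positive-negate q (A<0 , C<0) = 0<- A<0 , 0<- C<0

  Escaping : Form → Set
  Escaping q = Climbing q ⊎ Climbing (negate q)

  escaping-turn : ∀ t q → Escaping q → Escaping (turnᶠ t q)
  escaping-turn t q (inj₁ c) = inj₁ (climbing-turn t q c)
  escaping-turn t q (inj₂ c) = inj₂ (subst Climbing (turn-negate t q) (climbing-turn t (negate q) c))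

  escaping⇒¬mixed : ∀ q → Escaping q → ¬ Mixed q
  escaping⇒¬mixed q (inj₁ c) m = positive⇒¬mixed q (climbing⇒positive q c) m
  escaping⇒¬mixed q (inj₂ c) m = positive⇒¬mixed (negate q) (climbing⇒positive (negate q) c) (mixed-negate q m)

  escape : ∀ t q → Anisotropic (turnᶠ t q) → Mixed q → ¬ Mixed (turnᶠ t q) → Escaping (turnᶠ t q)
  escape t q aniso m ¬m with pattern-of {turnᶠ t q} aniso
  ... | up u       = contradiction (up⇒mixed (turnᶠ t q) u) ¬m
  ... | down d     = contradiction (down⇒mixed (turnᶠ t q) d) ¬m
  ... | positive p = inj₁ (leave t q m p)
  ... | negative n = inj₂ (subst Climbing (turn-negate t q)
                       (leave t (negate q) (mixed-negate q m)
                         (subst Positive (sym (turn-negate t q)) (negative⇒positive-negate (turnᶠ t q) n))))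

  -- Of the three regions at the vertex two already have opposite signs, and the third agrees with
  -- only one of them. A river therefore has a single continuation.
  branch : ∀ t q → Mixed q → Mixed (turnᶠ t q) → ¬ Mixed (turnᶠ (other t) q)
  branch L q m mᴸ mᴿ with mixed⇒up⊎down q m | mixed⇒up⊎down (turnᶠ L q) mᴸ | mixed⇒up⊎down (turnᶠ R q) mᴿ
  ... | inj₁ (0<A , _) | inj₂ (A<0 , _) | _              = ℤₚ.<-asym 0<A A<0
  ... | inj₂ (A<0 , _) | inj₁ (0<A , _) | _              = ℤₚ.<-asym 0<A A<0
  ... | inj₁ _         | inj₁ (_ , M<0) | inj₁ (0<M , _) = ℤₚ.<-asym M<0 0<M
  ... | inj₁ (_ , C<0) | inj₁ _         | inj₂ (_ , 0<C) = ℤₚ.<-asym C<0 0<C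
  ... | inj₂ _         | inj₂ (_ , 0<M) | inj₂ (M<0 , _) = ℤₚ.<-asym M<0 0<M
  ... | inj₂ (_ , 0<C) | inj₂ _         | inj₁ (_ , C<0) = ℤₚ.<-asym C<0 0<C
  branch R q m mᴿ mᴸ = branch L q m mᴸ mᴿ

  up-turn : ∀ t q → Up q → Mixed (turnᶠ t q) → Up (turnᶠ t q)
  up-turn t q (0<A , C<0) m with t | mixed⇒up⊎down (turnᶠ t q) m
  ... | L | inj₁ u         = u
  ... | R | inj₁ u         = u
  ... | L | inj₂ (A<0 , _) = contradiction 0<A (ℤₚ.<-asym A<0)
  ... | R | inj₂ (_ , 0<C) = contradiction 0<C (ℤₚ.<-asym C<0)

  Definite : Form → Set
  Definite q = disc q < 0ℤ × 0ℤ < A q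

  definite⇒0<C : ∀ q → Definite q → 0ℤ < C q
  definite⇒0<C [ A , B , C ] (disc<0 , 0<A) with ℤₚ.<-cmp 0ℤ C
  ... | tri< 0<C _ _ = 0<C
  ... | tri≈ _ refl _ = contradiction (subst (_< 0ℤ) (eq A B) disc<0) (ℤₚ.≤⇒≯ (0≤i*i B))
    where
    eq : ∀ A B → B * B - + 4 * A * 0ℤ ≡ B * B
    eq = solve-∀
  ... | tri> _ _ C<0 = contradiction disc<0
      (ℤₚ.<-asym (by (eq A B C) (ℤₚ.+-mono-≤-< (0≤i*i B) (0<* (0<* 0<4 0<A) (0<- C<0)))))
    where
    eq : ∀ A B C → B * B + + 4 * A * - C ≡ B * B - + 4 * A * C
    eq = solve-∀

  -- The increment is `2A` or `2C`. This monotonicity along paths without backtracking serves twice: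
  -- it shows that paths do not close up, and it drives the Jacobian to infinity along a river.
  B-increases : ∀ t q → Definite q → B q < B (turnᶠ t q)
  B-increases L q (_ , 0<A) = subst (_< B (turnᶠ L q)) (ℤₚ.+-identityˡ (B q)) (ℤₚ.+-monoˡ-< (B q) (0<* 0<2 0<A))
  B-increases R q def       = subst (_< B (turnᶠ R q)) (ℤₚ.+-identityʳ (B q))
      (ℤₚ.+-monoʳ-< (B q) (0<* 0<2 (definite⇒0<C q def)))

module LabellingSigns (𝒻 : Tree.Labelling) where
  open FormAction
  open Tree
  open IntegerSequences
  open SignPatterns
  open Labelling 𝒻

  f-turn : ∀ t e → f (turn t e) ≡ turnᶠ t (f e)
  f-turn L e = trans (f-left e) (T-• (Form.A (f e)) (Form.B (f e)) (Form.C (f e)))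
  f-turn R e = trans (f-right e) (TST-• (Form.A (f e)) (Form.B (f e)) (Form.C (f e)))

  f-flip : ∀ e → f (bar e) ≡ flipᶠ (f e)
  f-flip e = trans (f-bar e) (S-• (Form.A (f e)) (Form.B (f e)) (Form.C (f e)))

  propagate : ∀ {ℓ} (P : Form → Set ℓ) → (∀ q → P q → P (flipᶠ q)) → (∀ q → P q → P (turnᶠ L q)) →
              ∀ {e} → P (f e) → ∀ e′ → P (f e′)
  propagate P flips turns {e} p e′ with v , refl ← connected e e′ = go v
    where
    go : ∀ v → P (f (act v e))
    go []          = p
    go (flip ∷ v)  = subst P (sym (f-flip (act v e))) (flips (f (act v e)) (go v))
    go (ahead ∷ v) = subst P (sym (f-turn L (act v e))) (turns (f (act v e)) (go v))

  definite-everywhere : ∀ {e} → Definite (f e) → ∀ e′ → Definite (f e′)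
  definite-everywhere = propagate Definite
    (λ { q@([ A , B , C ]) def@(disc<0 , _) →
      subst (ℤ._< 0ℤ) (trans (sym (disc-S q)) (cong disc (S-• A B C))) disc<0 , definite⇒0<C q def })
    (λ { q@([ A , B , C ]) (disc<0 , 0<A) →
      subst (ℤ._< 0ℤ) (trans (sym (disc-T q)) (cong disc (T-• A B C))) disc<0 , 0<A })

  anisotropic-everywhere : ∀ {e} → Anisotropic (f e) → ∀ e′ → Anisotropic (f e′)
  anisotropic-everywhere {e} aniso e′ n eq = aniso n (trans eq (f-disc e′ e))

-- A single river: uniqueness and form-preserving automorphisms.

module Turns where
  open FormAction
  open Tree
  open IntegerSequences
  open SignPatterns
  turn-bar-turn : ∀ t e → turn t (bar (turn t e)) ≡ turn (other t) e
  turn-bar-turn L e = refl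
  turn-bar-turn R e = right-bar-right e

  turn-other-bar-turn : ∀ t e → turn (other t) (bar (turn t e)) ≡ bar e
  turn-other-bar-turn L e = left-bar-right e
  turn-other-bar-turn R e = left-bar-right e

  same⊎other : ∀ (t t′ : Turn) → t′ ≡ t ⊎ t′ ≡ other t
  same⊎other L L = inj₁ refl
  same⊎other L R = inj₂ refl
  same⊎other R L = inj₂ refl
  same⊎other R R = inj₁ refl

  -- In the topograph of x² + y² the middle coefficient grows along every path
  -- without backtracking, which rules out closed paths.
  module _ (edge : ℤ → Edge) (turns : ℤ → Turn) (flow : ∀ i → edge (ℤ.suc i) ≡ turn (turns i) (edge i)) where

    path-injective : ∀ {i j} → edge i ≡ edge j → i ≡ j
    path-injective {i} {j} eq = injective (λ i → Form.B (f (edge i))) increases (cong (λ e → Form.B (f e)) eq)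
      where
      𝒻 = labelling (topograph [ 1ℤ , 0ℤ , 1ℤ ])
      open Labelling 𝒻
      open LabellingSigns 𝒻
      increases : ∀ i → Form.B (f (edge i)) ℤ.< Form.B (f (edge (ℤ.suc i)))
      increases i = subst (λ q → Form.B (f (edge i)) ℤ.< Form.B q)
        (sym (trans (cong f (flow i)) (f-turn (turns i) (edge i))))
        (B-increases (turns i) (f (edge i)) (definite-everywhere {root} (ℤ.-<+ , ℤ.+<+ (ℕ.s≤s ℕ.z≤n)) (edge i)))

module Rivers {q : Form} {𝒯 : Topograph q} (ℛ : River 𝒯) (aniso : SignPatterns.Anisotropic q) where
  open FormAction
  open Tree
  open IntegerSequences
  open SignPatterns
  open Turns
  open Topograph 𝒯
  open River ℛ
  open Labelling (labelling 𝒯) using (f-act; f-disc)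
  open LabellingSigns (labelling 𝒯)

  anisotropic : ∀ e → Anisotropic (f e)
  anisotropic = anisotropic-everywhere (subst Anisotropic (sym f-base) aniso)

  edge-injective : ∀ {i j} → edge i ≡ edge j → i ≡ j
  edge-injective = path-injective edge turns flow

  on-river : ∀ i → Mixed (f (edge i))
  on-river i = up⇒mixed (f (edge i)) (flowing i)

  module _ {t e} (m : Mixed (f e)) (m′ : Mixed (f (turn t e))) where

    ¬mixed-other : ¬ Mixed (f (turn (other t) e))
    ¬mixed-other m″ = branch t (f e) m (subst Mixed (f-turn t e) m′) (subst Mixed (f-turn (other t) e) m″)

    escape-other : Escaping (f (turn (other t) e))
    escape-other = subst Escaping (sym (f-turn (other t) e))
      (escape (other t) (f e) (subst Anisotropic (f-turn (other t) e) (anisotropic (turn (other t) e)))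
        m (λ m″ → ¬mixed-other (subst Mixed (sym (f-turn (other t) e)) m″)))

  OnEdge : Orientation → Edge → Set
  OnEdge forward  e = ∃[ j ] e ≡ edge j
  OnEdge backward e = ∃[ j ] e ≡ bar (edge j)

  mixed-bar : ∀ e → Mixed (f e) → Mixed (f (bar e))
  mixed-bar e m = subst Mixed (sym (f-flip e)) (mixed-flip (f e) m)

  mixed-bar⁻¹ : ∀ e → Mixed (f (bar e)) → Mixed (f e)
  mixed-bar⁻¹ e m = subst (λ e → Mixed (f e)) (bar-involutive e) (mixed-bar (bar e) m)

  -- One of the two continuations of a river edge is the adjacent river edge, the other escapes.
  -- Against the flow, the adjacent edge is the preceding one reversed.
  next : ∀ t o e → OnEdge o e → OnEdge o (turn t e) ⊎ Escaping (f (turn t e))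
  next t forward _ (j , refl) with same⊎other (turns j) t
  ... | inj₁ refl = inj₁ (ℤ.suc j , sym (flow j))
  ... | inj₂ refl = inj₂ (escape-other {turns j} {edge j} (on-river j)
      (subst (λ e → Mixed (f e)) (flow j) (on-river (ℤ.suc j))))
  next t backward _ (j , refl) = subst (λ e → OnEdge backward (turn t e) ⊎ Escaping (f (turn t e)))
      (cong bar (trans (sym (flow i)) (cong edge (ℤₚ.suc-pred j)))) step
    where
    i = ℤ.pred j
    s = turns i
    e = bar (turn s (edge i))
    m : Mixed (f e)
    m = mixed-bar (turn s (edge i)) (subst (λ e → Mixed (f e)) (flow i) (on-river (ℤ.suc i)))
    m′ : Mixed (f (turn (other s) e))
    m′ = subst (λ e → Mixed (f e)) (sym (turn-other-bar-turn s (edge i))) (mixed-bar (edge i) (on-river i))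
    step : OnEdge backward (turn t e) ⊎ Escaping (f (turn t e))
    step with same⊎other (other s) t
    ... | inj₁ refl = inj₁ (i , turn-other-bar-turn s (edge i))
    ... | inj₂ refl = inj₂ (escape-other {other s} {e} m m′)

  developed-river : ∀ o w → OnEdge o (developAway (edge 0ℤ) w o) ⊎ Escaping (f (developAway (edge 0ℤ) w o))
  developed-river forward  []      = inj₁ (0ℤ , refl)
  developed-river backward []      = inj₁ (0ℤ , refl)
  developed-river o        (t ∷ w) with developed-river o w
  ... | inj₁ on = next t o (developAway (edge 0ℤ) w o) on
  ... | inj₂ c  = inj₂ (subst Escaping (sym (f-turn t e)) (escaping-turn t (f e) c))
    where e = developAway (edge 0ℤ) w o

  -- Every edge is reached from `edge 0ℤ` by turns without backtracking. Such a path follows the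
  -- river for a while, and once it has escaped it never separates opposite signs again. Hence the
  -- given sequence exhausts the river.
  river-connected : ∀ e → Mixed (f e) → ∃[ j ] (e ≡ edge j ⊎ e ≡ bar (edge j))
  river-connected e m = subst (λ e → ∃[ j ] (e ≡ edge j ⊎ e ≡ bar (edge j)))
    (develop-developed e₀ e) (go (develop (developed e₀) e)
        (subst (λ e → Mixed (f e)) (sym (develop-developed e₀ e)) m))
    where
    e₀ = edge 0ℤ
    away-case : ∀ o w → Mixed (f (developAway e₀ w o)) → OnEdge o (developAway e₀ w o)
    away-case o w m with developed-river o w
    ... | inj₁ on = on
    ... | inj₂ c  = contradiction m (escaping⇒¬mixed (f (developAway e₀ w o)) c)
    go : ∀ x → Mixed (f (develop e₀ x)) → ∃[ j ] (develop e₀ x ≡ edge j ⊎ develop e₀ x ≡ bar (edge j))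
    go (away forward w) m with j , eq ← away-case forward w m = j , inj₁ eq
    go (away backward w) m with j , eq ← away-case backward w m = j , inj₂ eq
    go (toward forward t w) m with j , eq ← away-case forward (t ∷ w) (mixed-bar⁻¹ _ m) = j , inj₂ (cong bar eq)
    go (toward backward t w) m with j , eq ← away-case backward (t ∷ w) (mixed-bar⁻¹ _ m) =
      j , inj₁ (trans (cong bar eq) (bar-involutive (edge j)))

  up-bar : ∀ e → Up (f e) → ¬ Up (f (bar e))
  up-bar e (0<A , _) u = ℤₚ.<-asym 0<A (proj₂ (subst Up (f-flip e) u))

  flowing-edge : ∀ e → Up (f e) → ∃[ j ] e ≡ edge j
  flowing-edge e u with river-connected e (up⇒mixed (f e) u)
  ... | j , inj₁ eq   = j , eq
  ... | j , inj₂ refl = contradiction u (up-bar (edge j) (flowing j))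

  mixed-turn-unique : ∀ t t′ e → Mixed (f e) → Mixed (f (turn t e)) → Mixed (f (turn t′ e)) → t ≡ t′
  mixed-turn-unique t t′ e m mₜ mₜ′ with same⊎other t t′
  ... | inj₁ refl = refl
  ... | inj₂ refl = contradiction mₜ′ (¬mixed-other {t} {e} m mₜ)

  module Translations (P : PeriodTranslation ℛ) where
    open PeriodTranslation P

    p = period

    p-positive : 0 ℕ.< p
    p-positive = proj₁ (proj₁ leastPeriod)

    instance
      p-nonZero : ℕ.NonZero p
      p-nonZero = ℕ.>-nonZero p-positive

    τ^-edge : ∀ k i → (τ ^ k) (edge i) ≡ edge (i ℤ.+ k ℤ.* + p)
    τ^-edge k i = everywhere (λ k → ∀ i → (τ ^ k) (edge i) ≡ edge (i ℤ.+ k ℤ.* + p)) {0ℤ}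
      (λ i → cong edge (e₀ i (+ p)))
      (λ k h i → trans (^-+ τ 1ℤ k (edge i)) (trans (cong (PlaneIso.to τ) (h i))
        (trans (translates (i ℤ.+ k ℤ.* + p)) (cong edge (e₁ i k (+ p))))))
      (λ k h i → trans (sym (cong (λ k → (τ ^ k) (edge i)) (ℤₚ.pred-suc k))) (trans (^-+ τ -1ℤ (ℤ.suc k) (edge i))
        (to-from τ (trans (translates (i ℤ.+ k ℤ.* + p))
            (sym (trans (h i) (cong edge (sym (e₁ i k (+ p)))))))))) k i
      where
      e₀ : ∀ i p → i ≡ i ℤ.+ 0ℤ ℤ.* p
      e₀ = solve-∀
      e₁ : ∀ i k p → i ℤ.+ k ℤ.* p ℤ.+ p ≡ i ℤ.+ (1ℤ ℤ.+ k) ℤ.* p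
      e₁ = solve-∀

    τ^-forms : ∀ k e → f ((τ ^ k) e) ≡ f e
    τ^-forms k e = everywhere (λ k → ∀ e → f ((τ ^ k) e) ≡ f e) {0ℤ}
      (λ e → refl)
      (λ k h e → trans (cong f (^-+ τ 1ℤ k e)) (trans (preserves-forms _) (h e)))
      (λ k h e → trans (sym (preserves-forms ((τ ^ k) e))) (trans (cong f (sym (^-+ τ 1ℤ k e))) (h e))) k e

    turns-period : ∀ i k → turns (i ℤ.+ k ℤ.* + p) ≡ turns i
    turns-period i k = everywhere (λ k → turns (i ℤ.+ k ℤ.* + p) ≡ turns i) {0ℤ}
      (cong turns (e₀ i (+ p)))
      (λ k h → trans (step k) h) (λ k h → trans (sym (step k)) h) k
      where
      e₀ : ∀ i p → i ℤ.+ 0ℤ ℤ.* p ≡ i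
      e₀ = solve-∀
      e₁ : ∀ i k p → i ℤ.+ (1ℤ ℤ.+ k) ℤ.* p ≡ i ℤ.+ k ℤ.* p ℤ.+ p
      e₁ = solve-∀
      step : ∀ k → turns (i ℤ.+ ℤ.suc k ℤ.* + p) ≡ turns (i ℤ.+ k ℤ.* + p)
      step k = trans (cong turns (e₁ i k (+ p))) (proj₂ (proj₁ leastPeriod) (i ℤ.+ k ℤ.* + p))

    module _ (ψ : PlaneIso) (preserves : ∀ e → f (PlaneIso.to ψ e) ≡ f e) where
      private
        module ψ = PlaneIso ψ

        image : ∀ i → ∃[ k ] ψ.to (edge i) ≡ edge k
        image i = flowing-edge (ψ.to (edge i)) (subst Up (sym (preserves (edge i))) (flowing i))

        image-suc : ∀ i k → ψ.to (edge i) ≡ edge k →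
                    turns i ≡ turns k × ψ.to (edge (ℤ.suc i)) ≡ edge (ℤ.suc k)
        image-suc i k eq = t≡ , trans eq′ (trans (cong (λ t → turn t (edge k)) t≡) (sym (flow k)))
          where
          eq′ : ψ.to (edge (ℤ.suc i)) ≡ turn (turns i) (edge k)
          eq′ = trans (cong ψ.to (flow i)) (trans (to-turn ψ (turns i) (edge i)) (cong (turn (turns i)) eq))
          t≡ : turns i ≡ turns k
          t≡ = mixed-turn-unique (turns i) (turns k) (edge k) (on-river k)
            (subst Mixed (trans (sym (preserves (edge (ℤ.suc i)))) (cong f eq′)) (on-river (ℤ.suc i)))
            (subst (λ e → Mixed (f e)) (flow k) (on-river (ℤ.suc k)))

        k₀ = proj₁ (image 0ℤ)

        shifts : ∀ i → ψ.to (edge i) ≡ edge (i ℤ.+ k₀)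
        shifts = everywhere (λ i → ψ.to (edge i) ≡ edge (i ℤ.+ k₀)) {0ℤ}
          (trans (proj₂ (image 0ℤ)) (cong edge (sym (ℤₚ.+-identityˡ k₀))))
          (λ i h → trans (proj₂ (image-suc i (i ℤ.+ k₀) h)) (cong edge (sym (ℤₚ.+-assoc 1ℤ i k₀))))
          (λ i h → trans (proj₂ (image i)) (cong edge (suc-injective (trans
            (edge-injective (trans (sym (proj₂ (image-suc i (proj₁ (image i)) (proj₂ (image i))))) h))
            (ℤₚ.+-assoc 1ℤ i k₀)))))
          where
          suc-injective : ∀ {i j} → ℤ.suc i ≡ ℤ.suc j → i ≡ j
          suc-injective {i} {j} eq = trans (sym (ℤₚ.pred-suc i)) (trans (cong ℤ.pred eq) (ℤₚ.pred-suc j))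

        turns-shift : ∀ i → turns (i ℤ.+ k₀) ≡ turns i
        turns-shift i = sym (proj₁ (image-suc i (i ℤ.+ k₀) (shifts i)))

        k = k₀ ℤ./ℕ p
        r = k₀ ℤ.%ℕ p

        turns-remainder : ∀ i → turns (i ℤ.+ + r) ≡ turns i
        turns-remainder i = begin
          turns (i ℤ.+ + r)                ≡⟨ turns-period (i ℤ.+ + r) k ⟨
          turns (i ℤ.+ + r ℤ.+ k ℤ.* + p)  ≡⟨ cong turns (ℤₚ.+-assoc i (+ r) (k ℤ.* + p)) ⟩
          turns (i ℤ.+ (+ r ℤ.+ k ℤ.* + p))  ≡⟨ cong (λ j → turns (i ℤ.+ j)) (ℤᵈ.a≡a%ℕn+[a/ℕn]*n k₀ p) ⟨
          turns (i ℤ.+ k₀)                 ≡⟨ turns-shift i ⟩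
          turns i                          ∎
          where open ≡-Reasoning

        r≡0 : r ≡ 0
        r≡0 with r in eq
        ... | ℕ.zero  = refl
        ... | ℕ.suc m = contradiction (ℕₚ.<-≤-trans (subst (ℕ._< p) eq (ℤᵈ.n%ℕd<d k₀ p))
                (proj₂ leastPeriod (ℕ.s≤s ℕ.z≤n , subst (λ r → ∀ i → turns (i ℤ.+ + r) ≡ turns i) eq
                    turns-remainder)))
              (ℕₚ.<-irrefl refl)

      -- An automorphism preserving the forms shifts the river by some `k₀` and respects its turns.
      -- A nonzero remainder of `k₀` modulo `p` would be a period below the least one; so `ψ` agrees
      -- with a power of `τ` on one edge, hence everywhere.
      form-preserving : ∃[ k ] ∀ e → ψ.to e ≡ (τ ^ k) e
      form-preserving = k , to-≗ ψ (power τ k) {edge 0ℤ} (begin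
        ψ.to (edge 0ℤ)             ≡⟨ shifts 0ℤ ⟩
        edge (0ℤ ℤ.+ k₀)           ≡⟨ cong (λ j → edge (0ℤ ℤ.+ j)) (trans (ℤᵈ.a≡a%ℕn+[a/ℕn]*n k₀ p)
                                        (trans (cong (λ r → + r ℤ.+ k ℤ.* + p) r≡0) (ℤₚ.+-identityˡ (k ℤ.* + p)))) ⟩
        edge (0ℤ ℤ.+ k ℤ.* + p)    ≡⟨ τ^-edge k 0ℤ ⟨
        (τ ^ k) (edge 0ℤ)          ∎)
        where open ≡-Reasoning

    carry-preserves : ∀ {e e′} → f e ≡ f e′ → ∀ x → f (PlaneIso.to (carry e e′) x) ≡ f x
    carry-preserves {e} {e′} eq x with v , refl ← connected e x = begin
      f (PlaneIso.to (carry e e′) (act v e))  ≡⟨ cong f (to-act (carry e e′) v e) ⟩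
      f (act v (PlaneIso.to (carry e e′) e))  ≡⟨ cong (λ e → f (act v e)) (to-carry e e′) ⟩
      f (act v e′)                            ≡⟨ f-act v e′ ⟩
      actᶠ v (f e′)                           ≡⟨ cong (actᶠ v) eq ⟨
      actᶠ v (f e)                            ≡⟨ f-act v e ⟨
      f (act v e)                             ∎
      where open ≡-Reasoning

    -- The isomorphism carrying one edge to the other preserves all forms, because words propagate
    -- the equality at one edge; it is thus a power of `τ`.
    same-form : ∀ {e e′} → f e ≡ f e′ → ∃[ k ] e′ ≡ (τ ^ k) e
    same-form {e} {e′} eq with k , h ← form-preserving (carry e e′) (carry-preserves eq) =
      k , trans (sym (to-carry e e′)) (h e)

-- Interlacing roots make the rivers cross.

module JacobianBounds where
  open FormAction
  open Tree
  open IntegerSequences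
  open Signs
  open SignPatterns
  open import Data.Integer.Base using (_+_; _*_; _-_; -_; _<_; _≤_)
  open Form

  0≤* : ∀ {i j} → 0ℤ ≤ i → 0ℤ ≤ j → 0ℤ ≤ i * j
  0≤* {i} {j} 0≤i 0≤j = subst (_≤ i * j) (ℤₚ.*-zeroʳ i) (ℤₚ.*-monoˡ-≤-nonNeg i {{ℤ.nonNegative 0≤i}} 0≤j)

  *-mono-≤ : ∀ {i j k l} → 0ℤ ≤ i → 0ℤ ≤ l → i ≤ j → k ≤ l → i * k ≤ j * l
  *-mono-≤ {i} {j} {k} {l} 0≤i 0≤l i≤j k≤l = ℤₚ.≤-trans
    (ℤₚ.*-monoˡ-≤-nonNeg i {{ℤ.nonNegative 0≤i}} k≤l) (ℤₚ.*-monoʳ-≤-nonNeg l {{ℤ.nonNegative 0≤l}} i≤j)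

  -- On the river `- C` is at least one, so `B² + 4A(-C)` dominates `A`: coefficients on the river
  -- are bounded by the discriminant.
  up⇒A≤disc : ∀ q → Up q → A q ≤ disc q
  up⇒A≤disc [ A , B , C ] (0<A , C<0) = subst₂ _≤_ (ℤₚ.+-identityʳ A) (eq A B C)
    (ℤₚ.+-monoʳ-≤ A (ℤₚ.+-mono-≤ (0≤i*i B) (ℤₚ.+-mono-≤ (0≤* (0≤* 0≤3 0≤A) (ℤₚ.<⇒≤ 0<-C))
      (0≤* 0≤A (ℤₚ.i≤j⇒0≤j-i (ℤₚ.i<j⇒suc[i]≤j 0<-C))))))
    where
    0≤A = ℤₚ.<⇒≤ 0<A
    0<-C = 0<- C<0
    0≤3 : 0ℤ ≤ + 3
    0≤3 = ℤ.+≤+ ℕ.z≤n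
    eq : ∀ A B C → A + (B * B + (+ 3 * A * - C + A * (- C - 1ℤ))) ≡ B * B - + 4 * A * C
    eq = solve-∀

  up⇒-C≤disc : ∀ q → Up q → - C q ≤ disc q
  up⇒-C≤disc [ A , B , C ] (0<A , C<0) =
    subst (- C ≤_) (eq A B C) (up⇒A≤disc [ - C , B , - A ] (0<- C<0 , -<0 0<A))
    where
    eq : ∀ A B C → B * B - + 4 * - C * - A ≡ B * B - + 4 * A * C
    eq = solve-∀

  up⇒0<disc : ∀ q → Up q → 0ℤ < disc q
  up⇒0<disc q u@(0<A , _) = ℤₚ.<-≤-trans 0<A (up⇒A≤disc q u)

  -- When both forms follow the flow, the two terms of `2(aC - Ac)` have opposite signs. Dropping
  -- the negative one leaves a product of two coefficients, each bounded by its discriminant.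
  jac-bound : ∀ q q′ → Up q → Up q′ → B (jac q q′) ≤ + 2 * (disc q * disc q′)
  jac-bound q@([ a , b , c ]) q′@([ A , B , C ]) u@(0<a , c<0) u′@(0<A , C<0) = begin
    + 2 * (a * C - A * c)   ≤⟨ ℤₚ.*-monoˡ-≤-nonNeg (+ 2) (subst₂ _≤_ (eq a c A C) (ℤₚ.+-identityˡ (- c * A))
                                (ℤₚ.+-monoˡ-≤ (- c * A) (ℤₚ.<⇒≤ (±⇒*<0 0<a C<0)))) ⟩
    + 2 * (- c * A)         ≤⟨ ℤₚ.*-monoˡ-≤-nonNeg (+ 2) (*-mono-≤ (ℤₚ.<⇒≤ (0<- c<0)) (ℤₚ.<⇒≤ (up⇒0<disc q′ u′))
                                (up⇒-C≤disc q u) (up⇒A≤disc q′ u′)) ⟩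
    + 2 * (disc q * disc q′) ∎
    where
    open ℤₚ.≤-Reasoning
    eq : ∀ a c A C → a * C + - c * A ≡ a * C - A * c
    eq = solve-∀

  jac-bound′ : ∀ q q′ → Up q → Up q′ → - B (jac q q′) ≤ + 2 * (disc q * disc q′)
  jac-bound′ q@([ a , b , c ]) q′@([ A , B , C ]) u@(0<a , c<0) u′@(0<A , C<0) = begin
    - (+ 2 * (a * C - A * c))   ≡⟨ eq a c A C ⟩
    + 2 * (A * c + a * - C)   ≤⟨ ℤₚ.*-monoˡ-≤-nonNeg (+ 2) (subst (A * c + a * - C ≤_) (ℤₚ.+-identityˡ (a * - C))
                                (ℤₚ.+-monoˡ-≤ (a * - C) (ℤₚ.<⇒≤ (±⇒*<0 0<A c<0)))) ⟩
    + 2 * (a * - C)         ≤⟨ ℤₚ.*-monoˡ-≤-nonNeg (+ 2) (*-mono-≤ (ℤₚ.<⇒≤ 0<a) (ℤₚ.<⇒≤ (up⇒0<disc q′ u′))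
                                (up⇒A≤disc q u) (up⇒-C≤disc q′ u′)) ⟩
    + 2 * (disc q * disc q′) ∎
    where
    open ℤₚ.≤-Reasoning
    eq : ∀ a c A C → - (+ 2 * (a * C - A * c)) ≡ + 2 * (A * c + a * - C)
    eq = solve-∀

  B-jac-negateʳ : ∀ q q′ → B (jac q (negate q′)) ≡ - B (jac q q′)
  B-jac-negateʳ [ a , b , c ] [ A , B , C ] = eq a c A C
    where
    eq : ∀ a c A C → + 2 * (a * - C - - A * c) ≡ - (+ 2 * (a * C - A * c))
    eq = solve-∀

  disc-negate : ∀ q → disc (negate q) ≡ disc q
  disc-negate [ A , B , C ] = eq A B C
    where
    eq : ∀ A B C → - B * - B - + 4 * - A * - C ≡ B * B - + 4 * A * C
    eq = solve-∀

  jac-bound-mixed : ∀ q q′ → Up q → Mixed q′ → let K = + 2 * (disc q * disc q′) in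
                    B (jac q q′) ≤ K × - B (jac q q′) ≤ K
  jac-bound-mixed q q′ u m with mixed⇒up⊎down q′ m
  ... | inj₁ u′          = jac-bound q q′ u u′ , jac-bound′ q q′ u u′
  ... | inj₂ (A<0 , 0<C) =
    subst₂ _≤_ (trans (cong -_ (B-jac-negateʳ q q′)) (ℤₚ.neg-involutive _))
        (cong (λ D → + 2 * (disc q * D)) (disc-negate q′))
      (jac-bound′ q (negate q′) u u′) ,
    subst₂ _≤_ (B-jac-negateʳ q q′) (cong (λ D → + 2 * (disc q * D)) (disc-negate q′))
      (jac-bound q (negate q′) u u′)
    where
    u′ : Up (negate q′)
    u′ = 0<- A<0 , -<0 0<C

  jac-negative : ∀ q q′ → Up q → Negative q′ → B (jac q q′) < 0ℤ
  jac-negative q@([ a , b , c ]) q′@([ A , B , C ]) (0<a , c<0) (A<0 , C<0) =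
    0<-⁻¹ (by (eq a c A C) (0<* 0<2 (0<+ (0<* 0<a (0<- C<0)) (−−⇒0<* A<0 c<0))))
    where
    eq : ∀ a c A C → + 2 * (a * - C + A * c) ≡ - (+ 2 * (a * C - A * c))
    eq = solve-∀

  jac-positive : ∀ q q′ → Up q → Positive q′ → 0ℤ < B (jac q q′)
  jac-positive q@([ a , b , c ]) q′@([ A , B , C ]) (0<a , c<0) (0<A , 0<C) =
    by (eq a c A C) (0<* 0<2 (0<+ (0<* 0<a 0<C) (0<* 0<A (0<- c<0))))
    where
    eq : ∀ a c A C → + 2 * (a * C + A * - c) ≡ + 2 * (a * C - A * c)
    eq = solve-∀

  -- Beyond the bound `q′` cannot be mixed, and a negative `q′` would make the middle coefficient of
  -- the Jacobian negative; the positive pattern is all that remains.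
  far-positive : ∀ q q′ → Up q → Anisotropic q′ → 0ℤ < disc q′ → + 2 * (disc q * disc q′) < B (jac q q′) →
      Positive q′
  far-positive q q′ u aniso 0<D far with pattern-of {q′} aniso
  ... | up u′       = contradiction far (ℤₚ.≤⇒≯ (proj₁ (jac-bound-mixed q q′ u (up⇒mixed q′ u′))))
  ... | down d′     = contradiction far (ℤₚ.≤⇒≯ (proj₁ (jac-bound-mixed q q′ u (down⇒mixed q′ d′))))
  ... | positive p  = p
  ... | negative n  = contradiction (jac-negative q q′ u n)
                        (ℤₚ.<-asym (ℤₚ.<-trans (0<* 0<2 (0<* (up⇒0<disc q u) 0<D)) far))

  far-negative : ∀ q q′ → Up q → Anisotropic q′ → 0ℤ < disc q′ → + 2 * (disc q * disc q′) < - B (jac q q′) →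
      Negative q′
  far-negative q q′ u aniso 0<D far with pattern-of {q′} aniso
  ... | up u′       = contradiction far (ℤₚ.≤⇒≯ (proj₂ (jac-bound-mixed q q′ u (up⇒mixed q′ u′))))
  ... | down d′     = contradiction far (ℤₚ.≤⇒≯ (proj₂ (jac-bound-mixed q q′ u (down⇒mixed q′ d′))))
  ... | negative n  = n
  ... | positive p  = contradiction (0<-⁻¹ (ℤₚ.<-trans (0<* 0<2 (0<* (up⇒0<disc q u) 0<D)) far))
                        (ℤₚ.<-asym (jac-positive q q′ u p))

module Adjacent where
  open FormAction
  open Tree
  open IntegerSequences
  open Signs
  open SignPatterns
  open Form

  -- Consecutive edges share a region, so both signs cannot change in one turn. The same reason
  -- gives the two lemmas that follow.
  negative⇏positive : ∀ t q → Negative q → ¬ Positive (turnᶠ t q)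
  negative⇏positive L q (A<0 , _) (0<A , _) = ℤₚ.<-asym A<0 0<A
  negative⇏positive R q (_ , C<0) (_ , 0<C) = ℤₚ.<-asym C<0 0<C

  up⇏down : ∀ t q → Up q → ¬ Down (turnᶠ t q)
  up⇏down L q (0<A , _) (A<0 , _) = ℤₚ.<-asym A<0 0<A
  up⇏down R q (_ , C<0) (_ , 0<C) = ℤₚ.<-asym C<0 0<C

  down⇏up : ∀ t q → Down q → ¬ Up (turnᶠ t q)
  down⇏up L q (A<0 , _) (0<A , _) = ℤₚ.<-asym A<0 0<A
  down⇏up R q (_ , 0<C) (_ , C<0) = ℤₚ.<-asym C<0 0<C

module CrossingCriterion
  {q₁ q₂ : Form} {𝒯₁ : Topograph q₁} {𝒯₂ : Topograph q₂} (ℛ₁ : River 𝒯₁)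
  (aniso₂ : SignPatterns.Anisotropic q₂) (0<D₂ : 0ℤ ℤ.< disc q₂) (φ : PlaneIso)
  where
  open FormAction
  open Tree
  open IntegerSequences
  open Signs
  open SignPatterns
  open Turns
  open JacobianBounds
  open Adjacent
  open Form using (A; B; C)
  open River ℛ₁
  module 𝒯₁ = Topograph 𝒯₁
  module 𝒯₂ = Topograph 𝒯₂
  open PlaneIso φ using (from)

  𝒻 ℊ : Labelling
  𝒻 = labelling 𝒯₁
  ℊ = pullback (labelling 𝒯₂) (inverse φ)

  open Labelling 𝒻 using () renaming (f to f; f-disc to f-disc)

  -- `ℊ′` is ℊ up to sign, normalised so that the Jacobian is positive definite.
  module Construction (ℊ′ : Labelling) (disc≡ : ∀ e → disc (Labelling.f ℊ′ e) ≡ disc q₂)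
                      (mixed : ∀ {e} → Mixed (Labelling.f ℊ′ e) → OnImage 𝒯₁ 𝒯₂ φ e)
                      (definite : ∀ e → Definite (jac (f e) (Labelling.f ℊ′ e))) where
    open Labelling ℊ′ using () renaming (f to g)
    module f = LabellingSigns 𝒻
    module g = LabellingSigns ℊ′

    f-next : ∀ i → f (edge (ℤ.suc i)) ≡ turnᶠ (turns i) (f (edge i))
    f-next i = trans (cong f (flow i)) (f.f-turn (turns i) (edge i))

    g-next : ∀ i → g (edge (ℤ.suc i)) ≡ turnᶠ (turns i) (g (edge i))
    g-next i = trans (cong g (flow i)) (g.f-turn (turns i) (edge i))

    anisotropic : ∀ e → Anisotropic (g e)
    anisotropic e n eq = aniso₂ n (trans eq (disc≡ e))

    PathStep : Edge → Edge → Set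
    PathStep e e′ = Next e e′ × Shared 𝒯₁ 𝒯₂ φ e′

    SameSign : Edge → Edge → Set
    SameSign e e′ = (Up (g e) × Up (g e′)) ⊎ (Down (g e) × Down (g e′))

    same-sign-mixed : ∀ {e e′} → SameSign e e′ → Mixed (g e′)
    same-sign-mixed {e′ = e′} (inj₁ (_ , u)) = up⇒mixed (g e′) u
    same-sign-mixed {e′ = e′} (inj₂ (_ , d)) = down⇒mixed (g e′) d

    -- The state of a walk along the river of `f`: at `j` both regions of `g` are negative, and from
    -- its successor up to `k` the rivers run together. `signs` compares just the two ends, because
    -- the sides of entry and exit depend on them.
    record Run (k : ℤ) : Set where
      constructor run
      field
        j        : ℤ
        negativeʲ : Negative (g (edge j))
        path     : Star PathStep (edge (ℤ.suc j)) (edge k)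
        signs    : SameSign (edge (ℤ.suc j)) (edge k)

    shared : ∀ i → Mixed (g (edge i)) → Shared 𝒯₁ 𝒯₂ φ (edge i)
    shared i m = up⇒mixed (f (edge i)) (flowing i) , mixed m

    start : ∀ i → Negative (g (edge i)) → SameSign (edge (ℤ.suc i)) (edge (ℤ.suc i)) → Run (ℤ.suc i)
    start i n signs = run i n Star.ε signs

    extend : ∀ i → (r : Run i) → SameSign (edge (ℤ.suc (Run.j r))) (edge (ℤ.suc i)) → Run (ℤ.suc i)
    extend i (run j n path _) signs = run j n
      (path ◅◅ (((turns i , flow i) , shared (ℤ.suc i)
          (same-sign-mixed {edge (ℤ.suc j)} {edge (ℤ.suc i)} signs)) ◅ Star.ε)) signs

    Completed : Set
    Completed = ∃[ k ] Run k × Positive (g (edge (ℤ.suc k)))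

    -- Signs change in one region at a time, so the walk from a negative to a positive edge passes
    -- through mixed edges, all up or all down. A return to negative discards the current run. The
    -- counter `n` measures the distance to an edge known to be positive.
    scan : ∀ n i → Negative (g (edge i)) ⊎ Run i → Positive (g (edge (i ℤ.+ + n))) → Completed
    scan ℕ.zero i s p with subst (λ i → Positive (g (edge i))) (ℤₚ.+-identityʳ i) p | s
    ... | 0<A , _ | inj₁ (A<0 , _) = contradiction 0<A (ℤₚ.<-asym A<0)
    ... | p′      | inj₂ r = contradiction (same-sign-mixed {edge (ℤ.suc (Run.j r))} {edge i} (Run.signs r))
        (positive⇒¬mixed (g (edge i)) p′)
    scan (ℕ.suc n) i s p with pattern-of {g (edge (ℤ.suc i))} (anisotropic (edge (ℤ.suc i))) | s
    ... | negative neg | _ = scan n (ℤ.suc i) (inj₁ neg) (subst (λ j → Positive (g (edge j))) (+-suc-shift i n) p)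
    ... | up u | inj₁ neg =
      scan n (ℤ.suc i) (inj₂ (start i neg (inj₁ (u , u)))) (subst (λ j → Positive (g (edge j))) (+-suc-shift i n) p)
    ... | down d | inj₁ neg =
      scan n (ℤ.suc i) (inj₂ (start i neg (inj₂ (d , d)))) (subst (λ j → Positive (g (edge j))) (+-suc-shift i n) p)
    ... | positive pos | inj₁ neg = contradiction (subst Positive (g-next i) pos)
        (negative⇏positive (turns i) (g (edge i)) neg)
    ... | up u | inj₂ r@(run _ _ _ (inj₁ (u₀ , _))) =
      scan n (ℤ.suc i) (inj₂ (extend i r (inj₁ (u₀ , u)))) (subst (λ j → Positive (g (edge j))) (+-suc-shift i n) p)
    ... | up u | inj₂ (run _ _ _ (inj₂ (_ , d))) = contradiction (subst Up (g-next i) u)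
        (down⇏up (turns i) (g (edge i)) d)
    ... | down d | inj₂ r@(run _ _ _ (inj₂ (d₀ , _))) =
      scan n (ℤ.suc i) (inj₂ (extend i r (inj₂ (d₀ , d)))) (subst (λ j → Positive (g (edge j))) (+-suc-shift i n) p)
    ... | down d | inj₂ (run _ _ _ (inj₁ (_ , u))) = contradiction (subst Down (g-next i) d)
        (up⇏down (turns i) (g (edge i)) u)
    ... | positive pos | inj₂ r = i , r , pos

    b : ℤ → ℤ
    b i = B (jac (f (edge i)) (g (edge i)))

    b-increases : ∀ i → b i ℤ.< b (ℤ.suc i)
    b-increases i = subst (λ q → b i ℤ.< B q) (sym (trans (cong w (flow i)) (w.f-turn (turns i) (edge i))))
      (B-increases (turns i) (w (edge i)) (definite (edge i)))
      where
      𝓌 = jacobian 𝒻 ℊ′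
      open Labelling 𝓌 using () renaming (f to w)
      module w = LabellingSigns 𝓌

    -- The bound of `jac-bound-mixed`, common to all edges because both discriminants are constant
    -- on the tree.
    K : ℤ
    K = + 2 ℤ.* (disc q₁ ℤ.* disc q₂)

    K≡ : ∀ i → K ≡ + 2 ℤ.* (disc (f (edge i)) ℤ.* disc (g (edge i)))
    K≡ i = cong₂ (λ D D′ → + 2 ℤ.* (D ℤ.* D′))
      (trans (cong disc (sym 𝒯₁.f-base)) (f-disc 𝒯₁.base (edge i))) (sym (disc≡ (edge i)))

    far-positive-at : ∀ i → K ℤ.< b i → Positive (g (edge i))
    far-positive-at i far = far-positive (f (edge i)) (g (edge i)) (flowing i) (anisotropic (edge i))
      (subst (0ℤ ℤ.<_) (sym (disc≡ (edge i))) 0<D₂) (subst (ℤ._< b i) (K≡ i) far)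

    far-negative-at : ∀ i → K ℤ.< ℤ.- b i → Negative (g (edge i))
    far-negative-at i far = far-negative (f (edge i)) (g (edge i)) (flowing i) (anisotropic (edge i))
      (subst (0ℤ ℤ.<_) (sym (disc≡ (edge i))) 0<D₂) (subst (ℤ._< ℤ.- b i) (K≡ i) far)

    completed : Completed
    completed = between (unbounded b b-increases K)
      where
      between : ∃[ i ] ∃[ n ] K ℤ.< ℤ.- b i × K ℤ.< b (i ℤ.+ + n) → Completed
      between (i , n , K<-b , K<b) = scan n i (inj₁ (far-negative-at i K<-b)) (far-positive-at (i ℤ.+ + n) K<b)

    last-index : ∃[ k ] Mixed (g (edge k)) × Positive (g (edge (ℤ.suc k)))
    last-index = last completed
      where
      last : Completed → ∃[ k ] Mixed (g (edge k)) × Positive (g (edge (ℤ.suc k)))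
      last (k , r , p) = k , same-sign-mixed {edge (ℤ.suc (Run.j r))} {edge k} (Run.signs r) , p

    positive-side : ∀ j → turns j ≡ R → Positive (f (left (edge j)))
    positive-side j eq with 0<M , _ ← subst Up (trans (f-next j) (cong (λ t → turnᶠ t (f (edge j))) eq))
        (flowing (ℤ.suc j)) =
      subst Positive (sym (f.f-turn L (edge j))) (proj₁ (flowing j) , 0<M)

    negative-side : ∀ j → turns j ≡ L → Negative (f (right (edge j)))
    negative-side j eq with _ , M<0 ← subst Up (trans (f-next j) (cong (λ t → turnᶠ t (f (edge j))) eq))
        (flowing (ℤ.suc j)) =
      subst Negative (sym (f.f-turn R (edge j))) (M<0 , proj₂ (flowing j))

    g-next′ : ∀ j {t} → turns j ≡ t → g (edge (ℤ.suc j)) ≡ turnᶠ t (g (edge j))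
    g-next′ j eq = trans (g-next j) (cong (λ t → turnᶠ t (g (edge j))) eq)

    before : ∀ j → Next (bar (edge (ℤ.suc j))) (turn (other (turns j)) (edge j))
    before j = turns j , sym (trans (cong (λ e → turn (turns j) (bar e)) (flow j))
        (turn-bar-turn (turns j) (edge j)))

    -- The turns at both ends are forced: a turn replaces one region, so the sign that changes tells
    -- which turn was made. For an up run the river of `f` turns right before it and left after it,
    -- hence the other river arrives from the left, positive bank and departs to the right, negative
    -- one. Down runs are the mirror image.
    assemble : ∀ k (r : Run k) → let j = Run.j r in SameSign (edge (ℤ.suc j)) (edge k) →
               ∀ tʲ → turns j ≡ tʲ → ∀ tᵏ → turns k ≡ tᵏ → Positive (g (edge (ℤ.suc k))) → Crosses 𝒯₁ 𝒯₂ φ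
    assemble k (run j neg path _) (inj₁ (uʲ , _)) L eqʲ tᵏ eqᵏ pos =
      contradiction (proj₁ (subst Up (g-next′ j eqʲ) uʲ)) (ℤₚ.<-asym (proj₁ neg))
    assemble k (run j neg path _) (inj₁ (_ , uᵏ)) R eqʲ R eqᵏ pos =
      contradiction (proj₂ (subst Positive (g-next′ k eqᵏ) pos)) (ℤₚ.<-asym (proj₂ uᵏ))
    assemble k (run j neg path _) (inj₁ (uʲ , uᵏ)) R eqʲ L eqᵏ pos = record
      { first = edge (ℤ.suc j) ; last = edge k
      ; first-shared = shared (ℤ.suc j) (up⇒mixed (g (edge (ℤ.suc j))) uʲ)
      ; path = path
      ; entry = left (edge j) ; exit = right (edge k)
      ; before-first = subst (λ t → Next (bar (edge (ℤ.suc j))) (turn (other t) (edge j))) eqʲ (before j)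
      ; after-last = R , refl
      ; entry-on-image = mixed (subst Mixed (sym (g.f-turn L (edge j)))
          (down⇒mixed (turnᶠ L (g (edge j))) (proj₁ neg , proj₁ (subst Up (g-next′ j eqʲ) uʲ))))
      ; exit-on-image = mixed (subst Mixed (sym (g.f-turn R (edge k)))
          (up⇒mixed (turnᶠ R (g (edge k))) (proj₂ (subst Positive (g-next′ k eqᵏ) pos) , proj₂ uᵏ)))
      ; sides = inj₁ (positive-side j eqʲ , negative-side k eqᵏ)
      }
    assemble k (run j neg path _) (inj₂ (dʲ , _)) R eqʲ tᵏ eqᵏ pos =
      contradiction (proj₂ (subst Down (g-next′ j eqʲ) dʲ)) (ℤₚ.<-asym (proj₂ neg))
    assemble k (run j neg path _) (inj₂ (_ , dᵏ)) L eqʲ L eqᵏ pos =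
      contradiction (proj₁ (subst Positive (g-next′ k eqᵏ) pos)) (ℤₚ.<-asym (proj₁ dᵏ))
    assemble k (run j neg path _) (inj₂ (dʲ , dᵏ)) L eqʲ R eqᵏ pos = record
      { first = edge (ℤ.suc j) ; last = edge k
      ; first-shared = shared (ℤ.suc j) (down⇒mixed (g (edge (ℤ.suc j))) dʲ)
      ; path = path
      ; entry = right (edge j) ; exit = left (edge k)
      ; before-first = subst (λ t → Next (bar (edge (ℤ.suc j))) (turn (other t) (edge j))) eqʲ (before j)
      ; after-last = L , refl
      ; entry-on-image = mixed (subst Mixed (sym (g.f-turn R (edge j)))
          (up⇒mixed (turnᶠ R (g (edge j))) (proj₂ (subst Down (g-next′ j eqʲ) dʲ) , proj₂ neg)))
      ; exit-on-image = mixed (subst Mixed (sym (g.f-turn L (edge k)))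
          (down⇒mixed (turnᶠ L (g (edge k))) (proj₁ dᵏ , proj₁ (subst Positive (g-next′ k eqᵏ) pos))))
      ; sides = inj₂ (negative-side j eqʲ , positive-side k eqᵏ)
      }

    crosses : Crosses 𝒯₁ 𝒯₂ φ
    crosses = from-run completed
      where
      from-run : Completed → Crosses 𝒯₁ 𝒯₂ φ
      from-run (k , r , pos) = assemble k r (Run.signs r) (turns (Run.j r)) refl (turns k) refl pos

  open Labelling ℊ using () renaming (f to g)

  -- Marks the end of the shared path by signs at two consecutive edges, hence decidably at each
  -- index; together with its uniqueness this makes crossings countable.
  ExitIndex : ℤ → Set
  ExitIndex k = Mixed (g (edge k)) × ¬ Mixed (g (edge (ℤ.suc k)))

  disc-g : ∀ e → disc (g e) ≡ disc q₂
  disc-g e = trans (Labelling.f-disc ℊ e (PlaneIso.to φ 𝒯₂.base))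
    (cong disc (trans (cong 𝒯₂.f (PlaneIso.strictlyInverseʳ φ 𝒯₂.base)) 𝒯₂.f-base))

  -- A negative discriminant makes the Jacobian definite. If it is negative definite, `g` is
  -- replaced by its negative, which has the same mixed edges.
  crossing⇒crosses : ∀ {e} → Crossing (f e) (g e) → Crosses 𝒯₁ 𝒯₂ φ × ∃[ k ] ExitIndex k
  crossing⇒crosses {e} disc<0 with sign-of (A (jac (f e) (g e))) A≢
    where
    A≢ : A (jac (f e) (g e)) ≢ 0ℤ
    A≢ eq = ℤₚ.≤⇒≯ (0≤i*i (B (jac (f e) (g e)))) (subst (ℤ._< 0ℤ) (disc-A≡0 (jac (f e) (g e)) eq) disc<0)
      where
      disc-A≡0 : ∀ q → A q ≡ 0ℤ → disc q ≡ B q ℤ.* B q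
      disc-A≡0 [ .0ℤ , b , c ] refl = eq′ b c
        where
        eq′ : ∀ b c → b ℤ.* b ℤ.- + 4 ℤ.* 0ℤ ℤ.* c ≡ b ℤ.* b
        eq′ = solve-∀
  ... | inj₁ 0<A = crosses , exit last-index
    where
    open Construction ℊ disc-g (λ m → m)
      (LabellingSigns.definite-everywhere (jacobian 𝒻 ℊ) {e} (disc<0 , 0<A))
    exit : ∃[ k ] Mixed (g (edge k)) × Positive (g (edge (ℤ.suc k))) → ∃[ k ] ExitIndex k
    exit (k , m , p) = k , m , positive⇒¬mixed (g (edge (ℤ.suc k))) p
  ... | inj₂ A<0 = crosses , exit last-index
    where
    A-negate : ∀ q q′ → A (jac q (negate q′)) ≡ ℤ.- A (jac q q′)
    A-negate [ a , b , c ] [ A , B , C ] = eq a b A B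
      where
      eq : ∀ a b A B → a ℤ.* ℤ.- B ℤ.- ℤ.- A ℤ.* b ≡ ℤ.- (a ℤ.* B ℤ.- A ℤ.* b)
      eq = solve-∀
    open Construction (negation ℊ) (λ e → trans (disc-negate (g e)) (disc-g e)) (λ {e} → mixed-negate⁻¹ (g e))
      (LabellingSigns.definite-everywhere (jacobian 𝒻 (negation ℊ)) {e}
        (subst (ℤ._< 0ℤ) (sym (disc-jac-negateʳ (f e) (g e))) disc<0 , subst (0ℤ ℤ.<_)
            (sym (A-negate (f e) (g e))) (0<- A<0)))
    exit : ∃[ k ] Mixed (negate (g (edge k))) × Positive (negate (g (edge (ℤ.suc k)))) → ∃[ k ] ExitIndex k
    exit (k , m , p) = k , mixed-negate⁻¹ (g (edge k)) m ,
      λ m′ → positive⇒¬mixed (negate (g (edge (ℤ.suc k)))) p (mixed-negate (g (edge (ℤ.suc k))) m′)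

  -- Once the rivers have parted they never meet again.
  exit-last : ∀ {k k′} → ExitIndex k → ExitIndex k′ → ¬ (k ℤ.< k′)
  exit-last {k} {k′} (m , ¬m) (m′ , _) k<k′ = escaping⇒¬mixed (g (edge k′)) escaping m′
    where
    module g = LabellingSigns ℊ
    step : ∀ j → g (edge (ℤ.suc j)) ≡ turnᶠ (turns j) (g (edge j))
    step j = trans (cong g (flow j)) (g.f-turn (turns j) (edge j))
    first : Escaping (g (edge (ℤ.suc k)))
    first = subst Escaping (sym (step k)) (escape (turns k) (g (edge k))
      (subst Anisotropic (step k) (λ n eq → aniso₂ n (trans eq (disc-g (edge (ℤ.suc k))))))
      m (λ m″ → ¬m (subst Mixed (sym (step k)) m″)))
    escaping : Escaping (g (edge k′))
    escaping = ascend-≤ (λ j → Escaping (g (edge j))) first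
      (λ j c → subst Escaping (sym (step j)) (escaping-turn (turns j) (g (edge j)) c)) (ℤₚ.i<j⇒suc[i]≤j k<k′)

  exit-unique : ∀ {k k′} → ExitIndex k → ExitIndex k′ → k ≡ k′
  exit-unique {k} {k′} x x′ with ℤₚ.<-cmp k k′
  ... | tri< k<k′ _ _ = contradiction k<k′ (exit-last x x′)
  ... | tri≈ _ k≡k′ _ = k≡k′
  ... | tri> _ _ k′<k = contradiction k′<k (exit-last x′ x)

-- Arithmetic in the ordered field.

module OrderedField {r ℓ₁ ℓ₂} (ℝ : RealField r ℓ₁ ℓ₂) where
  open RealField ℝ renaming (refl to ≈-refl; sym to ≈-sym; trans to ≈-trans; reflexive to ≈-reflexive; setoid to ≈-setoid; isEquivalence to ≈-isEquivalence) public
  open IsStrictTotalOrder isStrictTotalOrder public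
    using (compare; _≟_)
    renaming (trans to <-trans; irrefl to <-irrefl; asym to <-asym; <-respˡ-≈ to <-respˡ; <-respʳ-≈ to <-respʳ)
  open RingProperties ring public using (-‿involutive; -‿distribˡ-*; -‿distribʳ-*; -‿+-comm; -0#≈0#)
  open MonoidMult +-monoid using (×-homo-+)
  open SemiringMult semiring using (×1-homo-*)
  module ≈-Reasoning = SetoidReasoning ≈-setoid

  private
    infix 8 _·1
    _·1 : ℕ → Carrier
    n ·1 = n · 1#

    cancel-suc : ∀ x y → x + - y ≈ (1# + x) + - (1# + y)
    cancel-suc x y = begin
      x + - y                    ≈⟨ +-identityˡ (x + - y) ⟨
      0# + (x + - y)             ≈⟨ +-congʳ (-‿inverseʳ 1#) ⟨
      1# + - 1# + (x + - y)      ≈⟨ +-assoc 1# (- 1#) (x + - y) ⟩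
      1# + (- 1# + (x + - y))    ≈⟨ +-congˡ (+-assoc (- 1#) x (- y)) ⟨
      1# + (- 1# + x + - y)      ≈⟨ +-congˡ (+-congʳ (+-comm (- 1#) x)) ⟩
      1# + (x + - 1# + - y)      ≈⟨ +-congˡ (+-assoc x (- 1#) (- y)) ⟩
      1# + (x + (- 1# + - y))    ≈⟨ +-assoc 1# x (- 1# + - y) ⟨
      1# + x + (- 1# + - y)      ≈⟨ +-congˡ (-‿+-comm 1# y) ⟩
      1# + x + - (1# + y)        ∎
      where open ≈-Reasoning

  fromℤ-⊖ : ∀ m n → fromℤ (m ℤ.⊖ n) ≈ m ·1 + - (n ·1)
  fromℤ-⊖ ℕ.zero    ℕ.zero    = ≈-sym (≈-trans (+-identityˡ (- 0#)) -0#≈0#)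
  fromℤ-⊖ ℕ.zero    (ℕ.suc n) = ≈-sym (+-identityˡ _)
  fromℤ-⊖ (ℕ.suc m) ℕ.zero    = ≈-sym (≈-trans (+-congˡ -0#≈0#) (+-identityʳ _))
  fromℤ-⊖ (ℕ.suc m) (ℕ.suc n) = ≈-trans (≈-reflexive (cong fromℤ (ℤₚ.[1+m]⊖[1+n]≡m⊖n m n)))
    (≈-trans (fromℤ-⊖ m n) (cancel-suc (m ·1) (n ·1)))

  fromℤ-+ : ∀ i j → fromℤ (i ℤ.+ j) ≈ fromℤ i + fromℤ j
  fromℤ-+ (+ m)    (+ n)    = ×-homo-+ 1# m n
  fromℤ-+ (+ m)    -[1+ n ] = fromℤ-⊖ m (ℕ.suc n)
  fromℤ-+ -[1+ m ] (+ n)    = ≈-trans (fromℤ-⊖ n (ℕ.suc m)) (+-comm (n ·1) _)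
  fromℤ-+ -[1+ m ] -[1+ n ] = ≈-trans
    (-‿cong (≈-trans (≈-reflexive (cong (λ k → ℕ.suc k ·1) (sym (ℕₚ.+-suc m n))))
        (×-homo-+ 1# (ℕ.suc m) (ℕ.suc n))))
    (≈-sym (-‿+-comm (ℕ.suc m ·1) (ℕ.suc n ·1)))

  fromℤ-neg : ∀ i → fromℤ (ℤ.- i) ≈ - fromℤ i
  fromℤ-neg (+ ℕ.zero)  = ≈-sym -0#≈0#
  fromℤ-neg (+ ℕ.suc n) = ≈-refl
  fromℤ-neg -[1+ n ]    = ≈-sym (-‿involutive _)

  private
    fromℤ-*-pos : ∀ m n → fromℤ (+ m ℤ.* + n) ≈ fromℤ (+ m) * fromℤ (+ n)
    fromℤ-*-pos m n = ≈-trans (≈-reflexive (cong fromℤ (sym (ℤₚ.pos-* m n)))) (×1-homo-* m n)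

  fromℤ-* : ∀ i j → fromℤ (i ℤ.* j) ≈ fromℤ i * fromℤ j
  fromℤ-* (+ m)    (+ n)    = fromℤ-*-pos m n
  fromℤ-* (+ m)    -[1+ n ] = begin
    fromℤ (+ m ℤ.* -[1+ n ])               ≈⟨ ≈-reflexive (cong fromℤ (ℤₚ.neg-distribʳ-* (+ m) (+ ℕ.suc n))) ⟨
    fromℤ (ℤ.- (+ m ℤ.* + ℕ.suc n))        ≈⟨ fromℤ-neg (+ m ℤ.* + ℕ.suc n) ⟩
    - fromℤ (+ m ℤ.* + ℕ.suc n)            ≈⟨ -‿cong (fromℤ-*-pos m (ℕ.suc n)) ⟩
    - (fromℤ (+ m) * fromℤ (+ ℕ.suc n))    ≈⟨ -‿distribʳ-* _ _ ⟩
    fromℤ (+ m) * fromℤ -[1+ n ]           ∎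
    where open ≈-Reasoning
  fromℤ-* -[1+ m ] (+ n)    = begin
    fromℤ (-[1+ m ] ℤ.* + n)               ≈⟨ ≈-reflexive (cong fromℤ (ℤₚ.neg-distribˡ-* (+ ℕ.suc m) (+ n))) ⟨
    fromℤ (ℤ.- (+ ℕ.suc m ℤ.* + n))        ≈⟨ fromℤ-neg (+ ℕ.suc m ℤ.* + n) ⟩
    - fromℤ (+ ℕ.suc m ℤ.* + n)            ≈⟨ -‿cong (fromℤ-*-pos (ℕ.suc m) n) ⟩
    - (fromℤ (+ ℕ.suc m) * fromℤ (+ n))    ≈⟨ -‿distribˡ-* _ _ ⟩
    fromℤ -[1+ m ] * fromℤ (+ n)           ∎
    where open ≈-Reasoning
  fromℤ-* -[1+ m ] -[1+ n ] = begin
    fromℤ (+ ℕ.suc m ℤ.* + ℕ.suc n)        ≈⟨ fromℤ-*-pos (ℕ.suc m) (ℕ.suc n) ⟩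
    ℕ.suc m ·1 * ℕ.suc n ·1                ≈⟨ -‿involutive _ ⟨
    - - (ℕ.suc m ·1 * ℕ.suc n ·1)          ≈⟨ -‿cong (-‿distribʳ-* _ _) ⟩
    - (ℕ.suc m ·1 * - (ℕ.suc n ·1))        ≈⟨ -‿distribˡ-* _ _ ⟩
    - (ℕ.suc m ·1) * - (ℕ.suc n ·1)        ∎
    where open ≈-Reasoning

  fromℤ-1 : fromℤ 1ℤ ≈ 1#
  fromℤ-1 = +-identityʳ 1#

  fromℤ-cong : ∀ {i j} → i ≡ j → fromℤ i ≈ fromℤ j
  fromℤ-cong refl = ≈-refl

  private
    -- Gives the ring solver integer literals as coefficients, with decidable equality, although the
    -- field elements are abstract.
    ℤ⟶ℝ : ℤ.+-*-rawRing -Raw-AlmostCommutative⟶ fromCommutativeRing commutativeRing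
    ℤ⟶ℝ = record
      { ⟦_⟧    = fromℤ
      ; +-homo = fromℤ-+
      ; *-homo = fromℤ-*
      ; -‿homo = fromℤ-neg
      ; 0-homo = ≈-refl
      ; 1-homo = fromℤ-1
      }

    coefficients≟ : ∀ i j → Maybe (fromℤ i ≈ fromℤ j)
    coefficients≟ i j with i ℤₚ.≟ j
    ... | yes eq = just (fromℤ-cong eq)
    ... | no  _  = nothing

  open RingSolver ℤ.+-*-rawRing (fromCommutativeRing commutativeRing) ℤ⟶ℝ coefficients≟ public
    using (solve; _:=_; _:+_; _:*_; _:-_; :-_; con)

  pos-resp : ∀ {x y} → x ≈ y → 0# < x → 0# < y
  pos-resp = <-respʳ

  pos-+ : ∀ {x y} → 0# < x → 0# < y → 0# < x + y
  pos-+ {x} {y} 0<x 0<y = <-trans 0<y (<-respˡ (+-identityˡ y) (+-monoˡ-< y 0<x))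

  <⇒0<- : ∀ {x y} → x < y → 0# < y - x
  <⇒0<- {x} {y} x<y = <-respˡ (-‿inverseʳ x) (+-monoˡ-< (- x) x<y)

  0<-⇒< : ∀ {x y} → 0# < y - x → x < y
  0<-⇒< {x} {y} h = <-respˡ (+-identityˡ x)
      (<-respʳ (solve 2 (λ x y → y :- x :+ x := y) ≈-refl x y) (+-monoˡ-< x h))

  neg-pos : ∀ {x} → x < 0# → 0# < - x
  neg-pos {x} x<0 = pos-resp (+-identityˡ (- x)) (<⇒0<- x<0)

  neg-pos⁻¹ : ∀ {x} → 0# < - x → x < 0#
  neg-pos⁻¹ {x} h = 0<-⇒< (pos-resp (≈-sym (+-identityˡ (- x))) h)

  neg-neg-* : ∀ {x y} → x < 0# → y < 0# → 0# < x * y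
  neg-neg-* {x} {y} x<0 y<0 =
    pos-resp (solve 2 (λ x y → :- x :* :- y := x :* y) ≈-refl x y) (*-pos (neg-pos x<0) (neg-pos y<0))

  pos⇒≉0 : ∀ {x} → 0# < x → x ≉ 0#
  pos⇒≉0 0<x x≈0 = <-irrefl (≈-sym x≈0) 0<x

  sq-pos : ∀ {x} → x ≉ 0# → 0# < x * x
  sq-pos {x} x≉0 with compare 0# x
  ... | tri< 0<x _ _ = *-pos 0<x 0<x
  ... | tri≈ _ 0≈x _ = contradiction (≈-sym 0≈x) x≉0
  ... | tri> _ _ x<0 = neg-neg-* x<0 x<0

  *-pos-cancelˡ : ∀ {x y} → 0# < x → 0# < x * y → 0# < y
  *-pos-cancelˡ {x} {y} 0<x 0<xy with compare 0# y
  ... | tri< 0<y _ _ = 0<y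
  ... | tri≈ _ 0≈y _ = contradiction (≈-trans (*-congˡ (≈-sym 0≈y)) (zeroʳ x)) (pos⇒≉0 0<xy)
  ... | tri> _ _ y<0 = contradiction
      (pos-resp (solve 2 (λ x y → x :* :- y := :- (x :* y)) ≈-refl x y) (*-pos 0<x (neg-pos y<0)))
                         (λ h → <-asym 0<xy (neg-pos⁻¹ h))

  *-≉0 : ∀ {x y} → x ≉ 0# → y ≉ 0# → x * y ≉ 0#
  *-≉0 {x} {y} x≉0 y≉0 xy≈0 = pos⇒≉0 (*-pos (sq-pos x≉0) (sq-pos y≉0))
    (≈-trans (solve 2 (λ x y → (x :* x) :* (y :* y) := (x :* y) :* (x :* y)) ≈-refl x y)
      (≈-trans (*-congˡ xy≈0) (zeroʳ (x * y))))

  *-cancelˡ-≈ : ∀ {x y z} → x ≉ 0# → x * y ≈ x * z → y ≈ z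
  *-cancelˡ-≈ {x} {y} {z} x≉0 eq with (y - z) ≟ 0#
  ... | yes y-z≈0 = ≈-trans (solve 2 (λ y z → y := y :- z :+ z) ≈-refl y z)
      (≈-trans (+-congʳ y-z≈0) (+-identityˡ z))
  ... | no  y-z≉0 = contradiction
    (≈-trans (solve 3 (λ x y z → x :* (y :- z) := x :* y :- x :* z) ≈-refl x y z)
        (≈-trans (+-congʳ eq) (-‿inverseʳ (x * z))))
    (*-≉0 x≉0 y-z≉0)

  *-≉0ʳ : ∀ {x y} → x * y ≉ 0# → y ≉ 0#
  *-≉0ʳ {x} xy≉0 y≈0 = xy≉0 (≈-trans (*-congˡ y≈0) (zeroʳ x))

  *-≉0ˡ : ∀ {x y} → x * y ≉ 0# → x ≉ 0#
  *-≉0ˡ {x} {y} xy≉0 x≈0 = xy≉0 (≈-trans (*-congʳ x≈0) (zeroˡ y))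

  divide : ∀ {x} y → x ≉ 0# → x * (y * x ⁻¹) ≈ y
  divide {x} y x≉0 = begin
    x * (y * x ⁻¹)   ≈⟨ solve 3 (λ x y z → x :* (y :* z) := y :* (x :* z)) ≈-refl x y (x ⁻¹) ⟩
    y * (x * x ⁻¹)   ≈⟨ *-congˡ (*-inverseʳ x≉0) ⟩
    y * 1#           ≈⟨ *-identityʳ y ⟩
    y                ∎
    where open ≈-Reasoning

  ⁻¹-pos : ∀ {x} → 0# < x → 0# < x ⁻¹
  ⁻¹-pos {x} 0<x = *-pos-cancelˡ 0<x (pos-resp (≈-sym (*-inverseʳ (pos⇒≉0 0<x))) 0<1)

  1≉0 : 1# ≉ 0#
  1≉0 = pos⇒≉0 0<1

  fromℕ-pos : ∀ n → 0# < ℕ.suc n · 1#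
  fromℕ-pos ℕ.zero    = pos-resp (≈-sym (+-identityʳ 1#)) 0<1
  fromℕ-pos (ℕ.suc n) = pos-+ 0<1 (fromℕ-pos n)

  fromℤ-pos : ∀ {i} → 0ℤ ℤ.< i → 0# < fromℤ i
  fromℤ-pos {+ ℕ.suc n} _ = fromℕ-pos n
  fromℤ-pos {+ ℕ.zero} (ℤ.+<+ ())

  fromℤ-neg< : ∀ {i} → i ℤ.< 0ℤ → fromℤ i < 0#
  fromℤ-neg< { -[1+ n ]} _ = neg-pos⁻¹ (pos-resp (≈-sym (-‿involutive _)) (fromℕ-pos n))
  fromℤ-neg< {+ n} (ℤ.+<+ ())

  fromℤ-pos⁻¹ : ∀ {i} → 0# < fromℤ i → 0ℤ ℤ.< i
  fromℤ-pos⁻¹ {i} h with ℤₚ.<-cmp 0ℤ i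
  ... | tri< 0<i _ _  = 0<i
  ... | tri≈ _ refl _ = contradiction h (<-irrefl ≈-refl)
  ... | tri> _ _ i<0  = contradiction h (<-asym (fromℤ-neg< i<0))

  fromℤ-≉0 : ∀ {i} → i ≢ 0ℤ → fromℤ i ≉ 0#
  fromℤ-≉0 {i} i≢0 i≈0 with ℤₚ.<-cmp 0ℤ i
  ... | tri< 0<i _ _  = pos⇒≉0 (fromℤ-pos 0<i) i≈0
  ... | tri≈ _ 0≡i _  = i≢0 (sym 0≡i)
  ... | tri> _ _ i<0  = <-irrefl i≈0 (fromℤ-neg< i<0)

  fromℤ-injective : ∀ {i j} → fromℤ i ≈ fromℤ j → i ≡ j
  fromℤ-injective {i} {j} eq with (i ℤ.- j) ℤₚ.≟ 0ℤ
  ... | yes i-j≡0 = ℤₚ.i-j≡0⇒i≡j i j i-j≡0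
  ... | no  i-j≢0 = contradiction
    (≈-trans (fromℤ-+ i (ℤ.- j)) (≈-trans (+-cong eq (fromℤ-neg j)) (-‿inverseʳ (fromℤ j))))
    (fromℤ-≉0 i-j≢0)

  square-injective : ∀ {x y} → 0# < x → 0# < y → x * x ≈ y * y → x ≈ y
  square-injective {x} {y} 0<x 0<y eq = *-cancelˡ-≈ (pos⇒≉0 (pos-+ 0<x 0<y))
    (≈-trans (solve 2 (λ x y → (x :+ y) :* x := x :* x :+ x :* y) ≈-refl x y)
      (≈-trans (+-congʳ eq) (solve 2 (λ x y → y :* y :+ x :* y := (x :+ y) :* y) ≈-refl x y)))

  square-<⁻¹ : ∀ {x y} → 0# < x → 0# < y → x * x < y * y → x < y
  square-<⁻¹ {x} {y} 0<x 0<y h = 0<-⇒< (*-pos-cancelˡ (pos-+ 0<y 0<x)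
    (pos-resp (solve 2 (λ x y → y :* y :- x :* x := (y :+ x) :* (y :- x)) ≈-refl x y) (<⇒0<- h)))

-- Crossing rivers make the roots interlace.

module NegatedForms where
  open FormAction
  open Tree
  open Signs
  open SignPatterns
  negate-involutive : ∀ q → negate (negate q) ≡ q
  negate-involutive [ A , B , C ] = form-≡ (ℤₚ.neg-involutive A) (ℤₚ.neg-involutive B) (ℤₚ.neg-involutive C)

  negate-flip : ∀ q → negate (flipᶠ q) ≡ flipᶠ (negate q)
  negate-flip [ A , B , C ] = refl

  up-flip : ∀ q → Up q → Up (negate (flipᶠ q))
  up-flip q (0<A , C<0) = 0<- C<0 , -<0 0<A

  down-negate : ∀ q → Down q → Up (negate q)
  down-negate q (A<0 , 0<C) = 0<- A<0 , -<0 0<C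

  positive-negate : ∀ q → Positive q → Negative (negate q)
  positive-negate q (0<A , 0<C) = -<0 0<A , -<0 0<C

module VectorSigns {r ℓ₁ ℓ₂} (ℝ : RealField r ℓ₁ ℓ₂) where
  open FormAction
  open Tree
  open Signs
  open SignPatterns
  open NegatedForms
  open OrderedField ℝ

  -- Four times the value of the form q′ at ((σ − b)/2 , a), which is an
  -- isotropic vector of q = [a , b , c] when σ² is the discriminant of q.
  V : Carrier → Form → Form → Carrier
  V σ [ a , b , c ] [ A , B , C ] =
    fromℤ A * (x * x) + fromℤ B * (x * y) + fromℤ C * (y * y)
    where
    x = σ - fromℤ b
    y = fromℤ (+ 2) * fromℤ a

  IsRoot : Carrier → Form → Set ℓ₁
  IsRoot σ q = σ * σ ≈ fromℤ (disc q)

  disc≈ : ∀ a b c → fromℤ (b ℤ.* b ℤ.- + 4 ℤ.* a ℤ.* c) ≈ fromℤ b * fromℤ b - fromℤ (+ 4) * fromℤ a * fromℤ c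
  disc≈ a b c = ≈-trans (fromℤ-+ (b ℤ.* b) (ℤ.- (+ 4 ℤ.* a ℤ.* c)))
    (+-cong (fromℤ-* b b) (≈-trans (fromℤ-neg (+ 4 ℤ.* a ℤ.* c))
        (-‿cong (≈-trans (fromℤ-* (+ 4 ℤ.* a) c) (*-congʳ (fromℤ-* (+ 4) a))))))

  minor≈ : ∀ a b c d → fromℤ (a ℤ.* b ℤ.- c ℤ.* d) ≈ fromℤ a * fromℤ b - fromℤ c * fromℤ d
  minor≈ a b c d = ≈-trans (fromℤ-+ (a ℤ.* b) (ℤ.- (c ℤ.* d)))
    (+-cong (fromℤ-* a b) (≈-trans (fromℤ-neg (c ℤ.* d)) (-‿cong (fromℤ-* c d))))

  private
    sum≈ : ∀ a b c → fromℤ (a ℤ.+ b ℤ.+ c) ≈ fromℤ a + fromℤ b + fromℤ c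
    sum≈ a b c = ≈-trans (fromℤ-+ (a ℤ.+ b) c) (+-congʳ (fromℤ-+ a b))

    2*+≈ : ∀ a b → fromℤ (+ 2 ℤ.* a ℤ.+ b) ≈ fromℤ (+ 2) * fromℤ a + fromℤ b
    2*+≈ a b = ≈-trans (fromℤ-+ (+ 2 ℤ.* a) b) (+-congʳ (fromℤ-* (+ 2) a))

    +2*≈ : ∀ b c → fromℤ (b ℤ.+ + 2 ℤ.* c) ≈ fromℤ b + fromℤ (+ 2) * fromℤ c
    +2*≈ b c = ≈-trans (fromℤ-+ b (+ 2 ℤ.* c)) (+-congˡ (fromℤ-* (+ 2) c))

  quadratic : Carrier → Carrier → Carrier → Carrier → Carrier → Carrier
  quadratic A B C x y = A * (x * x) + B * (x * y) + C * (y * y)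

  quadratic-cong : ∀ {A A′ B B′ C C′ x x′ y y′} → A ≈ A′ → B ≈ B′ → C ≈ C′ → x ≈ x′ → y ≈ y′ →
                   quadratic A B C x y ≈ quadratic A′ B′ C′ x′ y′
  quadratic-cong A≈ B≈ C≈ x≈ y≈ = +-cong (+-cong (*-cong A≈ (*-cong x≈ x≈)) (*-cong B≈ (*-cong x≈ y≈)))
      (*-cong C≈ (*-cong y≈ y≈))

  -- A left turn keeps `a`, so the chosen isotropic vector is transported exactly, without a scaling
  -- factor.
  V-L : ∀ σ q q′ → V σ (turnᶠ L q) (turnᶠ L q′) ≈ V σ q q′
  V-L σ [ a , b , c ] [ A , B , C ] = ≈-trans
    (quadratic-cong ≈-refl (2*+≈ A B) (sum≈ A B C) (+-congˡ (-‿cong (2*+≈ a b))) ≈-refl)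
    (solve 6 (λ σ a b A B C →
      let x = σ :- (con (+ 2) :* a :+ b) ; y = con (+ 2) :* a ; x₀ = σ :- b in
      A :* (x :* x) :+ (con (+ 2) :* A :+ B) :* (x :* y) :+ (A :+ B :+ C) :* (y :* y) :=
      A :* (x₀ :* x₀) :+ B :* (x₀ :* y) :+ C :* (y :* y)) ≈-refl
      σ (fromℤ a) (fromℤ b) (fromℤ A) (fromℤ B) (fromℤ C))

  module _ {σ a b c} (root : IsRoot σ [ a , b , c ]) where
    private
      x = σ - fromℤ b
      y = fromℤ (+ 2) * fromℤ a
      x′ = σ - (fromℤ b + fromℤ (+ 2) * fromℤ c)
      z = σ + fromℤ b + y

      root′ : σ * σ ≈ fromℤ b * fromℤ b - fromℤ (+ 4) * fromℤ a * fromℤ c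
      root′ = ≈-trans root (disc≈ a b c)

    -- In the old coordinates the vector attached to the form after a right turn is `(x′ , z)`. It
    -- is isotropic for the same root as `(x , y)`, so the two are proportional; the identity is the
    -- vanishing of their determinant.
    proportional : y * x′ ≈ x * z
    proportional = ≈-sym (≈-trans
      (solve 3 (λ σ a b → (σ :- b) :* (σ :+ b :+ con (+ 2) :* a) := σ :* σ :+
          (:- (b :* b) :+ con (+ 2) :* a :* (σ :- b)))
        ≈-refl σ (fromℤ a) (fromℤ b))
      (≈-trans (+-congʳ root′)
        (solve 4 (λ σ a b c → (b :* b :- con (+ 4) :* a :* c) :+ (:- (b :* b) :+ con (+ 2) :* a :* (σ :- b)) :=
          con (+ 2) :* a :* (σ :- (b :+ con (+ 2) :* c))) ≈-refl σ (fromℤ a) (fromℤ b) (fromℤ c))))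

    V-R : ∀ q′ → (y * y) * V σ (turnᶠ R [ a , b , c ]) (turnᶠ R q′) ≈ (z * z) * V σ [ a , b , c ] q′
    V-R [ A , B , C ] = begin
      (y * y) * V σ (turnᶠ R [ a , b , c ]) (turnᶠ R [ A , B , C ])
        ≈⟨ *-congˡ (quadratic-cong (sum≈ A B C) (+2*≈ B C) ≈-refl (+-congˡ (-‿cong (+2*≈ b c)))
            (*-congˡ (sum≈ a b c))) ⟩
      (y * y) * quadratic (fromℤ A + fromℤ B + fromℤ C) (fromℤ B + fromℤ (+ 2) * fromℤ C) (fromℤ C) x′
          (fromℤ (+ 2) * (fromℤ a + fromℤ b + fromℤ c))
        ≈⟨ solve 7 (λ σ a b c A B C →
             let x = σ :- (b :+ con (+ 2) :* c) ; w = con (+ 2) :* (a :+ b :+ c) ; y = con (+ 2) :* a ; z = σ :+ b :+ y in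
             (y :* y) :* ((A :+ B :+ C) :* (x :* x) :+ (B :+ con (+ 2) :* C) :* (x :* w) :+ C :* (w :* w)) :=
             A :* ((y :* x) :* (y :* x)) :+ B :* ((y :* x) :* (y :* z)) :+ C :* ((y :* z) :* (y :* z))) ≈-refl
             σ (fromℤ a) (fromℤ b) (fromℤ c) (fromℤ A) (fromℤ B) (fromℤ C) ⟩
      quadratic (fromℤ A) (fromℤ B) (fromℤ C) (y * x′) (y * z)
        ≈⟨ quadratic-cong ≈-refl ≈-refl ≈-refl proportional ≈-refl ⟩
      quadratic (fromℤ A) (fromℤ B) (fromℤ C) (x * z) (y * z)
        ≈⟨ solve 6 (λ A B C x y z →
             A :* ((x :* z) :* (x :* z)) :+ B :* ((x :* z) :* (y :* z)) :+ C :* ((y :* z) :* (y :* z)) :=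
             (z :* z) :* (A :* (x :* x) :+ B :* (x :* y) :+ C :* (y :* y))) ≈-refl (fromℤ A) (fromℤ B) (fromℤ C)
                 x y z ⟩
      (z * z) * V σ [ a , b , c ] [ A , B , C ] ∎
      where open ≈-Reasoning

    -- The product of the values of one form at the two zeros of the other is their resultant, up to
    -- scaling. Opposite signs at the two zeros thus amount to a crossing.
    V-product : ∀ q′ → V σ [ a , b , c ] q′ * V (- σ) [ a , b , c ] q′ ≈ (y * y) * fromℤ
        (disc (jac [ a , b , c ] q′))
    V-product [ A , B , C ] = begin
      V σ [ a , b , c ] [ A , B , C ] * V (- σ) [ a , b , c ] [ A , B , C ]
        ≈⟨ solve 6 (λ σ a b A B C →
             let x = σ :- b ; x̄ = :- σ :- b ; y = con (+ 2) :* a ; P = λ t → A :* (t :+ b :* b) :- con (+ 2) :* a :* b :* B :+ C :* (y :* y)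
                 Q = con (+ 2) :* (a :* B :- A :* b) in
             (A :* (x :* x) :+ B :* (x :* y) :+ C :* (y :* y)) :*
                 (A :* (x̄ :* x̄) :+ B :* (x̄ :* y) :+ C :* (y :* y)) :=
             P (σ :* σ) :* P (σ :* σ) :- (σ :* σ) :* (Q :* Q)) ≈-refl
             σ (fromℤ a) (fromℤ b) (fromℤ A) (fromℤ B) (fromℤ C) ⟩
      P (σ * σ) * P (σ * σ) - (σ * σ) * (Q * Q)
        ≈⟨ +-cong (*-cong P≈ P≈) (-‿cong (*-congʳ root′)) ⟩
      P D * P D - D * (Q * Q)
        ≈⟨ solve 6 (λ a b c A B C →
             let y = con (+ 2) :* a ; P = λ t → A :* (t :+ b :* b) :- con (+ 2) :* a :* b :* B :+ C :* (y :* y)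
                 Q = con (+ 2) :* (a :* B :- A :* b) ; D = b :* b :- con (+ 4) :* a :* c
                 α = a :* B :- A :* b ; β = con (+ 2) :* (a :* C :- A :* c) ; γ = b :* C :- B :* c in
             P D :* P D :- D :* (Q :* Q) := (y :* y) :* (β :* β :- con (+ 4) :* α :* γ)) ≈-refl
             (fromℤ a) (fromℤ b) (fromℤ c) (fromℤ A) (fromℤ B) (fromℤ C) ⟩
      (y * y) * (β * β - fromℤ (+ 4) * α * γ)
        ≈⟨ *-congˡ (≈-trans (disc≈ (a ℤ.* B ℤ.- A ℤ.* b) (+ 2 ℤ.* (a ℤ.* C ℤ.- A ℤ.* c)) (b ℤ.* C ℤ.- B ℤ.* c))
             (+-cong (*-cong β≈ β≈) (-‿cong (*-cong (*-congˡ (minor≈ a B A b)) (minor≈ b C B c))))) ⟨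
      (y * y) * fromℤ (disc (jac [ a , b , c ] [ A , B , C ])) ∎
      where
      open ≈-Reasoning
      D = fromℤ b * fromℤ b - fromℤ (+ 4) * fromℤ a * fromℤ c
      -- `V` splits as `P (σ * σ) + σ * Q` into parts even and odd in `σ`, so that the product over
      -- both signs of `σ` is a difference of squares.
      P : Carrier → Carrier
      P t = fromℤ A * (t + fromℤ b * fromℤ b) - fromℤ (+ 2) * fromℤ a * fromℤ b * fromℤ B + fromℤ C * (y * y)
      P≈ : P (σ * σ) ≈ P D
      P≈ = +-congʳ (+-congʳ (*-congˡ (+-congʳ root′)))
      Q = fromℤ (+ 2) * (fromℤ a * fromℤ B - fromℤ A * fromℤ b)
      α = fromℤ a * fromℤ B - fromℤ A * fromℤ b
      β = fromℤ (+ 2) * (fromℤ a * fromℤ C - fromℤ A * fromℤ c)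
      γ = fromℤ b * fromℤ C - fromℤ B * fromℤ c
      β≈ : fromℤ (+ 2 ℤ.* (a ℤ.* C ℤ.- A ℤ.* c)) ≈ β
      β≈ = ≈-trans (fromℤ-* (+ 2) (a ℤ.* C ℤ.- A ℤ.* c)) (*-congˡ (minor≈ a C A c))

  V-negate : ∀ σ q q′ → V σ q (negate q′) ≈ - V σ q q′
  V-negate σ [ a , b , c ] [ A , B , C ] = ≈-trans
    (quadratic-cong (fromℤ-neg A) (fromℤ-neg B) (fromℤ-neg C) ≈-refl ≈-refl)
    (solve 5 (λ A B C x y → :- A :* (x :* x) :+ :- B :* (x :* y) :+ :- C :* (y :* y) :=
      :- (A :* (x :* x) :+ B :* (x :* y) :+ C :* (y :* y))) ≈-refl
      (fromℤ A) (fromℤ B) (fromℤ C) (σ - fromℤ b) (fromℤ (+ 2) * fromℤ a))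

  root-neg : ∀ {σ} q → IsRoot σ q → IsRoot (- σ) q
  root-neg {σ} q = ≈-trans (solve 1 (λ σ → :- σ :* :- σ := σ :* σ) ≈-refl σ)

  module _ {s} (0<s : 0# < s) where

    -- On a river edge `s² - b² = -4ac` is positive, and so is the sum of the two factors.
    b<s : ∀ q → IsRoot s q → Up q → 0# < s - fromℤ (Form.B q) × 0# < s + fromℤ (Form.B q)
    b<s q@([ a , b , c ]) root (0<a , c<0) = low , high
      where
      product : 0# < (s - fromℤ b) * (s + fromℤ b)
      product = pos-resp (≈-trans (solve 3
          (λ a b c → con (+ 4) :* a :* :- c := (b :* b :- con (+ 4) :* a :* c) :- b :* b) ≈-refl (fromℤ a)
          (fromℤ b) (fromℤ c))
        (≈-trans (+-congʳ (≈-sym (≈-trans root (disc≈ a b c))))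
          (solve 2 (λ s b → s :* s :- b :* b := (s :- b) :* (s :+ b)) ≈-refl s (fromℤ b))))
        (*-pos (*-pos (fromℤ-pos 0<4) (fromℤ-pos 0<a)) (neg-pos (fromℤ-neg< c<0)))
      sum : 0# < (s - fromℤ b) + (s + fromℤ b)
      sum = pos-resp (solve 2 (λ s b → s :+ s := (s :- b) :+ (s :+ b)) ≈-refl s (fromℤ b)) (pos-+ 0<s 0<s)
      low : 0# < s - fromℤ b
      low with compare 0# (s - fromℤ b)
      ... | tri< h _ _ = h
      ... | tri≈ _ h _ = contradiction (≈-trans (*-congʳ (≈-sym h)) (zeroˡ _)) (pos⇒≉0 product)
      ... | tri> _ _ h with compare 0# (s + fromℤ b)
      ...   | tri< h′ _ _ = contradiction product
          (<-asym (neg-pos⁻¹ (pos-resp (solve 2 (λ x y → :- x :* y := :- (x :* y)) ≈-refl _ _)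
          (*-pos (neg-pos h) h′))))
      ...   | tri≈ _ h′ _ = contradiction (≈-trans (*-congˡ (≈-sym h′)) (zeroʳ _)) (pos⇒≉0 product)
      ...   | tri> _ _ h′ = contradiction sum
          (<-asym (neg-pos⁻¹ (pos-resp (-‿+-comm _ _) (pos-+ (neg-pos h) (neg-pos h′)))))
      high : 0# < s + fromℤ b
      high = *-pos-cancelˡ low product

    -- The zero for `s` lies ahead of the edge: its vector has positive coordinates, and every term
    -- of `V` is positive.
    climbing⇒V : ∀ q q′ → IsRoot s q → Up q → Climbing q′ → 0# < V s q q′
    climbing⇒V q@([ a , b , c ]) q′ root u@(0<a , _) (0<A , 0<B , 0<C) = pos-+ (pos-+
        (*-pos (fromℤ-pos 0<A) (*-pos 0<x 0<x)) (*-pos (fromℤ-pos 0<B) (*-pos 0<x 0<y)))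
            (*-pos (fromℤ-pos 0<C) (*-pos 0<y 0<y))
      where
      0<x = proj₁ (b<s q root u)
      0<y = *-pos (fromℤ-pos 0<2) (fromℤ-pos 0<a)

    -- The zero for `- s` lies behind the edge: its vector has coordinates of opposite signs, which
    -- the negative middle coefficient of a form climbing in the reverse direction compensates.
    climbing-back⇒V : ∀ q q′ → IsRoot s q → Up q → Climbing (flipᶠ q′) → 0# < V (- s) q q′
    climbing-back⇒V q@([ a , b , c ]) q′@([ A , B , C ]) root u@(0<a , _) (0<C , 0<-B , 0<A) = pos-resp
      (≈-trans (+-congʳ (+-congˡ (*-congʳ (fromℤ-neg B))))
       (solve 6 (λ s y b A B C → A :* ((s :+ b) :* (s :+ b)) :+ :- B :* ((s :+ b) :* y) :+ C :* (y :* y) :=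
        A :* ((:- s :- b) :* (:- s :- b)) :+ B :* ((:- s :- b) :* y) :+ C :* (y :* y)) ≈-refl
        s (fromℤ (+ 2) * fromℤ a) (fromℤ b) (fromℤ A) (fromℤ B) (fromℤ C)))
      (pos-+ (pos-+ (*-pos (fromℤ-pos 0<A) (*-pos 0<x 0<x)) (*-pos (fromℤ-pos 0<-B) (*-pos 0<x 0<y)))
          (*-pos (fromℤ-pos 0<C) (*-pos 0<y 0<y)))
      where
      0<x = proj₂ (b<s q root u)
      0<y = *-pos (fromℤ-pos 0<2) (fromℤ-pos 0<a)

    -- A turn along the river changes `V` by a quotient of nonzero squares, here cross-multiplied;
    -- the sign survives in both directions.
    SquareRatio : Carrier → Carrier → Set _
    SquareRatio v v′ = ∃[ y ] ∃[ z ] y ≉ 0# × z ≉ 0# × (y * y) * v′ ≈ (z * z) * v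

    ratio-forth : ∀ {v v′} → SquareRatio v v′ → 0# < v → 0# < v′
    ratio-forth (y , z , y≉0 , z≉0 , eq) 0<v = *-pos-cancelˡ (sq-pos y≉0)
        (pos-resp (≈-sym eq) (*-pos (sq-pos z≉0) 0<v))

    ratio-back : ∀ {v v′} → SquareRatio v v′ → 0# < v′ → 0# < v
    ratio-back (y , z , y≉0 , z≉0 , eq) 0<v′ = *-pos-cancelˡ (sq-pos z≉0) (pos-resp eq (*-pos (sq-pos y≉0) 0<v′))

    module _ q (root : IsRoot s q) (u : Up q) where
      private
        open Form q renaming (A to a; B to b; C to c)
        2a≉0 : fromℤ (+ 2) * fromℤ a ≉ 0#
        2a≉0 = pos⇒≉0 (*-pos (fromℤ-pos 0<2) (fromℤ-pos (proj₁ u)))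

      turn-ratio⁺ : ∀ t q′ → SquareRatio (V s q q′) (V s (turnᶠ t q) (turnᶠ t q′))
      turn-ratio⁺ L q′ = 1# , 1# , 1≉0 , 1≉0 , *-congˡ (V-L s q q′)
      turn-ratio⁺ R q′ = _ , _ , 2a≉0 ,
        pos⇒≉0 (pos-+ (proj₂ (b<s q root u)) (*-pos (fromℤ-pos 0<2) (fromℤ-pos (proj₁ u)))) , V-R {s} {a} {b}
            {c} root q′

      turn-ratio⁻ : ∀ t q′ → Up (turnᶠ t q) → IsRoot s (turnᶠ t q) → SquareRatio (V (- s) q q′)
          (V (- s) (turnᶠ t q) (turnᶠ t q′))
      turn-ratio⁻ L q′ u′ root′ = 1# , 1# , 1≉0 , 1≉0 , *-congˡ (V-L (- s) q q′)
      -- For `- s` the factor `z` has no evident sign. It is nonzero because `y * x′ ≈ x * z`, where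
      -- `x′` is nonzero since the next edge is again on the river.
      turn-ratio⁻ R q′ u′ root′ = _ , _ , 2a≉0 , *-≉0ʳ
          (λ eq → *-≉0 2a≉0 x′≉0 (≈-trans (proportional { - s} {a} {b} {c} (root-neg q root)) eq)) ,
        V-R { - s} {a} {b} {c} (root-neg q root) q′
        where
        x′≉0 : - s - (fromℤ b + fromℤ (+ 2) * fromℤ c) ≉ 0#
        x′≉0 eq = pos⇒≉0 (proj₂ (b<s (turnᶠ R q) root′ u′)) (≈-trans (+-congˡ (+2*≈ b c))
          (≈-trans (solve 2 (λ s b → s :+ b := :- (:- s :- b)) ≈-refl s _) (≈-trans (-‿cong eq) -0#≈0#)))

    crossing-from-signs : ∀ q q′ → IsRoot s q → Up q → 0# < V s q q′ → 0# < V (- s) q (negate q′) → Crossing q q′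
    crossing-from-signs q@([ a , b , c ]) q′ root u 0<V⁺ 0<V⁻ = 0<-⁻¹
        (fromℤ-pos⁻¹ (*-pos-cancelˡ (sq-pos {y} 2a≉0) (pos-resp (begin
      V s q q′ * V (- s) q (negate q′)   ≈⟨ *-congˡ (V-negate (- s) q q′) ⟩
      V s q q′ * - V (- s) q q′          ≈⟨ -‿distribʳ-* _ _ ⟨
      - (V s q q′ * V (- s) q q′)        ≈⟨ -‿cong (V-product {s} {a} {b} {c} root q′) ⟩
      - ((y * y) * fromℤ d)              ≈⟨ -‿distribʳ-* _ _ ⟩
      (y * y) * - fromℤ d                ≈⟨ *-congˡ (fromℤ-neg d) ⟨
      (y * y) * fromℤ (ℤ.- d)            ∎) (*-pos 0<V⁺ 0<V⁻))))
      where
      open ≈-Reasoning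
      d = disc (jac q q′)
      y = fromℤ (+ 2) * fromℤ a
      2a≉0 : y ≉ 0#
      2a≉0 = pos⇒≉0 (*-pos (fromℤ-pos 0<2) (fromℤ-pos (proj₁ u)))

module ExitLemma where
  open FormAction
  open Tree
  open Signs
  open SignPatterns
  open Turns
  open NegatedForms

  -- Where the river of g leaves that of f, the latter continues on the other
  -- branch, on which g has a constant sign and climbs.
  exit-up : ∀ q q′ → Up q → Up q′ → ∀ t → Mixed (turnᶠ t q′) →
            (Positive (turnᶠ t q) → Up (turnᶠ (other t) q) × Climbing (negate (turnᶠ (other t) q′))) ×
            (Negative (turnᶠ t q) → Up (turnᶠ (other t) q) × Climbing (turnᶠ (other t) q′))
  exit-up q q′ (0<a , c<0) (0<A , C<0) L m =
    (λ (_ , 0<M) → (0<M , c<0) , subst Climbing (turn-negate R q′) (leave-R (negate q′) (-<0 0<A)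
      (subst Positive (sym (turn-negate R q′)) (0<- M′<0 , 0<- C<0)))) ,
    (λ (a<0 , _) → contradiction 0<a (ℤₚ.<-asym a<0))
    where
    M′<0 : Form.C (turnᶠ L q′) ℤ.< 0ℤ
    M′<0 = proj₂ (up-turn L q′ (0<A , C<0) m)
  exit-up q q′ (0<a , c<0) (0<A , C<0) R m =
    (λ (_ , 0<c) → contradiction 0<c (ℤₚ.<-asym c<0)) ,
    (λ (M<0 , _) → (0<a , M<0) , leave-L q′ C<0 (0<A , 0<M′))
    where
    0<M′ : 0ℤ ℤ.< Form.A (turnᶠ R q′)
    0<M′ = proj₁ (up-turn R q′ (0<A , C<0) m)

module CrossesImpliesCrossing {r ℓ₁ ℓ₂} (ℝ : RealField r ℓ₁ ℓ₂) where
  open FormAction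
  open Tree
  open Signs
  open SignPatterns
  open Turns
  open NegatedForms
  open OrderedField ℝ using (Carrier; _<_; 0#; -_; fromℤ; _≈_; _*_)
  open VectorSigns ℝ
  open ExitLemma

  module Normalised (𝒻 ℊ : Labelling) {s} (0<s : 0# < s) (root : ∀ e → IsRoot s (Labelling.f 𝒻 e)) where
    open Labelling 𝒻 using (f)
    open Labelling ℊ using () renaming (f to g)
    module f = LabellingSigns 𝒻
    module g = LabellingSigns ℊ

    Step UpStep : Edge → Edge → Set
    Step e e′ = Next e e′ × Mixed (f e′) × Mixed (g e′)
    UpStep e e′ = Next e e′ × Up (f e′)

    up-next : ∀ t e → Up (f e) → Mixed (f (turn t e)) → Up (f (turn t e))
    up-next t e u m = subst Up (sym (f.f-turn t e)) (up-turn t (f e) u (subst Mixed (f.f-turn t e) m))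

    g-up-next : ∀ t e → Up (g e) → Mixed (g (turn t e)) → Up (g (turn t e))
    g-up-next t e u m = subst Up (sym (g.f-turn t e)) (up-turn t (g e) u (subst Mixed (g.f-turn t e) m))

    up-path : ∀ {e e′} → Up (f e) → Up (g e) → Star Step e e′ → Star UpStep e e′ × Up (f e′) × Up (g e′)
    up-path u v Star.ε = Star.ε , u , v
    up-path {e} u v (((t , refl) , m , n) ◅ path) with p , u′ , v′ ← up-path (up-next t e u m)
        (g-up-next t e v n) path =
      ((t , refl) , up-next t e u m) ◅ p , u′ , v′

    -- The sign at the zero behind is found before the shared path and carried forward by this
    -- lemma; the sign at the zero ahead is found beyond the path and carried back by `back-step`.
    forth : ∀ {e e′} → Up (f e) → Star UpStep e e′ → 0# < V (- s) (f e) (negate (g e)) → 0# < V (- s) (f e′)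
        (negate (g e′))
    forth u Star.ε h = h
    forth {e} u (((t , refl) , u′) ◅ path) h = forth u′ path
      (subst₂ (λ q q′ → 0# < V (- s) q q′) (sym (f.f-turn t e))
          (trans (turn-negate t (g e)) (cong negate (sym (g.f-turn t e))))
        (ratio-forth 0<s (turn-ratio⁻ 0<s (f e) (root e) u t (negate (g e)) (subst Up (f.f-turn t e) u′)
          (subst (IsRoot s) (f.f-turn t e) (root (turn t e)))) h))

    back-step : ∀ t e → Up (f e) → 0# < V s (f (turn t e)) (g (turn t e)) → 0# < V s (f e) (g e)
    back-step t e u h = ratio-back 0<s (turn-ratio⁺ 0<s (f e) (root e) u t (g e))
      (subst₂ (λ q q′ → 0# < V s q q′) (f.f-turn t e) (g.f-turn t e) h)

    -- x and y are the continuations of the river of f beyond the two ends of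
    -- the shared path.
    crossing : ∀ {e e′ x y} → Up (f e) → Star UpStep e e′ → Up (f e′) →
               Next e′ y → Up (f y) → Climbing (g y) →
               (∃[ t ] e ≡ turn t (bar x)) → Up (f (bar x)) → Climbing (negate (g x)) →
               Crossing (f e′) (g e′)
    crossing {e} {e′} {x} {y} u path u′ (t , refl) uʸ cʸ (t′ , refl) uˣ cˣ =
      crossing-from-signs 0<s (f e′) (g e′) (root e′) u′
        (back-step t e′ u′ (climbing⇒V 0<s (f y) (g y) (root y) uʸ cʸ))
        (forth uˣ (((t′ , refl) , u) ◅ path) (climbing-back⇒V 0<s (f (bar x)) (negate (g (bar x))) (root (bar x)) uˣ
          (subst Climbing (trans (cong negate (trans (cong g (sym (bar-involutive x))) (g.f-flip (bar x))))
              (negate-flip (g (bar x)))) cˣ)))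

  module Oriented (𝒻 ℊ : Labelling) {s} (0<s : 0# < s) (root : ∀ e → IsRoot s (Labelling.f 𝒻 e)) where
    open Labelling 𝒻 using (f)
    open Labelling ℊ using () renaming (f to g)
    open Normalised 𝒻 ℊ 0<s root

    up-flip-bar : ∀ e → Up (f e) → Up (negate (f (bar e)))
    up-flip-bar e u = subst (λ q → Up (negate q)) (sym (f.f-flip e)) (up-flip (f e) u)

    g-up-flip-bar : ∀ e → Up (g e) → Up (negate (g (bar e)))
    g-up-flip-bar e u = subst (λ q → Up (negate q)) (sym (g.f-flip e)) (up-flip (g e) u)

    -- The entry is an exit of the reversed path. Reversal exchanges the two regions, and negating
    -- the reversed form restores the `Up` pattern, so `exit-up` serves at both ends.
    crosses⇒crossing : ∀ {first last entry exit} → Up (f first) → Up (g first) → Star Step first last →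
      Next (bar first) entry → Next last exit → Mixed (g entry) → Mixed (g exit) →
      (Positive (f entry) × Negative (f exit)) ⊎ (Negative (f entry) × Positive (f exit)) →
      Crossing (f last) (g last)
    crosses⇒crossing {first} {last} u v path (t , refl) (t′ , refl) mᵉ mˣ sides = go sides
      where
      ends = up-path u v path
      u′ = proj₁ (proj₂ ends)
      v′ = proj₂ (proj₂ ends)
      x = turn (other t) (bar first)
      y = turn (other t′) last
      after = exit-up (f last) (g last) u′ v′ t′ (subst Mixed (g.f-turn t′ last) mˣ)
      before = exit-up (negate (f (bar first))) (negate (g (bar first)))
        (up-flip-bar first u) (g-up-flip-bar first v) t
        (subst Mixed (sym (turn-negate t (g (bar first))))
            (mixed-negate (turnᶠ t (g (bar first))) (subst Mixed (g.f-turn t (bar first)) mᵉ)))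
      step : ∃[ t″ ] first ≡ turn t″ (bar x)
      step = other (other t) , sym (trans (turn-other-bar-turn (other t) (bar first)) (bar-involutive first))
      negate-turn : ∀ 𝒽 → negate (Labelling.f 𝒽 x) ≡ turnᶠ (other t) (negate (Labelling.f 𝒽 (bar first)))
      negate-turn 𝒽 = trans (cong negate (LabellingSigns.f-turn 𝒽 (other t) (bar first)))
          (sym (turn-negate (other t) (Labelling.f 𝒽 (bar first))))
      up-before : Up (turnᶠ (other t) (negate (f (bar first)))) → Up (f (bar x))
      up-before w = subst Up (sym (trans (f.f-flip x) (sym (negate-involutive (flipᶠ (f x))))))
        (subst Up (cong negate (trans (cong flipᶠ (sym (negate-turn 𝒻))) (sym (negate-flip (f x)))))
          (up-flip (turnᶠ (other t) (negate (f (bar first)))) w))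
      up-after : Up (turnᶠ (other t′) (f last)) → Up (f y)
      up-after = subst Up (sym (f.f-turn (other t′) last))
      positive-entry : Positive (f (turn t (bar first))) → Negative (turnᶠ t (negate (f (bar first))))
      positive-entry p = subst Negative (sym (turn-negate t (f (bar first))))
        (positive-negate (turnᶠ t (f (bar first))) (subst Positive (f.f-turn t (bar first)) p))
      negative-entry : Negative (f (turn t (bar first))) → Positive (turnᶠ t (negate (f (bar first))))
      negative-entry n = subst Positive (sym (turn-negate t (f (bar first))))
        (negative⇒positive-negate (turnᶠ t (f (bar first))) (subst Negative (f.f-turn t (bar first)) n))
      go : (Positive (f (turn t (bar first))) × Negative (f (turn t′ last))) ⊎
           (Negative (f (turn t (bar first))) × Positive (f (turn t′ last))) → Crossing (f last) (g last)
      go (inj₁ (p , n)) = crossing {x = x} {y} u (proj₁ ends) u′ (other t′ , refl)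
          (up-after (proj₁ a)) (subst Climbing (sym (g.f-turn (other t′) last)) (proj₂ a))
          step (up-before (proj₁ b)) (subst Climbing (sym (negate-turn ℊ)) (proj₂ b))
        where
        a = proj₂ after (subst Negative (f.f-turn t′ last) n)
        b = proj₂ before (positive-entry p)
      go (inj₂ (n , p)) = subst (ℤ._< 0ℤ) (disc-jac-negateʳ (f last) (g last))
          (Normalised.crossing 𝒻 (negation ℊ) 0<s root {x = x} {y} u (proj₁ ends) u′ (other t′ , refl)
            (up-after (proj₁ a)) (subst (λ q → Climbing (negate q)) (sym (g.f-turn (other t′) last)) (proj₂ a))
            step (up-before (proj₁ b)) (subst Climbing (cong negate (sym (negate-turn ℊ))) (proj₂ b)))
        where
        a = proj₁ after (subst Positive (f.f-turn t′ last) p)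
        b = proj₁ before (negative-entry n)

  module _ {q₁ q₂ : Form} {𝒯₁ : Topograph q₁} {𝒯₂ : Topograph q₂} (φ : PlaneIso)
           {s} (0<s : 0# < s) (root : IsRoot s q₁) where
    private
      𝒻 ℊ : Labelling
      𝒻 = labelling 𝒯₁
      ℊ = pullback (labelling 𝒯₂) (inverse φ)
      open Labelling 𝒻 using (f; f-disc)
      open Labelling ℊ using () renaming (f to g)

      rootᶠ : ∀ e → IsRoot s (f e)
      rootᶠ e = subst (λ D → s * s ≈ fromℤ D)
          (trans (cong disc (sym (Topograph.f-base 𝒯₁))) (f-disc (Topograph.base 𝒯₁) e)) root

      root⁻ : ∀ e → IsRoot s (negate (f e))
      root⁻ e = subst (λ D → s * s ≈ fromℤ D) (sym (JacobianBounds.disc-negate (f e))) (rootᶠ e)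

    -- The shared path may run with or against either river. Negating the corresponding labelling
    -- reduces to both rivers flowing along it; negating `f` also exchanges the two banks.
    crosses⇒crossing : Crosses 𝒯₁ 𝒯₂ φ → ∃[ e ] Crossing (f e) (g e)
    crosses⇒crossing crosses = last , orient (mixed⇒up⊎down (f first) (proj₁ first-shared))
        (mixed⇒up⊎down (g first) (proj₂ first-shared))
      where
      open Crosses crosses
      negate-sides : ∀ {q q′} → (Positive q × Negative q′) ⊎ (Negative q × Positive q′) →
                     (Positive (negate q) × Negative (negate q′)) ⊎ (Negative (negate q) × Positive (negate q′))
      negate-sides {q} {q′} (inj₁ (p , n)) = inj₂ (positive-negate q p , negative⇒positive-negate q′ n)
      negate-sides {q} {q′} (inj₂ (n , p)) = inj₁ (negative⇒positive-negate q n , positive-negate q′ p)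
      orient : Up (f first) ⊎ Down (f first) → Up (g first) ⊎ Down (g first) → Crossing (f last) (g last)
      orient (inj₁ u) (inj₁ v) = Oriented.crosses⇒crossing 𝒻 ℊ 0<s rootᶠ u v path
        before-first after-last entry-on-image exit-on-image sides
      orient (inj₁ u) (inj₂ v) = subst (ℤ._< 0ℤ) (disc-jac-negateʳ (f last) (g last))
        (Oriented.crosses⇒crossing 𝒻 (negation ℊ) 0<s rootᶠ u (down-negate (g first) v)
          (Star.map (λ { {_} {e} (n , m , m′) → n , m , mixed-negate (g e) m′ }) path)
          before-first after-last (mixed-negate (g entry) entry-on-image) (mixed-negate (g exit) exit-on-image)
              sides)
      orient (inj₂ u) (inj₁ v) = subst (ℤ._< 0ℤ) (disc-jac-negateˡ (f last) (g last))
        (Oriented.crosses⇒crossing (negation 𝒻) ℊ 0<s root⁻ (down-negate (f first) u) v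
          (Star.map (λ { {_} {e} (n , m , m′) → n , mixed-negate (f e) m , m′ }) path)
          before-first after-last entry-on-image exit-on-image (negate-sides {f entry} {f exit} sides))
      orient (inj₂ u) (inj₂ v) = subst (ℤ._< 0ℤ)
          (trans (disc-jac-negateˡ (f last) (negate (g last))) (disc-jac-negateʳ (f last) (g last)))
        (Oriented.crosses⇒crossing (negation 𝒻) (negation ℊ) 0<s root⁻ (down-negate (f first) u)
            (down-negate (g first) v)
          (Star.map (λ { {_} {e} (n , m , m′) → n , mixed-negate (f e) m , mixed-negate (g e) m′ }) path)
          before-first after-last (mixed-negate (g entry) entry-on-image) (mixed-negate (g exit) exit-on-image)
              (negate-sides {f entry} {f exit} sides))

-- Counting crossing superimpositions.

module Enumeration where
  open FormAction
  open Tree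
  open IntegerSequences
  open SignPatterns

  record Enumerated {m} (P : Fin m → Set) : Set where
    field
      size       : ℕ
      element    : Fin size → Fin m
      satisfies  : ∀ k → P (element k)
      distinct   : ∀ {k l} → element k ≡ element l → k ≡ l
      exhaustive : ∀ x → P x → ∃[ k ] element k ≡ x

  enumerate : ∀ {m} {P : Fin m → Set} → Decidable P → Enumerated P
  enumerate {ℕ.zero} P? = record
    { size = 0 ; element = λ () ; satisfies = λ () ; distinct = λ { {()} } ; exhaustive = λ () }
  enumerate {ℕ.suc m} {P} P? with P? zero | enumerate (λ x → P? (suc x))
  ... | no ¬p | E = record
    { size = size ; element = λ k → suc (element k) ; satisfies = satisfies
    ; distinct = λ eq → distinct (Finₚ.suc-injective eq)
    ; exhaustive = λ { zero p → contradiction p ¬p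
                     ; (suc x) p → let k , eq = exhaustive x p in k , cong suc eq } }
    where open Enumerated E
  ... | yes p | E = record
    { size = ℕ.suc size
    ; element = λ { zero → zero ; (suc k) → suc (element k) }
    ; satisfies = λ { zero → p ; (suc k) → satisfies k }
    ; distinct = λ { {zero} {zero} _ → refl ; {suc k} {suc l} eq → cong suc (distinct (Finₚ.suc-injective eq)) }
    ; exhaustive = λ { zero p → zero , refl
                     ; (suc x) p → let k , eq = exhaustive x p in suc k , cong suc eq } }
    where open Enumerated E

  residue-unique : ∀ {p} (i j : Fin p) k → + toℕ i ℤ.+ k ℤ.* + p ≡ + toℕ j → i ≡ j
  residue-unique {p} i j (+ ℕ.zero)  eq = Finₚ.toℕ-injective
      (ℤₚ.+-injective (trans (sym (ℤₚ.+-identityʳ (+ toℕ i))) eq))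
  residue-unique {p} i j (+ ℕ.suc m) eq = contradiction (Finₚ.toℕ<n j) (ℕₚ.≤⇒≯ (begin
      p                         ≤⟨ ℕₚ.m≤m+n p (m ℕ.* p) ⟩
      p ℕ.+ m ℕ.* p             ≤⟨ ℕₚ.m≤n+m _ (toℕ i) ⟩
      toℕ i ℕ.+ ℕ.suc m ℕ.* p   ≡⟨ ℤₚ.+-injective (trans (cong (λ k → + toℕ i ℤ.+ k) (ℤₚ.pos-* (ℕ.suc m) p)) eq) ⟩
      toℕ j                     ∎))
    where open ℕₚ.≤-Reasoning
  residue-unique {p} i j -[1+ m ] eq = contradiction (Finₚ.toℕ<n i) (ℕₚ.≤⇒≯ (begin
      p                         ≤⟨ ℕₚ.m≤m+n p (m ℕ.* p) ⟩
      p ℕ.+ m ℕ.* p             ≤⟨ ℕₚ.m≤n+m _ (toℕ j) ⟩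
      toℕ j ℕ.+ ℕ.suc m ℕ.* p   ≡⟨ ℤₚ.+-injective (trans (cong (λ k → + toℕ j ℤ.+ k) (ℤₚ.pos-* (ℕ.suc m) p))
                                     (trans (cong (ℤ._+ + ℕ.suc m ℤ.* + p) (sym eq))
                                         (e (+ toℕ i) (+ ℕ.suc m) (+ p)))) ⟩
      toℕ i                     ∎))
    where
    open ℕₚ.≤-Reasoning
    e : ∀ i k p → i ℤ.+ ℤ.- k ℤ.* p ℤ.+ k ℤ.* p ≡ i
    e = solve-∀

  residue : ∀ {p} .{{_ : ℕ.NonZero p}} k → Σ[ i ∈ Fin p ] ∃[ a ] k ≡ + toℕ i ℤ.+ a ℤ.* + p
  residue {p} k = fromℕ< (ℤᵈ.n%ℕd<d k p) , k ℤ./ℕ p ,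
    trans (ℤᵈ.a≡a%ℕn+[a/ℕn]*n k p) (cong (λ r → + r ℤ.+ (k ℤ./ℕ p) ℤ.* + p) (sym (Finₚ.toℕ-fromℕ< (ℤᵈ.n%ℕd<d k p))))

  orientation : Fin 2 → Orientation
  orientation zero    = forward
  orientation (suc _) = backward

  code : Orientation → Fin 2
  code forward  = zero
  code backward = suc zero

  code-orientation : ∀ x → code (orientation x) ≡ x
  code-orientation zero       = refl
  code-orientation (suc zero) = refl

  orientation-code : ∀ o → orientation (code o) ≡ o
  orientation-code forward  = refl
  orientation-code backward = refl

  module _ {m n : ℕ} where
    private
      decode′ : Fin n × Fin 2 → Fin n × Orientation
      decode′ (j , b) = j , orientation b

      decode″ : Fin m × Fin (n ℕ.* 2) → Fin m × Fin n × Orientation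
      decode″ (i , y) = i , decode′ (Fin.remQuot {n} 2 y)

    decode : Fin (m ℕ.* (n ℕ.* 2)) → Fin m × Fin n × Orientation
    decode x = decode″ (Fin.remQuot {m} (n ℕ.* 2) x)

    encode : Fin m × Fin n × Orientation → Fin (m ℕ.* (n ℕ.* 2))
    encode (i , j , o) = Fin.combine i (Fin.combine j (code o))

    encode-decode : ∀ x → encode (decode x) ≡ x
    encode-decode x = trans (cong (Fin.combine (proj₁ (Fin.remQuot {m} (n ℕ.* 2) x)))
        (trans (cong (Fin.combine (proj₁ (Fin.remQuot {n} 2 y))) (code-orientation (proj₂ (Fin.remQuot {n} 2 y))))
          (Finₚ.combine-remQuot {n} 2 y)))
      (Finₚ.combine-remQuot {m} (n ℕ.* 2) x)
      where y = proj₂ (Fin.remQuot {m} (n ℕ.* 2) x)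

    decode-encode : ∀ x → decode (encode x) ≡ x
    decode-encode (i , j , o) = trans (cong decode″ (Finₚ.remQuot-combine i (Fin.combine j (code o))))
      (cong (i ,_) (trans (cong decode′ (Finₚ.remQuot-combine j (code o))) (cong (j ,_) (orientation-code o))))

module CountCrossings {r ℓ₁ ℓ₂} (ℝ : RealField r ℓ₁ ℓ₂) (q₁ q₂ : PIBQF)
  {𝒯₁ : Topograph (PIBQF.form q₁)} {𝒯₂ : Topograph (PIBQF.form q₂)} {ℛ₁ : River 𝒯₁} {ℛ₂ : River 𝒯₂}
  (P₁ : PeriodTranslation ℛ₁) (P₂ : PeriodTranslation ℛ₂) where
  open FormAction
  open Tree
  open IntegerSequences
  open SignPatterns
  open Enumeration

  infixr 9 _▸_
  _▸_ : Orientation → Edge → Edge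
  forward  ▸ e = e
  backward ▸ e = bar e

  open OrderedField ℝ using (Carrier; 0#; √; √-pos; √-square; fromℤ; fromℤ-pos)
  module 𝒯₁ = Topograph 𝒯₁
  module 𝒯₂ = Topograph 𝒯₂
  module River₁ = Rivers ℛ₁ (PIBQF.nonsquare q₁)
  module River₂ = Rivers ℛ₂ (PIBQF.nonsquare q₂)
  module Translations₁ = River₁.Translations P₁
  module Translations₂ = River₂.Translations P₂
  module Criterion (φ : PlaneIso) = CrossingCriterion {𝒯₂ = 𝒯₂} ℛ₁ (PIBQF.nonsquare q₂) (PIBQF.D>0 q₂) φ
  open River ℛ₁ using () renaming (edge to edge₁)
  open River ℛ₂ using () renaming (edge to edge₂; flowing to flowing₂)
  open Translations₁ using () renaming (p to p₁)
  open Translations₂ using () renaming (p to p₂)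
  open PeriodTranslation P₁ using () renaming (τ to τ₁)
  open PeriodTranslation P₂ using () renaming (τ to τ₂)
  open PlaneIso using (to; from)

  g : PlaneIso → Edge → Form
  g φ e = 𝒯₂.f (from φ e)

  IsCrossing : PlaneIso → Edge → Set
  IsCrossing φ e = Crossing (𝒯₁.f e) (g φ e)

  crossing-everywhere : ∀ φ {e} → IsCrossing φ e → ∀ e′ → IsCrossing φ e′
  crossing-everywhere φ {e} c e′ = subst (ℤ._< 0ℤ)
      (Labelling.f-disc (jacobian (Criterion.𝒻 φ) (Criterion.ℊ φ)) e e′) c

  crosses⇒crossing : ∀ φ → Crosses 𝒯₁ 𝒯₂ φ → ∀ e → IsCrossing φ e
  crosses⇒crossing φ x = crossing-everywhere φ
    (proj₂ (CrossesImpliesCrossing.crosses⇒crossing ℝ φ (√-pos 0<D₁) (√-square 0<D₁) x))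
    where 0<D₁ = fromℤ-pos (PIBQF.D>0 q₁)

  crossing⇒crosses : ∀ φ {e} → IsCrossing φ e → Crosses 𝒯₁ 𝒯₂ φ
  crossing⇒crosses φ {e} c = proj₁ (Criterion.crossing⇒crosses φ {e} c)

  iso : ℤ → PlaneIso → ℤ → PlaneIso
  iso a φ b = power τ₁ a ∙ φ ∙ power τ₂ b

  τ^-g : ∀ φ φ′ a b → (∀ e → to φ′ e ≡ (τ₁ ^ a) (to φ ((τ₂ ^ b) e))) → ∀ e → g φ′ ((τ₁ ^ a) e) ≡ g φ e
  τ^-g φ φ′ a b h e = begin
    𝒯₂.f (from φ′ ((τ₁ ^ a) e))  ≡⟨ cong 𝒯₂.f (to-from φ′ eq) ⟩
    𝒯₂.f ((τ₂ ^ (ℤ.- b)) (from φ e))  ≡⟨ Translations₂.τ^-forms (ℤ.- b) (from φ e) ⟩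
    𝒯₂.f (from φ e) ∎
    where
    open ≡-Reasoning
    eq : to φ′ ((τ₂ ^ (ℤ.- b)) (from φ e)) ≡ (τ₁ ^ a) e
    eq = trans (h _) (cong (τ₁ ^ a) (trans (cong (to φ) (^-neg′ τ₂ b (from φ e))) (PlaneIso.strictlyInverseˡ φ e)))

  module _ {φ φ′ a b} (h : ∀ e → to φ′ e ≡ (τ₁ ^ a) (to φ ((τ₂ ^ b) e))) where

    exit-translate : ∀ {k} → Criterion.ExitIndex φ k → Criterion.ExitIndex φ′ (k ℤ.+ a ℤ.* + p₁)
    exit-translate {k} (m , ¬m) = subst Mixed (sym (g-edge k)) m ,
      λ m′ → ¬m (subst Mixed (g-edge (ℤ.suc k))
          (subst (λ k → Mixed (g φ′ (edge₁ k))) (sym (ℤₚ.+-assoc 1ℤ k (a ℤ.* + p₁))) m′))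
      where
      g-edge : ∀ k → g φ′ (edge₁ (k ℤ.+ a ℤ.* + p₁)) ≡ g φ (edge₁ k)
      g-edge k = trans (cong (g φ′) (sym (Translations₁.τ^-edge a k))) (τ^-g φ φ′ a b h (edge₁ k))

    crossing-translate : ∀ {e} → IsCrossing φ e → IsCrossing φ′ ((τ₁ ^ a) e)
    crossing-translate {e} = subst₂ Crossing (sym (Translations₁.τ^-forms a e)) (sym (τ^-g φ φ′ a b h e))

  Triple : Set
  Triple = Fin p₁ × Fin p₂ × Orientation

  -- Places an edge from one period of the second river onto an edge from one period of the first,
  -- with or against the flow. Every crossing is equivalent to one of these finitely many.
  candidate : Triple → PlaneIso
  candidate (i , j , o) = carry (edge₂ (+ toℕ j)) (o ▸ edge₁ (+ toℕ i))

  -- The last edge of the river of 𝒯₁ that is shared, reduced modulo the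
  -- periods, represents a crossing superimposition.
  Good : Triple → Set
  Good x@(i , _ , _) = IsCrossing (candidate x) (edge₁ (+ toℕ i)) × Criterion.ExitIndex (candidate x) (+ toℕ i)

  good? : Decidable Good
  good? x@(i , _ , _) = (disc (jac (𝒯₁.f e) (g φ e)) ℤₚ.<? 0ℤ) ×-dec
      (mixed? (g φ e) ×-dec ¬? (mixed? (g φ (edge₁ (ℤ.suc (+ toℕ i))))))
    where
    φ = candidate x
    e = edge₁ (+ toℕ i)
    mixed? : Decidable Mixed
    mixed? q = Form.A q ℤ.* Form.C q ℤₚ.<? 0ℤ

  orient-τ^ : ∀ a o e → (τ₁ ^ a) (o ▸ e) ≡ o ▸ (τ₁ ^ a) e
  orient-τ^ a forward  e = refl
  orient-τ^ a backward e = PlaneIso.to-bar (power τ₁ a) e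

  orient-to : ∀ φ o e → to φ (o ▸ e) ≡ o ▸ to φ e
  orient-to φ forward  e = refl
  orient-to φ backward e = PlaneIso.to-bar φ e

  orient-involutive : ∀ o e → o ▸ (o ▸ e) ≡ e
  orient-involutive forward  e = refl
  orient-involutive backward e = bar-involutive e

  orient-from : ∀ φ o j {e} → to φ (edge₂ j) ≡ o ▸ e → o ▸ edge₂ j ≡ from φ e
  orient-from φ o j {e} h =
    sym (to-from φ (trans (orient-to φ o (edge₂ j)) (trans (cong (o ▸_) h) (orient-involutive o e))))

  oriented-edge-unique : ∀ o o′ j j′ → o ▸ edge₂ j ≡ o′ ▸ edge₂ j′ → j ≡ j′ × o ≡ o′
  oriented-edge-unique forward  forward  j j′ eq = River₂.edge-injective eq , refl
  oriented-edge-unique backward backward j j′ eq = River₂.edge-injective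
    (trans (sym (bar-involutive (edge₂ j))) (trans (cong bar eq) (bar-involutive (edge₂ j′)))) , refl
  oriented-edge-unique forward  backward j j′ eq =
    contradiction (subst (λ e → Up (𝒯₂.f e)) eq (flowing₂ j)) (River₂.up-bar (edge₂ j′) (flowing₂ j′))
  oriented-edge-unique backward forward  j j′ eq =
    contradiction (subst (λ e → Up (𝒯₂.f e)) (sym eq) (flowing₂ j′)) (River₂.up-bar (edge₂ j) (flowing₂ j))

  -- Translation by `a` periods moves the exit by `a * p₁`. As the exit is unique and both indices
  -- lie below `p₁`, they agree; the oriented edge of the second river found there then determines
  -- the other two components.
  distinct-candidates : ∀ x y → Good x → Good y → SameModulo τ₁ τ₂ (candidate x) (candidate y) → x ≡ y
  distinct-candidates x@(i , j , o) y@(i′ , j′ , o′) (_ , exitˣ) (_ , exitʸ) (a , b , h) =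
    cong₂ _,_ i≡i′ (cong₂ _,_ j≡j′ (proj₂ same))
    where
    open ≡-Reasoning
    φ = candidate x
    ψ = candidate y
    index : + toℕ i ℤ.+ a ℤ.* + p₁ ≡ + toℕ i′
    index = Criterion.exit-unique ψ (exit-translate {φ} {ψ} {a} {b} h exitˣ) exitʸ
    i≡i′ : i ≡ i′
    i≡i′ = residue-unique i i′ a index
    k : ℤ
    k = + toℕ j ℤ.+ (ℤ.- b) ℤ.* + p₂
    image : to ψ (edge₂ k) ≡ o ▸ edge₁ (+ toℕ i′)
    image = begin
      to ψ (edge₂ k)                                      ≡⟨ cong (to ψ) (Translations₂.τ^-edge (ℤ.- b) (+ toℕ j)) ⟨
      to ψ ((τ₂ ^ (ℤ.- b)) (edge₂ (+ toℕ j)))             ≡⟨ h _ ⟩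
      (τ₁ ^ a) (to φ ((τ₂ ^ b) ((τ₂ ^ (ℤ.- b)) (edge₂ (+ toℕ j)))))
          ≡⟨ cong (λ e → (τ₁ ^ a) (to φ e)) (^-neg′ τ₂ b (edge₂ (+ toℕ j))) ⟩
      (τ₁ ^ a) (to φ (edge₂ (+ toℕ j)))                  
          ≡⟨ cong (τ₁ ^ a) (to-carry (edge₂ (+ toℕ j)) (o ▸ edge₁ (+ toℕ i))) ⟩
      (τ₁ ^ a) (o ▸ edge₁ (+ toℕ i))                      ≡⟨ orient-τ^ a o (edge₁ (+ toℕ i)) ⟩
      o ▸ (τ₁ ^ a) (edge₁ (+ toℕ i))                     
          ≡⟨ cong (o ▸_) (trans (Translations₁.τ^-edge a (+ toℕ i)) (cong edge₁ index)) ⟩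
      o ▸ edge₁ (+ toℕ i′)                                ∎
    same : k ≡ + toℕ j′ × o ≡ o′
    same = oriented-edge-unique o o′ k (+ toℕ j′) (trans (orient-from ψ o k image)
      (sym (orient-from ψ o′ (+ toℕ j′) (to-carry (edge₂ (+ toℕ j′)) (o′ ▸ edge₁ (+ toℕ i′))))))
    j≡j′ : j ≡ j′
    j≡j′ = residue-unique j j′ (ℤ.- b) (proj₁ same)

  river-image : ∀ φ {k} → Criterion.ExitIndex φ k → ∃[ j ] ∃[ o ] to φ (edge₂ j) ≡ o ▸ edge₁ k
  river-image φ {k} (m , _) with River₂.river-connected (from φ (edge₁ k)) m
  ... | j , inj₁ eq = j , forward , trans (cong (to φ) (sym eq)) (PlaneIso.strictlyInverseˡ φ (edge₁ k))
  ... | j , inj₂ eq = j , backward , (begin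
      to φ (edge₂ j)                  ≡⟨ cong (to φ) (bar-involutive (edge₂ j)) ⟨
      to φ (bar (bar (edge₂ j)))      ≡⟨ cong (λ e → to φ (bar e)) eq ⟨
      to φ (bar (from φ (edge₁ k)))   ≡⟨ PlaneIso.to-bar φ (from φ (edge₁ k)) ⟩
      bar (to φ (from φ (edge₁ k)))   ≡⟨ cong bar (PlaneIso.strictlyInverseˡ φ (edge₁ k)) ⟩
      bar (edge₁ k)                   ∎)
    where open ≡-Reasoning

  -- At the exit an edge of each river lies on the other. Reducing both indices modulo the periods
  -- translates `φ` into a candidate with the same edges identified.
  represented : ∀ φ → (∀ e → IsCrossing φ e) → ∃[ x ] Good x × SameModulo τ₁ τ₂ (candidate x) φ
  represented φ crossing = reduce (proj₂ (Criterion.crossing⇒crosses φ {edge₁ 0ℤ} (crossing (edge₁ 0ℤ))))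
    where
    open ≡-Reasoning
    reduce : ∃[ k ] Criterion.ExitIndex φ k → ∃[ x ] Good x × SameModulo τ₁ τ₂ (candidate x) φ
    reduce (k , exit) with river-image φ exit | residue {p₁} {{Translations₁.p-nonZero}} k
    ... | l , o , image | i , a , refl with residue {p₂} {{Translations₂.p-nonZero}} l
    ...   | j , b , refl = x , (crossing′ , exit′) , IsEquivalence.sym (sameModulo-isEquivalence τ₁ τ₂) {φ} {ψ}
        (ℤ.- a , b , h)
      where
      x = i , j , o
      ψ = candidate x
      h : ∀ e → to ψ e ≡ (τ₁ ^ (ℤ.- a)) (to φ ((τ₂ ^ b) e))
      h = to-≗ ψ (iso (ℤ.- a) φ b) {edge₂ (+ toℕ j)} (begin
        to ψ (edge₂ (+ toℕ j))
          ≡⟨ to-carry (edge₂ (+ toℕ j)) (o ▸ edge₁ (+ toℕ i)) ⟩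
        o ▸ edge₁ (+ toℕ i)
          ≡⟨ cong (o ▸_) (^-neg τ₁ a (edge₁ (+ toℕ i))) ⟨
        o ▸ (τ₁ ^ (ℤ.- a)) ((τ₁ ^ a) (edge₁ (+ toℕ i)))
          ≡⟨ cong (λ e → o ▸ (τ₁ ^ (ℤ.- a)) e) (Translations₁.τ^-edge a (+ toℕ i)) ⟩
        o ▸ (τ₁ ^ (ℤ.- a)) (edge₁ (+ toℕ i ℤ.+ a ℤ.* + p₁))
          ≡⟨ orient-τ^ (ℤ.- a) o (edge₁ (+ toℕ i ℤ.+ a ℤ.* + p₁)) ⟨
        (τ₁ ^ (ℤ.- a)) (o ▸ edge₁ (+ toℕ i ℤ.+ a ℤ.* + p₁))
          ≡⟨ cong (τ₁ ^ (ℤ.- a)) image ⟨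
        (τ₁ ^ (ℤ.- a)) (to φ (edge₂ (+ toℕ j ℤ.+ b ℤ.* + p₂)))
          ≡⟨ cong (λ e → (τ₁ ^ (ℤ.- a)) (to φ e)) (Translations₂.τ^-edge b (+ toℕ j)) ⟨
        (τ₁ ^ (ℤ.- a)) (to φ ((τ₂ ^ b) (edge₂ (+ toℕ j)))) ∎)
      e₁ : ∀ i a p → i ℤ.+ a ℤ.* p ℤ.+ (ℤ.- a) ℤ.* p ≡ i
      e₁ = solve-∀
      exit′ : Criterion.ExitIndex ψ (+ toℕ i)
      exit′ = subst (Criterion.ExitIndex ψ) (e₁ (+ toℕ i) a (+ p₁)) (exit-translate {φ} {ψ} { ℤ.- a} {b} h exit)
      crossing′ : IsCrossing ψ (edge₁ (+ toℕ i))
      crossing′ = crossing-everywhere ψ (crossing-translate {φ} {ψ} { ℤ.- a} {b} h {root} (crossing root))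
          (edge₁ (+ toℕ i))

  enumerated : Enumerated {p₁ ℕ.* (p₂ ℕ.* 2)} (λ x → Good (decode x))
  enumerated = enumerate (λ x → good? (decode x))

  number : ℕ
  number = Enumerated.size enumerated

  cardinality : HasCardinality (crossings P₁ P₂) number
  cardinality = record
    { to        = representative
    ; cong      = λ { {k} refl → IsEquivalence.refl (sameModulo-isEquivalence τ₁ τ₂) {proj₁ (representative k)} }
    ; bijective =
        (λ {k} {l} same → distinct (decode-injective
            (distinct-candidates (decode (element k)) (decode (element l)) (satisfies k) (satisfies l) same))) ,
        surjective
    }
    where
    open Enumerated enumerated
    representative : Fin number → CrossingSuperimposition 𝒯₁ 𝒯₂
    representative k = candidate (decode (element k)) , crossing⇒crosses (candidate (decode (element k)))
        (proj₁ (satisfies k))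
    decode-injective : ∀ {x y : Fin (p₁ ℕ.* (p₂ ℕ.* 2))} → decode {p₁} {p₂} x ≡ decode y → x ≡ y
    decode-injective {x} {y} eq = trans (sym (encode-decode {p₁} {p₂} x))
        (trans (cong (encode {p₁} {p₂}) eq) (encode-decode {p₁} {p₂} y))
    surjective : ∀ y → ∃[ k ] (∀ {l} → l ≡ k → SameModulo τ₁ τ₂ (proj₁ (representative l)) (proj₁ y))
    surjective (φ , crosses) = find (represented φ (crosses⇒crossing φ crosses))
      where
      find : ∃[ x ] Good x × SameModulo τ₁ τ₂ (candidate x) φ →
             ∃[ k ] (∀ {l} → l ≡ k → SameModulo τ₁ τ₂ (proj₁ (representative l)) φ)
      find (x , good , same) = pick (exhaustive (encode x) (subst Good (sym (decode-encode x)) good))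
        where
        pick : ∃[ k ] element k ≡ encode x → ∃[ k ] (∀ {l} → l ≡ k → SameModulo τ₁ τ₂ (proj₁ (representative l)) φ)
        pick (k , eq) = k , λ { refl →
          subst (λ x → SameModulo τ₁ τ₂ (candidate x) φ) (sym (trans (cong decode eq) (decode-encode x))) same }

-- Roots, half circles and their meeting points.

module Apolarity where
  open FormAction
  open Signs
  open SignPatterns
  open import Data.Integer.Base using (_+_; _*_; _-_; -_)
  open Form

  -- The Jacobian is apolar to both of its arguments. This is exactly what puts the point it defines
  -- on both half circles.
  apolarˡ : ∀ q q′ → let w = jac q q′ in B q * B w ≡ + 2 * (A w * C q + A q * C w)
  apolarˡ [ a , b , c ] [ A , B , C ] = eq a b c A B C
    where
    eq : ∀ a b c A B C → b * (+ 2 * (a * C - A * c)) ≡ + 2 * ((a * B - A * b) * c + a * (b * C - B * c))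
    eq = solve-∀

  apolarʳ : ∀ q q′ → let w = jac q q′ in B q′ * B w ≡ + 2 * (A w * C q′ + A q′ * C w)
  apolarʳ [ a , b , c ] [ A , B , C ] = eq a b c A B C
    where
    eq : ∀ a b c A B C → B * (+ 2 * (a * C - A * c)) ≡ + 2 * ((a * B - A * b) * C + A * (b * C - B * c))
    eq = solve-∀

module Roots {r ℓ₁ ℓ₂} (ℝ : RealField r ℓ₁ ℓ₂) where
  open FormAction
  open Signs
  open SignPatterns
  open OrderedField ℝ
  open Geometry ℝ
  open VectorSigns ℝ using (IsRoot; disc≈)
  open Form
  open Apolarity

  2≉0 : fromℤ (+ 2) ≉ 0#
  2≉0 = pos⇒≉0 (fromℤ-pos 0<2)

  rootOf : Carrier → Form → Carrier
  rootOf σ [ a , b , c ] = (- fromℤ b + σ) * fromℤ (+ 2 ℤ.* a) ⁻¹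

  geodesicOf : Carrier → Form → OrientedGeodesic
  geodesicOf σ q = rootOf (- σ) q ⇝ rootOf σ q

  rootOf-equation : ∀ {q} σ → A q ≢ 0ℤ → fromℤ (+ 2) * fromℤ (A q) * rootOf σ q ≈ - fromℤ (B q) + σ
  rootOf-equation {[ a , b , c ]} σ a≢0 = ≈-trans (*-congʳ (≈-sym (fromℤ-* (+ 2) a)))
    (divide (- fromℤ b + σ) (λ eq → *-≉0 2≉0 (fromℤ-≉0 a≢0) (≈-trans (≈-sym (fromℤ-* (+ 2) a)) eq)))

  rootOf-unique : ∀ {q} σ → A q ≢ 0ℤ → ∀ {x} → fromℤ (+ 2) * fromℤ (A q) * x ≈ - fromℤ (B q) + σ → rootOf σ q ≈ x
  rootOf-unique {q} σ a≢0 eq = *-cancelˡ-≈ (*-≉0 2≉0 (fromℤ-≉0 a≢0))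
      (≈-trans (rootOf-equation {q} σ a≢0) (≈-sym eq))

  -- Characterises an ordered pair of roots without division. The symmetric functions cannot tell
  -- the roots apart; `difference` fixes the orientation of the geodesic.
  record Vieta (q : Form) (σ s t : Carrier) : Set ℓ₁ where
    field
      sum        : fromℤ (A q) * (s + t) ≈ - fromℤ (B q)
      product    : fromℤ (A q) * (s * t) ≈ fromℤ (C q)
      difference : fromℤ (A q) * (t - s) ≈ σ

  vieta : ∀ q {σ} → A q ≢ 0ℤ → IsRoot σ q → Vieta q σ (rootOf (- σ) q) (rootOf σ q)
  vieta q@([ a , b , c ]) {σ} a≢0 σ² = record
    { sum = *-cancelˡ-≈ 2≉0 (begin
        two * (a′ * (s + t))          ≈⟨ solve 4
            (λ k a s t → k :* (a :* (s :+ t)) := k :* a :* s :+ k :* a :* t) ≈-refl two a′ s t ⟩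
        two * a′ * s + two * a′ * t   ≈⟨ +-cong eqˢ eqᵗ ⟩
        (- b′ + - σ) + (- b′ + σ)     ≈⟨ solve 2 (λ b σ → (:- b :+ :- σ) :+ (:- b :+ σ) := con (+ 2) :* :- b)
            ≈-refl b′ σ ⟩
        two * - b′                    ∎)
    ; product = *-cancelˡ-≈ (*-≉0 (pos⇒≉0 (fromℤ-pos 0<4)) (fromℤ-≉0 a≢0)) (begin
        four * a′ * (a′ * (s * t))    ≈⟨ solve 3
            (λ a s t → con (+ 4) :* a :* (a :* (s :* t)) := (con (+ 2) :* a :* s) :* (con (+ 2) :* a :* t))
            ≈-refl a′ s t ⟩
        (two * a′ * s) * (two * a′ * t)  ≈⟨ *-cong eqˢ eqᵗ ⟩
        (- b′ + - σ) * (- b′ + σ)     ≈⟨ solve 2 (λ b σ → (:- b :+ :- σ) :* (:- b :+ σ) := b :* b :- σ :* σ)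
            ≈-refl b′ σ ⟩
        b′ * b′ - σ * σ               ≈⟨ +-congˡ (-‿cong (≈-trans σ² (disc≈ a b c))) ⟩
        b′ * b′ - (b′ * b′ - four * a′ * c′) 
            ≈⟨ solve 3 (λ a b c → b :* b :- (b :* b :- con (+ 4) :* a :* c) := con (+ 4) :* a :* c) ≈-refl a′ b′
            c′ ⟩
        four * a′ * c′                ∎)
    ; difference = *-cancelˡ-≈ 2≉0 (begin
        two * (a′ * (t - s))          ≈⟨ solve 4
            (λ k a s t → k :* (a :* (t :- s)) := k :* a :* t :- k :* a :* s) ≈-refl two a′ s t ⟩
        two * a′ * t - two * a′ * s   ≈⟨ +-cong eqᵗ (-‿cong eqˢ) ⟩
        (- b′ + σ) - (- b′ + - σ)     ≈⟨ solve 2 (λ b σ → (:- b :+ σ) :- (:- b :+ :- σ) := con (+ 2) :* σ)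
            ≈-refl b′ σ ⟩
        two * σ                       ∎)
    }
    where
    open ≈-Reasoning
    two = fromℤ (+ 2)
    four = fromℤ (+ 4)
    a′ = fromℤ a
    b′ = fromℤ b
    c′ = fromℤ c
    s = rootOf (- σ) q
    t = rootOf σ q
    eqˢ = rootOf-equation {q} (- σ) a≢0
    eqᵗ = rootOf-equation {q} σ a≢0

  -- For fixed nonzero `σ` the difference of the roots determines the leading coefficient with its
  -- sign, and the other coefficients follow. Thus an oriented geodesic recovers its form.
  vieta-unique : ∀ {q q′ σ s t} → σ ≉ 0# → Vieta q σ s t → Vieta q′ σ s t → q ≡ q′
  vieta-unique {q@([ a , b , c ])} {q′@([ a′ , b′ , c′ ])} {σ} {s} {t} σ≉0 v v′ = form-≡ a≡a′
      (ℤₚ.neg-injective (fromℤ-injective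
          (≈-trans (fromℤ-neg b) (≈-trans (≈-trans (≈-sym v.sum) (≈-trans (*-congʳ (fromℤ-cong a≡a′)) v′.sum))
          (≈-sym (fromℤ-neg b′))))))
      (fromℤ-injective (≈-trans (≈-sym v.product) (≈-trans (*-congʳ (fromℤ-cong a≡a′)) v′.product)))
    where
    module v = Vieta v
    module v′ = Vieta v′
    a≡a′ : a ≡ a′
    a≡a′ = fromℤ-injective (*-cancelˡ-≈ {t - s}
        (λ eq → σ≉0 (≈-trans (≈-sym v.difference) (≈-trans (*-congˡ eq) (zeroʳ _))))
      (≈-trans (*-comm _ _) (≈-trans (≈-trans v.difference (≈-sym v′.difference)) (*-comm _ _))))

  vieta-cong : ∀ {q σ s s′ t t′} → s ≈ s′ → t ≈ t′ → Vieta q σ s t → Vieta q σ s′ t′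
  vieta-cong s≈ t≈ v = record
    { sum        = ≈-trans (*-congˡ (+-cong (≈-sym s≈) (≈-sym t≈))) (Vieta.sum v)
    ; product    = ≈-trans (*-congˡ (*-cong (≈-sym s≈) (≈-sym t≈))) (Vieta.product v)
    ; difference = ≈-trans (*-congˡ (+-cong (≈-sym t≈) (-‿cong (≈-sym s≈)))) (Vieta.difference v)
    }

  -- The action on forms is inverse to the one on roots.
  möbius-rootOf : ∀ γ q σ → det γ ≡ 1ℤ → A q ≢ 0ℤ → A (γ ∘ q) ≢ 0ℤ → IsRoot σ q →
                  möbius γ (rootOf σ (γ ∘ q)) ≈ rootOf σ q
  möbius-rootOf γ@(mat a b c d) q@([ A₀ , B₀ , C₀ ]) σ det≡1 A≢0′ A′≢0 σ² = *-cancelˡ-≈ r′-denominator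
      (≈-trans (divide _ r′-denominator)
      (*-cancelˡ-≈ τ≉0 (≈-trans numerator
          (≈-sym (≈-trans (≈-sym (*-assoc τ _ ρ)) (≈-trans (*-congʳ denominator) (*-identityˡ ρ)))))))
    where
    open ≈-Reasoning
    a′ = fromℤ a
    b′ = fromℤ b
    c′ = fromℤ c
    d′ = fromℤ d
    α = fromℤ A₀
    β = fromℤ B₀
    ρ = rootOf σ q
    ρ̄ = rootOf (- σ) q
    -- The denominator of the inverse transformation at `ρ`. It is nonzero because it divides the
    -- leading coefficient of `γ ∘ q`.
    τ = a′ - c′ * ρ
    r′ = rootOf σ (γ ∘ q)
    two = fromℤ (+ 2)
    module v = Vieta (vieta q {σ} A≢0′ σ²)
    B≈ : β ≈ - (α * (ρ̄ + ρ))
    B≈ = ≈-trans (≈-sym (-‿involutive β)) (-‿cong (≈-sym v.sum))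
    σ≈ : σ ≈ α * (ρ - ρ̄)
    σ≈ = ≈-sym v.difference
    A′≈ : fromℤ (A (γ ∘ q)) ≈ α * ((a′ - c′ * ρ) * (a′ - c′ * ρ̄))
    A′≈ = begin
      fromℤ (A₀ ℤ.* (a ℤ.* a) ℤ.+ B₀ ℤ.* (a ℤ.* c) ℤ.+ C₀ ℤ.* (c ℤ.* c))
        ≈⟨ ≈-trans (fromℤ-+ (A₀ ℤ.* (a ℤ.* a) ℤ.+ B₀ ℤ.* (a ℤ.* c)) (C₀ ℤ.* (c ℤ.* c)))
            (+-cong (≈-trans (fromℤ-+ (A₀ ℤ.* (a ℤ.* a)) (B₀ ℤ.* (a ℤ.* c)))
             (+-cong (≈-trans (fromℤ-* A₀ (a ℤ.* a)) (*-congˡ (fromℤ-* a a)))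
                 (≈-trans (fromℤ-* B₀ (a ℤ.* c)) (*-cong B≈ (fromℤ-* a c)))))
             (≈-trans (fromℤ-* C₀ (c ℤ.* c)) (*-cong (≈-sym v.product) (fromℤ-* c c)))) ⟩
      α * (a′ * a′) + - (α * (ρ̄ + ρ)) * (a′ * c′) + α * (ρ̄ * ρ) * (c′ * c′)
        ≈⟨ solve 5 (λ α ρ ρ̄ a c → α :* (a :* a) :+ :- (α :* (ρ̄ :+ ρ)) :* (a :* c) :+ α :* (ρ̄ :* ρ) :* (c :* c) :=
             α :* ((a :- c :* ρ) :* (a :- c :* ρ̄))) ≈-refl α ρ ρ̄ a′ c′ ⟩
      α * ((a′ - c′ * ρ) * (a′ - c′ * ρ̄)) ∎
    B′≈ : fromℤ (B (γ ∘ q)) ≈ two * α * (a′ * b′) + - (α * (ρ̄ + ρ)) * (a′ * d′ + b′ * c′) + two *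
        (α * (ρ̄ * ρ)) * (c′ * d′)
    B′≈ = ≈-trans (fromℤ-+ (+ 2 ℤ.* A₀ ℤ.* (a ℤ.* b) ℤ.+ B₀ ℤ.* (a ℤ.* d ℤ.+ b ℤ.* c)) (+ 2 ℤ.* C₀ ℤ.* (c ℤ.* d)))
      (+-cong (≈-trans (fromℤ-+ (+ 2 ℤ.* A₀ ℤ.* (a ℤ.* b)) (B₀ ℤ.* (a ℤ.* d ℤ.+ b ℤ.* c)))
        (+-cong (≈-trans (fromℤ-* (+ 2 ℤ.* A₀) (a ℤ.* b)) (*-cong (fromℤ-* (+ 2) A₀) (fromℤ-* a b)))
          (≈-trans (fromℤ-* B₀ (a ℤ.* d ℤ.+ b ℤ.* c))
              (*-cong B≈ (≈-trans (fromℤ-+ (a ℤ.* d) (b ℤ.* c)) (+-cong (fromℤ-* a d) (fromℤ-* b c)))))))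
        (≈-trans (fromℤ-* (+ 2 ℤ.* C₀) (c ℤ.* d))
            (*-cong (≈-trans (fromℤ-* (+ 2) C₀) (*-congˡ (≈-sym v.product))) (fromℤ-* c d))))
    det≈ : a′ * d′ - b′ * c′ ≈ 1#
    det≈ = ≈-trans (≈-sym (≈-trans (fromℤ-+ (a ℤ.* d) (ℤ.- (b ℤ.* c)))
        (+-cong (fromℤ-* a d) (≈-trans (fromℤ-neg (b ℤ.* c)) (-‿cong (fromℤ-* b c))))))
      (≈-trans (fromℤ-cong det≡1) fromℤ-1)
    τ≉0 : τ ≉ 0#
    τ≉0 = *-≉0ˡ (*-≉0ʳ (λ eq → fromℤ-≉0 A′≢0 (≈-trans A′≈ eq)))
    r₀ = (d′ * ρ - b′) * τ ⁻¹
    τr₀ : τ * r₀ ≈ d′ * ρ - b′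
    τr₀ = divide (d′ * ρ - b′) τ≉0
    r′≈ : r′ ≈ r₀
    r′≈ = rootOf-unique {γ ∘ q} σ A′≢0 (*-cancelˡ-≈ τ≉0 (begin
      τ * (two * fromℤ (A (γ ∘ q)) * r₀)
        ≈⟨ solve 4 (λ k A τ r → τ :* (k :* A :* r) := k :* A :* (τ :* r)) ≈-refl two (fromℤ (A (γ ∘ q))) τ r₀ ⟩
      two * fromℤ (A (γ ∘ q)) * (τ * r₀)
        ≈⟨ *-cong (*-congˡ A′≈) τr₀ ⟩
      two * (α * ((a′ - c′ * ρ) * (a′ - c′ * ρ̄))) * (d′ * ρ - b′)
        ≈⟨ solve 7 (λ α ρ ρ̄ a b c d → con (+ 2) :* (α :* ((a :- c :* ρ) :* (a :- c :* ρ̄))) :* (d :* ρ :- b) :=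
             (a :- c :* ρ) :* (:- (con (+ 2) :* α :* (a :* b) :+ :- (α :* (ρ̄ :+ ρ)) :* (a :* d :+ b :* c) :+
                 con (+ 2) :* (α :* (ρ̄ :* ρ)) :* (c :* d))
               :+ (a :* d :- b :* c) :* (α :* (ρ :- ρ̄)))) ≈-refl α ρ ρ̄ a′ b′ c′ d′ ⟩
      τ * (- (two * α * (a′ * b′) + - (α * (ρ̄ + ρ)) * (a′ * d′ + b′ * c′) + two * (α * (ρ̄ * ρ)) * (c′ * d′))
          + (a′ * d′ - b′ * c′) * (α * (ρ - ρ̄)))
        ≈⟨ *-congˡ (+-cong (-‿cong (≈-sym B′≈)) (≈-trans (*-cong det≈ (≈-sym σ≈)) (*-identityˡ σ))) ⟩
      τ * (- fromℤ (B (γ ∘ q)) + σ) ∎))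
    denominator : τ * (c′ * r′ + d′) ≈ 1#
    denominator = begin
      τ * (c′ * r′ + d′)           ≈⟨ *-congˡ (+-congʳ (*-congˡ r′≈)) ⟩
      τ * (c′ * r₀ + d′)           ≈⟨ solve 4 (λ τ c r d → τ :* (c :* r :+ d) := c :* (τ :* r) :+ τ :* d) ≈-refl
          τ c′ r₀ d′ ⟩
      c′ * (τ * r₀) + τ * d′       ≈⟨ +-congʳ (*-congˡ τr₀) ⟩
      c′ * (d′ * ρ - b′) + τ * d′  ≈⟨ solve 5
          (λ a b c d ρ → c :* (d :* ρ :- b) :+ (a :- c :* ρ) :* d := a :* d :- b :* c) ≈-refl a′ b′ c′ d′ ρ ⟩
      a′ * d′ - b′ * c′            ≈⟨ det≈ ⟩
      1#                           ∎
    numerator : τ * (a′ * r′ + b′) ≈ ρ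
    numerator = begin
      τ * (a′ * r′ + b′)           ≈⟨ *-congˡ (+-congʳ (*-congˡ r′≈)) ⟩
      τ * (a′ * r₀ + b′)           ≈⟨ solve 4 (λ τ c r d → τ :* (c :* r :+ d) := c :* (τ :* r) :+ τ :* d) ≈-refl
          τ a′ r₀ b′ ⟩
      a′ * (τ * r₀) + τ * b′       ≈⟨ +-congʳ (*-congˡ τr₀) ⟩
      a′ * (d′ * ρ - b′) + τ * b′  ≈⟨ solve 5
          (λ a b c d ρ → a :* (d :* ρ :- b) :+ (a :- c :* ρ) :* b := (a :* d :- b :* c) :* ρ) ≈-refl a′ b′ c′ d′ ρ ⟩
      (a′ * d′ - b′ * c′) * ρ      ≈⟨ *-congʳ det≈ ⟩
      1# * ρ                       ≈⟨ *-identityˡ ρ ⟩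
      ρ                            ∎
    r′-denominator : c′ * r′ + d′ ≉ 0#
    r′-denominator = *-≉0ʳ (λ eq → 1≉0 (≈-trans (≈-sym denominator) eq))

module Circles {r ℓ₁ ℓ₂} (ℝ : RealField r ℓ₁ ℓ₂) where
  open FormAction
  open Signs
  open SignPatterns
  open OrderedField ℝ
  open Geometry ℝ
  open Roots ℝ
  open VectorSigns ℝ using (disc≈; minor≈)
  open Form
  open Apolarity

  private
    two four : Carrier
    two = fromℤ (+ 2)
    four = fromℤ (+ 4)

  coeff : (Form → ℤ) → Form → Carrier
  coeff X q = fromℤ (X q)

  circle : Form → Carrier → Carrier → Carrier
  circle q x y = coeff A q * (x * x + y * y) + coeff B q * x + coeff C q

  diameter-circle : ∀ {q σ s t} → Vieta q σ s t → ∀ x y → coeff A q * ((x - s) * (x - t) + y * y) ≈ circle q x y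
  diameter-circle {q} {σ} {s} {t} v x y = begin
    α * ((x - s) * (x - t) + y * y)
      ≈⟨ solve 5 (λ α s t x y → α :* ((x :- s) :* (x :- t) :+ y :* y) := α :* (x :* x :+ y :* y) :+ :-
          (α :* (s :+ t)) :* x :+ α :* (s :* t)) ≈-refl α s t x y ⟩
    α * (x * x + y * y) + - (α * (s + t)) * x + α * (s * t)
      ≈⟨ +-cong (+-congˡ (*-congʳ (≈-trans (-‿cong (Vieta.sum v)) (-‿involutive _)))) (Vieta.product v) ⟩
    circle q x y ∎
    where
    open ≈-Reasoning
    α = coeff A q

  Δ : Form → Form → Carrier
  Δ g q = - fromℤ (disc (jac g q))

  α-jac : ∀ g q → coeff A (jac g q) ≈ coeff A g * coeff B q - coeff A q * coeff B g
  α-jac g q = minor≈ (A g) (B q) (A q) (B g)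

  β-jac : ∀ g q → coeff B (jac g q) ≈ two * (coeff A g * coeff C q - coeff A q * coeff C g)
  β-jac g q = ≈-trans (fromℤ-* (+ 2) (A g ℤ.* C q ℤ.- A q ℤ.* C g)) (*-congˡ (minor≈ (A g) (C q) (A q) (C g)))

  γ-jac : ∀ g q → coeff C (jac g q) ≈ coeff B g * coeff C q - coeff B q * coeff C g
  γ-jac g q = minor≈ (B g) (C q) (B q) (C g)

  module Meeting (g q : Form) where
    private
      w = jac g q
    α β γ : Carrier
    α = coeff A w
    β = coeff B w
    γ = coeff C w

    record Meets (x y : Carrier) : Set (ℓ₁ ⊔ ℓ₂) where
      field
        y>0 : 0# < y
        onᵍ : circle g x y ≈ 0#
        onᵠ : circle q x y ≈ 0#

    Δ≈ : Δ g q ≈ four * α * γ - β * β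
    Δ≈ = ≈-trans (-‿cong (disc≈ (A w) (B w) (C w)))
        (solve 3 (λ α β γ → :- (β :* β :- con (+ 4) :* α :* γ) := con (+ 4) :* α :* γ :- β :* β) ≈-refl α β γ)

    module _ {x y} (m : Meets x y) where
      open Meets m
      private
        a = coeff A g
        b = coeff B g
        c = coeff C g
        a′ = coeff A q
        b′ = coeff B q
        c′ = coeff C q
        n = x * x + y * y

      -- Eliminating `x² + y²` between the circle equations gives this relation, eliminating the
      -- linear term gives `meets-norm`. Together they say that the meeting point is the root of the
      -- Jacobian in the upper half plane.
      meets-x : two * α * x ≈ - β
      meets-x = begin
        two * α * x
          ≈⟨ *-congʳ (*-congˡ (α-jac g q)) ⟩
        two * (a * b′ - a′ * b) * x
          ≈⟨ solve 8 (λ a b c a′ b′ c′ x n →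
               con (+ 2) :* (a :* b′ :- a′ :* b) :* x :=
               con (+ 2) :* (a :* (a′ :* n :+ b′ :* x :+ c′) :- a′ :* (a :* n :+ b :* x :+ c)) :- con (+ 2) :*
                   (a :* c′ :- a′ :* c))
               ≈-refl a b c a′ b′ c′ x n ⟩
        two * (a * circle q x y - a′ * circle g x y) - two * (a * c′ - a′ * c)
          ≈⟨ +-cong (*-congˡ (+-cong (*-congˡ onᵠ) (-‿cong (*-congˡ onᵍ)))) (-‿cong (≈-sym (β-jac g q))) ⟩
        two * (a * 0# - a′ * 0#) - β
          ≈⟨ solve 3 (λ a a′ β → con (+ 2) :* (a :* con 0ℤ :- a′ :* con 0ℤ) :- β := :- β) ≈-refl a a′ β ⟩
        - β ∎
        where open ≈-Reasoning

      meets-norm : α * n ≈ γ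
      meets-norm = begin
        α * n
          ≈⟨ *-congʳ (α-jac g q) ⟩
        (a * b′ - a′ * b) * n
          ≈⟨ solve 8 (λ a b c a′ b′ c′ x n →
               (a :* b′ :- a′ :* b) :* n :=
               b′ :* (a :* n :+ b :* x :+ c) :- b :* (a′ :* n :+ b′ :* x :+ c′) :+ (b :* c′ :- b′ :* c))
               ≈-refl a b c a′ b′ c′ x n ⟩
        b′ * circle g x y - b * circle q x y + (b * c′ - b′ * c)
          ≈⟨ +-cong (+-cong (*-congˡ onᵍ) (-‿cong (*-congˡ onᵠ))) (≈-sym (γ-jac g q)) ⟩
        b′ * 0# - b * 0# + γ
          ≈⟨ solve 3 (λ b b′ γ → b′ :* con 0ℤ :- b :* con 0ℤ :+ γ := γ) ≈-refl b b′ γ ⟩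
        γ ∎
        where open ≈-Reasoning

      meets-Δ : Δ g q ≈ (two * α * y) * (two * α * y)
      meets-Δ = begin
        Δ g q                          ≈⟨ Δ≈ ⟩
        four * α * γ - β * β          
            ≈⟨ +-cong (*-congˡ (≈-sym meets-norm))
            (-‿cong (≈-trans (solve 1 (λ β → β :* β := :- β :* :- β) ≈-refl β)
                                            (*-cong (≈-sym meets-x) (≈-sym meets-x)))) ⟩
        four * α * (α * n) - (two * α * x) * (two * α * x)
          ≈⟨ solve 3 (λ α x y → con (+ 4) :* α :* (α :* (x :* x :+ y :* y)) :- (con (+ 2) :* α :* x) :*
              (con (+ 2) :* α :* x) :=
               (con (+ 2) :* α :* y) :* (con (+ 2) :* α :* y)) ≈-refl α x y ⟩
        (two * α * y) * (two * α * y)  ∎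
        where open ≈-Reasoning

      meets⇒crossing : α ≉ 0# → Crossing g q
      meets⇒crossing α≉0 = 0<-⁻¹ (fromℤ-pos⁻¹ (pos-resp (≈-trans (≈-sym meets-Δ) (≈-sym (fromℤ-neg (disc w))))
        (sq-pos (*-≉0 (*-≉0 2≉0 α≉0) (pos⇒≉0 y>0)))))

    module _ (α≉0 : α ≉ 0#) where
      private
        2α≉0 : two * α ≉ 0#
        2α≉0 = *-≉0 2≉0 α≉0

      meets-unique : ∀ {x y x′ y′} → Meets x y → Meets x′ y′ → x ≈ x′ × y ≈ y′
      meets-unique m m′ =
        *-cancelˡ-≈ 2α≉0 (≈-trans (meets-x m) (≈-sym (meets-x m′))) ,
        square-injective (Meets.y>0 m) (Meets.y>0 m′) (*-cancelˡ-≈ (*-≉0 2α≉0 2α≉0)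
          (≈-trans (regroup _) (≈-trans (≈-trans (≈-sym (meets-Δ m)) (meets-Δ m′)) (≈-sym (regroup _)))))
        where
        regroup : ∀ y → (two * α * (two * α)) * (y * y) ≈ (two * α * y) * (two * α * y)
        regroup = solve 2 (λ k y → (k :* k) :* (y :* y) := (k :* y) :* (k :* y)) ≈-refl (two * α)

    crossing⇒Δ>0 : Crossing g q → 0# < Δ g q
    crossing⇒Δ>0 c = pos-resp (fromℤ-neg (disc w)) (fromℤ-pos (0<- c))

    crossing⇒α≉0 : Crossing g q → α ≉ 0#
    crossing⇒α≉0 c α≈0 = contradiction (crossing⇒Δ>0 c) λ 0<Δ → β²≮0 (neg-pos⁻¹ (pos-resp (≈-trans Δ≈
        (≈-trans (+-congʳ (≈-trans (*-congʳ (≈-trans (*-congˡ α≈0) (zeroʳ four))) (zeroˡ γ))) (+-identityˡ _)))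
            0<Δ))
      where
      β²≮0 : ¬ (β * β < 0#)
      β²≮0 h = <-asym h (sq-pos (λ β≈0 → <-irrefl (≈-trans (*-congˡ β≈0) (zeroʳ β)) h))

    apolar : ∀ q′ → B q′ ℤ.* B w ≡ + 2 ℤ.* (A w ℤ.* C q′ ℤ.+ A q′ ℤ.* C w) →
             coeff B q′ * β ≈ two * (α * coeff C q′ + coeff A q′ * γ)
    apolar q′ eq = ≈-trans (≈-sym (fromℤ-* (B q′) (B w))) (≈-trans (fromℤ-cong eq)
      (≈-trans (fromℤ-* (+ 2) (A w ℤ.* C q′ ℤ.+ A q′ ℤ.* C w))
          (*-congˡ (≈-trans (fromℤ-+ (A w ℤ.* C q′) (A q′ ℤ.* C w))
        (+-cong (fromℤ-* (A w) (C q′)) (fromℤ-* (A q′) (C w)))))))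

    module _ (crossing : Crossing g q) where
      private
        α≉0 = crossing⇒α≉0 crossing
        k = two * α
        k≉0 : k ≉ 0#
        k≉0 = *-≉0 2≉0 α≉0
        -- The real part of the complex root of the Jacobian; below, `y₀` is its imaginary part,
        -- made positive by the choice of the square root.
        x₀ = - β * k ⁻¹
        Y = Δ g q * (k * k) ⁻¹
        0<Y : 0# < Y
        0<Y = *-pos (crossing⇒Δ>0 crossing) (⁻¹-pos (sq-pos k≉0))
        y₀ = √ Y
        kx : k * x₀ ≈ - β
        kx = divide (- β) k≉0
        ky : (k * k) * (y₀ * y₀) ≈ four * α * γ - β * β
        ky = ≈-trans (*-congˡ (√-square 0<Y)) (≈-trans (divide (Δ g q) (*-≉0 k≉0 k≉0)) Δ≈)

        on : ∀ q′ → coeff B q′ * β ≈ two * (α * coeff C q′ + coeff A q′ * γ) → circle q′ x₀ y₀ ≈ 0#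
        on q′ apolar = *-cancelˡ-≈ (*-≉0 k≉0 k≉0) (begin
          (k * k) * (a * (x₀ * x₀ + y₀ * y₀) + b * x₀ + c)
            ≈⟨ solve 6 (λ k a b c x n → (k :* k) :* (a :* (x :* x :+ n) :+ b :* x :+ c) :=
                 a :* ((k :* x) :* (k :* x) :+ (k :* k) :* n) :+ k :* (b :* (k :* x)) :+ (k :* k) :* c) ≈-refl k
                     a b c x₀ (y₀ * y₀) ⟩
          a * ((k * x₀) * (k * x₀) + (k * k) * (y₀ * y₀)) + k * (b * (k * x₀)) + (k * k) * c
            ≈⟨ +-congʳ (+-cong (*-congˡ (+-cong (*-cong kx kx) ky)) (*-congˡ (*-congˡ kx))) ⟩
          a * (- β * - β + (four * α * γ - β * β)) + k * (b * - β) + (k * k) * c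
            ≈⟨ solve 6 (λ α β γ a b c → a :* (:- β :* :- β :+ (con (+ 4) :* α :* γ :- β :* β)) :+
                (con (+ 2) :* α) :* (b :* :- β) :+ (con (+ 2) :* α :* (con (+ 2) :* α)) :* c :=
                 con (+ 2) :* α :* (con (+ 2) :* (α :* c :+ a :* γ) :- b :* β)) ≈-refl α β γ a b c ⟩
          two * α * (two * (α * c + a * γ) - b * β)
            ≈⟨ *-congˡ (≈-trans (+-congˡ (-‿cong apolar)) (-‿inverseʳ _)) ⟩
          k * 0#          ≈⟨ zeroʳ k ⟩
          0#              ≈⟨ zeroʳ (k * k) ⟨
          (k * k) * 0#    ∎)
          where
          open ≈-Reasoning
          a = coeff A q′
          b = coeff B q′
          c = coeff C q′

      opaque
        meeting-point : ∃[ x ] ∃[ y ] Meets x y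
        meeting-point = x₀ , y₀ , record
          { y>0 = √-pos 0<Y ; onᵍ = on g (apolar g (apolarˡ g q)) ; onᵠ = on q (apolar q (apolarʳ g q)) }

  module _ {g q σ σ′ s t s′ t′} (vᵍ : Vieta g σ s t) (vᵠ : Vieta q σ′ s′ t′) (A≢0ᵍ : A g ≢ 0ℤ) (A≢0ᵠ : A q ≢ 0ℤ) where
    open Meeting g q

    on-both : ∀ {x y} → (x +i y) ∈ (s ⇝ t) → (x +i y) ∈ (s′ ⇝ t′) → Meets x y
    on-both {x} {y} (0<y , e) (_ , e′) = record
      { y>0 = 0<y
      ; onᵍ = ≈-trans (≈-sym (diameter-circle vᵍ x y)) (≈-trans (*-congˡ e) (zeroʳ _))
      ; onᵠ = ≈-trans (≈-sym (diameter-circle vᵠ x y)) (≈-trans (*-congˡ e′) (zeroʳ _))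
      }

    on-both⁻¹ : ∀ {x y} → Meets x y → (x +i y) ∈ (s ⇝ t) × (x +i y) ∈ (s′ ⇝ t′)
    on-both⁻¹ {x} {y} m =
      (y>0 , *-cancelˡ-≈ (fromℤ-≉0 A≢0ᵍ) (≈-trans (diameter-circle vᵍ x y) (≈-trans onᵍ (≈-sym (zeroʳ _))))) ,
      (y>0 , *-cancelˡ-≈ (fromℤ-≉0 A≢0ᵠ) (≈-trans (diameter-circle vᵠ x y) (≈-trans onᵠ (≈-sym (zeroʳ _)))))
      where open Meets m

    -- Both circles are centred on the real axis, so their gradients at a common point are parallel
    -- precisely when the centres agree, that is when `α` vanishes.
    normals : ∀ x y → coeff A g * coeff A q *
      (((x - s) + (x - t)) * (y + y) - (y + y) * ((x - s′) + (x - t′))) ≈ - (two * y * α)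
    normals x y = begin
      a * a′ * (((x - s) + (x - t)) * (y + y) - (y + y) * ((x - s′) + (x - t′)))
        ≈⟨ solve 8 (λ a a′ s t s′ t′ x y → a :* a′ :*
            (((x :- s) :+ (x :- t)) :* (y :+ y) :- (y :+ y) :* ((x :- s′) :+ (x :- t′))) :=
             con (+ 2) :* y :* (a :* (a′ :* (s′ :+ t′)) :- a′ :* (a :* (s :+ t)))) ≈-refl a a′ s t s′ t′ x y ⟩
      two * y * (a * (a′ * (s′ + t′)) - a′ * (a * (s + t)))
        ≈⟨ *-congˡ (+-cong (*-congˡ (Vieta.sum vᵠ)) (-‿cong (*-congˡ (Vieta.sum vᵍ)))) ⟩
      two * y * (a * - coeff B q - a′ * - coeff B g)
        ≈⟨ solve 6 (λ k y a a′ b b′ → k :* y :* (a :* :- b′ :- a′ :* :- b) := :-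
            (k :* y :* (a :* b′ :- a′ :* b))) ≈-refl two y a a′ (coeff B g) (coeff B q) ⟩
      - (two * y * (a * coeff B q - a′ * coeff B g))
        ≈⟨ -‿cong (*-congˡ (α-jac g q)) ⟨
      - (two * y * α) ∎
      where
      open ≈-Reasoning
      a = coeff A g
      a′ = coeff A q

    transverse⇒α≉0 : ∀ {x y} → TransverseAt (x +i y) (s ⇝ t) (s′ ⇝ t′) → α ≉ 0#
    transverse⇒α≉0 {x} {y} tr α≈0 = tr (*-cancelˡ-≈ (*-≉0 (fromℤ-≉0 A≢0ᵍ) (fromℤ-≉0 A≢0ᵠ)) (≈-trans (normals x y)
      (≈-trans (-‿cong (≈-trans (*-congˡ α≈0) (zeroʳ _))) (≈-trans -0#≈0# (≈-sym (zeroʳ _))))))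

    α≉0⇒transverse : ∀ {x y} → 0# < y → α ≉ 0# → TransverseAt (x +i y) (s ⇝ t) (s′ ⇝ t′)
    α≉0⇒transverse {x} {y} 0<y α≉0 e = *-≉0 (*-≉0 2≉0 (pos⇒≉0 0<y)) α≉0 (≈-trans (≈-sym (-‿involutive _))
      (≈-trans (-‿cong (≈-trans (≈-sym (normals x y)) (≈-trans (*-congˡ e) (zeroʳ _)))) -0#≈0#))

-- Windows in geometric sequences.

module GeometricSequences {r ℓ₁ ℓ₂} (ℝ : RealField r ℓ₁ ℓ₂) where
  open IntegerSequences
  open OrderedField ℝ

  -- The condition `X ≤ W < ρX`. Its closed end corresponds to the included end of the segment, and
  -- one term of a sequence of ratio `ρ` satisfies it.
  InWindow : Carrier → Carrier → Carrier → Set ℓ₂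
  InWindow ρ W X = ¬ (W < X) × W < ρ * X

  _<?_ : ∀ x y → Dec (x < y)
  x <? y with compare x y
  ... | tri< x<y _ _ = yes x<y
  ... | tri≈ ¬h _ _  = no ¬h
  ... | tri> ¬h _ _  = no ¬h

  module _ {ρ} (1<ρ : 1# < ρ) (u : ℤ → Carrier) (u>0 : ∀ i → 0# < u i) (u-suc : ∀ i → u (ℤ.suc i) ≈ ρ * u i) where

    private
      u-cong : ∀ {i j} → i ≡ j → u i ≈ u j
      u-cong refl = ≈-refl

      0<ρ-1 : 0# < ρ - 1#
      0<ρ-1 = <⇒0<- 1<ρ

      increases : ∀ i → u i < u (ℤ.suc i)
      increases i = 0<-⇒< (pos-resp (≈-trans
          (≈-trans (distribʳ (u i) ρ (- 1#))
          (+-congˡ (≈-trans (≈-sym (-‿distribˡ-* 1# (u i))) (-‿cong (*-identityˡ (u i))))))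
        (+-congʳ (≈-sym (u-suc i)))) (*-pos 0<ρ-1 (u>0 i)))

    monotone : ∀ {i j} → i ℤ.< j → u i < u j
    monotone {i} i<j = ascend-≤ (λ k → u i < u k) (increases i) (λ k h → <-trans h (increases k))
        (ℤₚ.i<j⇒suc[i]≤j i<j)

    monotone⁻¹ : ∀ {i j} → u i < u j → i ℤ.< j
    monotone⁻¹ {i} {j} h with ℤₚ.<-cmp i j
    ... | tri< i<j _ _  = i<j
    ... | tri≈ _ refl _ = contradiction h (<-irrefl ≈-refl)
    ... | tri> _ _ j<i  = contradiction h (<-asym (monotone j<i))

    -- A form of Bernoulli's inequality: it turns the Archimedean axiom, which concerns multiples,
    -- into unboundedness of powers.
    growth-bound : ∀ i n → (n · 1#) * ((ρ - 1#) * u i) < u (i ℤ.+ + n)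
    growth-bound i ℕ.zero = <-respˡ (≈-sym (zeroˡ _)) (u>0 (i ℤ.+ 0ℤ))
    growth-bound i (ℕ.suc n) = 0<-⇒< (pos-resp
        (≈-trans (solve 4 (λ ρ-1 v w N → (v :- N :* w) :+ (ρ-1 :* v :- w) := ρ-1 :* v :+ v :- (con 1ℤ :+ N) :*
            w) ≈-refl (ρ - 1#) v w (n · 1#))
          (+-cong ρv≈ (-‿cong (*-congʳ (+-congʳ fromℤ-1))))) (second n (<⇒0<- (growth-bound i n)) refl))
      where
      v = u (i ℤ.+ + n)
      w = (ρ - 1#) * u i
      ρv≈ : (ρ - 1#) * v + v ≈ u (i ℤ.+ + ℕ.suc n)
      ρv≈ = ≈-trans (+-congʳ (distribʳ v ρ (- 1#)))
          (≈-trans (+-assoc _ _ _) (≈-trans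
          (+-congˡ (≈-trans (+-congʳ (≈-trans (≈-sym (-‿distribˡ-* 1# v)) (-‿cong (*-identityˡ v))))
          (-‿inverseˡ v)))
        (≈-trans (+-identityʳ _) (≈-trans (≈-sym (u-suc (i ℤ.+ + n))) (u-cong (sym (+-suc i n)))))))
      second : ∀ m → 0# < v - (n · 1#) * w → m ≡ n → 0# < (v - (n · 1#) * w) + ((ρ - 1#) * v - w)
      second ℕ.zero h refl = pos-resp
          (≈-sym (≈-trans (+-congˡ (≈-trans (+-congʳ (*-congˡ (u-cong (ℤₚ.+-identityʳ i)))) (-‿inverseʳ w)))
          (+-identityʳ _))) h
      second (ℕ.suc m) h refl = pos-+ h
          (pos-resp (≈-trans (distribˡ (ρ - 1#) v (- u i)) (+-congˡ (≈-sym (-‿distribʳ-* _ _))))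
        (*-pos 0<ρ-1 (<⇒0<- (monotone (subst (ℤ._< i ℤ.+ + ℕ.suc m) (ℤₚ.+-identityʳ i)
            (ℤₚ.+-monoʳ-< i (ℤ.+<+ (ℕ.s≤s ℕ.z≤n))))))))

    module _ {W} (0<W : 0# < W) where
      private
        multiple : ∀ x {y} → 0# < y → ∃[ n ] x < (n · 1#) * y
        multiple x {y} 0<y with n , h ← archimedean (x * y ⁻¹) =
          n , 0<-⇒< (pos-resp (≈-trans (distribˡ y (n · 1#) (- (x * y ⁻¹)))
              (+-cong (*-comm y (n · 1#)) (≈-trans (≈-sym (-‿distribʳ-* y (x * y ⁻¹)))
              (-‿cong (divide x (pos⇒≉0 0<y))))))
            (*-pos 0<y (<⇒0<- h)))

        above : ∃[ n ] W < u (+ n)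
        above with n , h ← multiple W (*-pos 0<ρ-1 (u>0 0ℤ)) =
          n , <-trans h (<-respʳ (u-cong (ℤₚ.+-identityˡ (+ n))) (growth-bound 0ℤ n))

        below : ∃[ n ] ¬ (W < u (ℤ.- + n))
        below with n , h ← multiple (u 0ℤ) (*-pos 0<ρ-1 0<W) = n , λ W<u → <-asym W<u (u<W n h)
          where
          u<W : ∀ n → u 0ℤ < (n · 1#) * ((ρ - 1#) * W) → u (ℤ.- + n) < W
          u<W n h = 0<-⇒< (*-pos-cancelˡ c>0 (pos-resp
            (≈-trans (+-congˡ (-‿cong (≈-sym (*-assoc _ _ _)))) (≈-trans (+-congʳ (≈-sym (*-assoc _ _ _)))
              (≈-trans (+-congˡ (-‿distribʳ-* c (u (ℤ.- + n)))) (≈-sym (distribˡ c W (- u (ℤ.- + n)))))))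
            (<⇒0<- (<-trans (<-respʳ (u-cong (ℤₚ.+-inverseˡ (+ n))) (growth-bound (ℤ.- + n) n)) h))))
            where
            c = (n · 1#) * (ρ - 1#)
            c>0 : 0# < c
            c>0 = *-pos-cancelˡ 0<W (pos-resp (≈-trans (≈-sym (*-assoc _ _ _)) (*-comm c W)) (<-trans (u>0 0ℤ) h))

        scan : ∀ n i → ¬ (W < u i) → W < u (i ℤ.+ + n) → ∃[ b ] ¬ (W < u b) × W < u (ℤ.suc b)
        scan ℕ.zero    i low high = contradiction (<-respʳ (u-cong (ℤₚ.+-identityʳ i)) high) low
        scan (ℕ.suc n) i low high with W <? u (ℤ.suc i)
        ... | yes h = i , low , h
        ... | no ¬h = scan n (ℤ.suc i) ¬h (<-respʳ (u-cong (+-suc-shift i n)) high)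

      window : ∃[ b ] InWindow ρ W (u b)
      window = found (scan (m ℕ.+ n) (ℤ.- + m) (proj₂ below) (<-respʳ (u-cong (e (+ m) (+ n))) (proj₂ above)))
        where
        m = proj₁ below
        n = proj₁ above
        e : ∀ m n → n ≡ ℤ.- m ℤ.+ (m ℤ.+ n)
        e = solve-∀
        found : (∃[ b ] ¬ (W < u b) × W < u (ℤ.suc b)) → ∃[ b ] InWindow ρ W (u b)
        found (b , low , high) = b , low , <-respʳ (u-suc b) high

    window-≮ : ∀ {W i j} → InWindow ρ W (u i) → InWindow ρ W (u j) → ¬ (i ℤ.< j)
    window-≮ {W} {i} {j} (_ , high) (low , _) i<j = low (ascend-≤ (λ k → W < u k) (<-respʳ (≈-sym (u-suc i)) high)
      (λ k h → <-trans h (increases k)) (ℤₚ.i<j⇒suc[i]≤j i<j))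

    window-unique : ∀ {W i j} → InWindow ρ W (u i) → InWindow ρ W (u j) → i ≡ j
    window-unique x y = ℤₚ.≤-antisym (ℤₚ.≮⇒≥ (window-≮ y x)) (ℤₚ.≮⇒≥ (window-≮ x y))

    -- `1 < ρ′` makes `k` positive, and two or more steps would exceed `ρ′` because a single one
    -- already reaches it; so `k` is one.
    ratio-unique : ∀ {ρ′} k → 1# < ρ′ → ¬ (ρ < ρ′) → u k ≈ ρ′ * u 0ℤ → ρ′ ≈ ρ
    ratio-unique {ρ′} k 1<ρ′ ρ≮ρ′ eq = *-cancelˡ-≈ (pos⇒≉0 (u>0 0ℤ)) (≈-trans (*-comm _ _) (≈-trans (≈-sym eq)
      (≈-trans (u-cong k≡1) (≈-trans (u-suc 0ℤ) (*-comm _ _)))))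
      where
      expand : ∀ x → (x - 1#) * u 0ℤ ≈ x * u 0ℤ - u 0ℤ
      expand x = ≈-trans (distribʳ (u 0ℤ) x (- 1#))
          (+-congˡ (≈-trans (≈-sym (-‿distribˡ-* 1# (u 0ℤ))) (-‿cong (*-identityˡ (u 0ℤ)))))
      0<k : 0ℤ ℤ.< k
      0<k = monotone⁻¹ (0<-⇒< (pos-resp (≈-trans (expand ρ′) (+-congʳ (≈-sym eq))) (*-pos (<⇒0<- 1<ρ′) (u>0 0ℤ))))
      k≤1 : ¬ (1ℤ ℤ.< k)
      k≤1 1<k = ρ≮ρ′ (0<-⇒< (*-pos-cancelˡ (u>0 0ℤ) (pos-resp
        (≈-trans (+-cong eq (-‿cong (u-suc 0ℤ)))
            (solve 3 (λ x y z → x :* z :- y :* z := z :* (x :- y)) ≈-refl ρ′ ρ (u 0ℤ)))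
        (<⇒0<- (monotone 1<k)))))
      k≡1 : k ≡ 1ℤ
      k≡1 = ℤₚ.≤-antisym (ℤₚ.≮⇒≥ k≤1) (ℤₚ.i<j⇒suc[i]≤j 0<k)

  -- If k steps with ratio ρ′ multiply by ρ, and neither ρ′ nor its inverse lies
  -- in (1 , ρ), then ρ′ is ρ or its inverse.
  module _ {ρ ρ′ W} (1<ρ : 1# < ρ) (ratio : ρ′ ≈ 1# ⊎ ¬ (ρ′ < ρ) ⊎ (∃[ κ ] κ * ρ′ ≈ 1# × ¬ (κ < ρ))) (0<W : 0# < W) where
    private
      Windows : (ℤ → Carrier) → Set ℓ₂
      Windows u = (∃[ b ] InWindow ρ W (u b)) × (∀ {i j} → InWindow ρ W (u i) → InWindow ρ W (u j) → i ≡ j)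

      window-resp : ∀ {ρ₁ ρ₂ X} → ρ₁ ≈ ρ₂ → InWindow ρ₁ W X → InWindow ρ₂ W X
      window-resp eq (low , high) = low , <-respʳ (*-congʳ eq) high

      geometric : ∀ {κ} → ¬ (κ < ρ) → (u : ℤ → Carrier) → (∀ b → 0# < u b) → (∀ b → u (ℤ.suc b) ≈ κ * u b) →
                  ∀ k → u k ≈ ρ * u 0ℤ → Windows u
      geometric {κ} κ≮ρ u u>0 u-suc k u-k =
        (let b , win = window 1<κ u u>0 u-suc 0<W in b , window-resp (≈-sym ρ≈κ) win) ,
        λ x y → window-unique 1<κ u u>0 u-suc (window-resp ρ≈κ x) (window-resp ρ≈κ y)
        where
        1<κ : 1# < κ
        1<κ with compare κ ρ
        ... | tri< κ<ρ _ _ = contradiction κ<ρ κ≮ρ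
        ... | tri≈ _ κ≈ρ _ = <-respʳ (≈-sym κ≈ρ) 1<ρ
        ... | tri> _ _ ρ<κ = <-trans 1<ρ ρ<κ
        ρ≈κ : ρ ≈ κ
        ρ≈κ = ratio-unique 1<κ u u>0 u-suc k 1<ρ κ≮ρ u-k

    opaque
      -- Ratio one is incompatible with reaching a multiple by `ρ > 1`. If it is the inverse ratio
      -- that is at least `ρ`, the sequence is read backwards.
      power-windows : (u : ℤ → Carrier) → (∀ b → 0# < u b) → (∀ b → u (ℤ.suc b) ≈ ρ′ * u b) →
                      ∀ k → u k ≈ ρ * u 0ℤ → Windows u
      power-windows u u>0 u-suc k u-k = by-ratio ratio
        where
        by-ratio : ρ′ ≈ 1# ⊎ ¬ (ρ′ < ρ) ⊎ (∃[ κ ] κ * ρ′ ≈ 1# × ¬ (κ < ρ)) → Windows u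
        by-ratio (inj₁ ρ′≈1) = contradiction 1<ρ (<-irrefl (*-cancelˡ-≈ (pos⇒≉0 (u>0 0ℤ))
            (≈-trans (*-identityʳ (u 0ℤ)) (≈-trans (≈-sym (constant k)) (≈-trans u-k (*-comm ρ (u 0ℤ)))))))
          where
          step : ∀ b → u (ℤ.suc b) ≈ u b
          step b = ≈-trans (u-suc b) (≈-trans (*-congʳ ρ′≈1) (*-identityˡ (u b)))
          constant : ∀ b → u b ≈ u 0ℤ
          constant = everywhere (λ b → u b ≈ u 0ℤ) {0ℤ} ≈-refl (λ b h → ≈-trans (step b) h)
              (λ b h → ≈-trans (≈-sym (step b)) h)
        by-ratio (inj₂ (inj₁ ρ′≮ρ)) = geometric ρ′≮ρ u u>0 u-suc k u-k
        by-ratio (inj₂ (inj₂ (κ , κρ′≈1 , κ≮ρ))) =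
            (let b , win = proj₁ geo in ℤ.- b , win) ,
            λ {i} {j} x y → ℤₚ.neg-injective (proj₂ geo {ℤ.- i} {ℤ.- j} (involute i x) (involute j y))
          where
          reversed : ℤ → Carrier
          reversed b = u (ℤ.- b)
          u-cong : ∀ {i j} → i ≡ j → u i ≈ u j
          u-cong refl = ≈-refl
          involute : ∀ i → InWindow ρ W (u i) → InWindow ρ W (reversed (ℤ.- i))
          involute i = subst (λ k → InWindow ρ W (u k)) (sym (ℤₚ.neg-involutive i))
          reversed-suc : ∀ b → reversed (ℤ.suc b) ≈ κ * reversed b
          reversed-suc b = begin
            u (ℤ.- ℤ.suc b)                   ≈⟨ *-identityˡ _ ⟨
            1# * u (ℤ.- ℤ.suc b)              ≈⟨ *-congʳ κρ′≈1 ⟨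
            κ * ρ′ * u (ℤ.- ℤ.suc b)          ≈⟨ *-assoc _ _ _ ⟩
            κ * (ρ′ * u (ℤ.- ℤ.suc b))        ≈⟨ *-congˡ (≈-trans (≈-sym (u-suc (ℤ.- ℤ.suc b))) (u-cong (e b))) ⟩
            κ * u (ℤ.- b)                     ∎
            where
            open ≈-Reasoning
            e : ∀ b → 1ℤ ℤ.+ ℤ.- (1ℤ ℤ.+ b) ≡ ℤ.- b
            e = solve-∀
          geo : Windows reversed
          geo = geometric κ≮ρ reversed (λ b → u>0 (ℤ.- b)) reversed-suc (ℤ.- k)
              (≈-trans (u-cong (ℤₚ.neg-involutive k)) u-k)

-- The matrices of determinant one which fix the roots of a form.

record Automorph (q : Form) (M : Matrix) : Set where
  open Form q
  open Matrix M
  field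
    U     : ℤ
    det≡1 : det M ≡ 1ℤ
    c≡    : c ≡ A ℤ.* U
    d-a≡  : d ℤ.- a ≡ B ℤ.* U
    b≡    : b ≡ ℤ.- (C ℤ.* U)

-- Positions of meeting points along a geodesic.

module Positions {r ℓ₁ ℓ₂} (ℝ : RealField r ℓ₁ ℓ₂) (q : Form) (A≢0q : Form.A q ≢ 0ℤ)
  {σ s t : RealField.Carrier ℝ} (0<σ : RealField._<_ ℝ (RealField.0# ℝ) σ) (v : Roots.Vieta ℝ q σ s t)
  where
  open FormAction
  open Signs
  open SignPatterns
  open OrderedField ℝ
  open Geometry ℝ
  open Roots ℝ
  open Circles ℝ
  open VectorSigns ℝ using (minor≈)
  open GeometricSequences ℝ using (InWindow)
  open Form
  open Apolarity

  private
    two four : Carrier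
    two = fromℤ (+ 2)
    four = fromℤ (+ 4)

  τ : Carrier
  τ = t - s

  τ≉0 : τ ≉ 0#
  τ≉0 eq = pos⇒≉0 0<σ (≈-trans (≈-sym (Vieta.difference v)) (≈-trans (*-congˡ eq) (zeroʳ _)))

  -- On the half circle these are the squared distances from the two ends. The factor `τ` makes them
  -- positive there whichever end lies further left.
  fromSource toTarget : Carrier → Carrier
  fromSource x = (x - s) * τ
  toTarget x = (t - x) * τ

  module OnGeodesic {x y} (on : (x +i y) ∈ (s ⇝ t)) where

    y²≈ : y * y ≈ (x - s) * (t - x)
    y²≈ = begin
      y * y                                             
          ≈⟨ solve 4 (λ x y s t → y :* y := ((x :- s) :* (x :- t) :+ y :* y) :+ (x :- s) :* (t :- x)) ≈-refl x y
          s t ⟩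
      ((x - s) * (x - t) + y * y) + (x - s) * (t - x)    ≈⟨ +-congʳ (proj₂ on) ⟩
      0# + (x - s) * (t - x)                             ≈⟨ +-identityˡ _ ⟩
      (x - s) * (t - x)                                  ∎
      where open ≈-Reasoning

    private
      product : 0# < fromSource x * toTarget x
      product = pos-resp (≈-trans (*-congʳ y²≈)
          (solve 4 (λ x s t τ → ((x :- s) :* (t :- x)) :* (τ :* τ) := ((x :- s) :* τ) :* ((t :- x) :* τ)) ≈-refl
          x s t τ))
        (*-pos (*-pos (proj₁ on) (proj₁ on)) (sq-pos τ≉0))

      sum : 0# < fromSource x + toTarget x
      sum = pos-resp (solve 3 (λ x s t → (t :- s) :* (t :- s) := (x :- s) :* (t :- s) :+ (t :- x) :* (t :- s))
          ≈-refl x s t) (sq-pos τ≉0)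

    fromSource>0 : 0# < fromSource x
    fromSource>0 with compare 0# (fromSource x)
    ... | tri< h _ _ = h
    ... | tri≈ _ h _ = contradiction (≈-trans (*-congʳ (≈-sym h)) (zeroˡ _)) (pos⇒≉0 product)
    ... | tri> _ _ h with compare 0# (toTarget x)
    ...   | tri< h′ _ _ = contradiction product
        (<-asym (neg-pos⁻¹ (pos-resp (≈-sym (-‿distribˡ-* _ _)) (*-pos (neg-pos h) h′))))
    ...   | tri≈ _ h′ _ = contradiction (≈-trans (*-congˡ (≈-sym h′)) (zeroʳ _)) (pos⇒≉0 product)
    ...   | tri> _ _ h′ = contradiction sum
        (<-asym (neg-pos⁻¹ (pos-resp (-‿+-comm _ _) (pos-+ (neg-pos h) (neg-pos h′)))))

    toTarget>0 : 0# < toTarget x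
    toTarget>0 = *-pos-cancelˡ fromSource>0 product

  -- On the geodesic of q the meeting point with that of g satisfies
  -- (t − x)/(x − s) = p²/Δ, where p = polar w, so that p² records its position.
  polar Q : Form → Carrier
  polar w = coeff B w + two * coeff A w * t
  Q w = polar w * polar w

  module Action {M} (auto : Automorph q M) where
    open Matrix M
    open Automorph auto

    private
      a′ = fromℤ a
      b′ = fromℤ b
      c′ = fromℤ c
      d′ = fromℤ d
      A′ = fromℤ (A q)
      U′ = fromℤ U

      c≈ : c′ ≈ A′ * U′
      c≈ = ≈-trans (fromℤ-cong c≡) (fromℤ-* (A q) U)

      a≈ : a′ ≈ c′ * (s + t) + d′
      a≈ = begin
        a′                               ≈⟨ solve 2 (λ a d → a := :- (d :- a) :+ d) ≈-refl a′ d′ ⟩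
        - (d′ - a′) + d′                
            ≈⟨ +-congʳ (-‿cong (≈-trans (+-congˡ (≈-sym (fromℤ-neg a)))
            (≈-trans (≈-sym (fromℤ-+ d (ℤ.- a))) (≈-trans (fromℤ-cong d-a≡) (fromℤ-* (B q) U))))) ⟩
        - (fromℤ (B q) * U′) + d′        ≈⟨ +-congʳ (≈-trans (-‿distribˡ-* _ _) (*-congʳ (≈-sym (Vieta.sum v)))) ⟩
        A′ * (s + t) * U′ + d′          
            ≈⟨ +-congʳ (≈-trans (solve 3 (λ A S U → A :* S :* U := A :* U :* S) ≈-refl A′ (s + t) U′)
            (*-congʳ (≈-sym c≈))) ⟩
        c′ * (s + t) + d′                ∎
        where open ≈-Reasoning

      b≈ : b′ ≈ - (c′ * (s * t))
      b≈ = begin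
        b′                           ≈⟨ ≈-trans (fromℤ-cong b≡)
            (≈-trans (fromℤ-neg (C q ℤ.* U)) (-‿cong (fromℤ-* (C q) U))) ⟩
        - (fromℤ (C q) * U′)         ≈⟨ -‿cong (*-congʳ (≈-sym (Vieta.product v))) ⟩
        - (A′ * (s * t) * U′)        ≈⟨ -‿cong
            (≈-trans (solve 3 (λ A S U → A :* S :* U := A :* U :* S) ≈-refl A′ (s * t) U′) (*-congʳ (≈-sym c≈))) ⟩
        - (c′ * (s * t))             ∎
        where open ≈-Reasoning

    -- The eigenvalues of M.
    ε ε̄ : Carrier
    ε = c′ * t + d′
    ε̄ = c′ * s + d′

    εε̄≈1 : ε * ε̄ ≈ 1#
    εε̄≈1 = begin
      (c′ * t + d′) * (c′ * s + d′)
        ≈⟨ solve 4 (λ c d s t → (c :* t :+ d) :* (c :* s :+ d) := (c :* (s :+ t) :+ d) :* d :- :-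
            (c :* (s :* t)) :* c) ≈-refl c′ d′ s t ⟩
      (c′ * (s + t) + d′) * d′ - - (c′ * (s * t)) * c′
        ≈⟨ +-cong (*-congʳ (≈-sym a≈)) (-‿cong (*-congʳ (≈-sym b≈))) ⟩
      a′ * d′ - b′ * c′                ≈⟨ minor≈ a d b c ⟨
      fromℤ (det M)                    ≈⟨ fromℤ-cong det≡1 ⟩
      fromℤ 1ℤ                         ≈⟨ fromℤ-1 ⟩
      1#                               ∎
      where open ≈-Reasoning

    private
      2At≈ : two * (A′ * t) ≈ - coeff B q + σ
      2At≈ = ≈-trans (solve 3 (λ A s t → con (+ 2) :* (A :* t) := A :* (s :+ t) :+ A :* (t :- s)) ≈-refl A′ s t)
        (+-cong (Vieta.sum v) (Vieta.difference v))

      2As≈ : two * (A′ * s) ≈ - coeff B q - σ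
      2As≈ = ≈-trans (solve 3 (λ A s t → con (+ 2) :* (A :* s) := A :* (s :+ t) :- A :* (t :- s)) ≈-refl A′ s t)
        (+-cong (Vieta.sum v) (-‿cong (Vieta.difference v)))

      2d≈ : two * d′ ≈ fromℤ (a ℤ.+ d) + coeff B q * U′
      2d≈ = begin
        two * d′                               
            ≈⟨ solve 2 (λ a d → con (+ 2) :* d := a :+ d :+ (d :- a)) ≈-refl a′ d′ ⟩
        a′ + d′ + (d′ - a′)                    
            ≈⟨ +-cong (≈-sym (fromℤ-+ a d))
            (≈-trans (+-congˡ (≈-sym (fromℤ-neg a)))
            (≈-trans (≈-sym (fromℤ-+ d (ℤ.- a))) (≈-trans (fromℤ-cong d-a≡) (fromℤ-* (B q) U)))) ⟩
        fromℤ (a ℤ.+ d) + coeff B q * U′        ∎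
        where open ≈-Reasoning

    2ε≈ : two * ε ≈ fromℤ (a ℤ.+ d) + U′ * σ
    2ε≈ = begin
      two * (c′ * t + d′)
        ≈⟨ ≈-trans (*-congˡ (+-congʳ (*-congʳ c≈)))
            (solve 4 (λ A U t d → con (+ 2) :* (A :* U :* t :+ d) := U :* (con (+ 2) :* (A :* t)) :+ con (+ 2)
            :* d) ≈-refl A′ U′ t d′) ⟩
      U′ * (two * (A′ * t)) + two * d′
        ≈⟨ +-cong (*-congˡ 2At≈) 2d≈ ⟩
      U′ * (- coeff B q + σ) + (fromℤ (a ℤ.+ d) + coeff B q * U′)
        ≈⟨ solve 4 (λ U B σ T → U :* (:- B :+ σ) :+ (T :+ B :* U) := T :+ U :* σ) ≈-refl U′ (coeff B q) σ
            (fromℤ (a ℤ.+ d)) ⟩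
      fromℤ (a ℤ.+ d) + U′ * σ ∎
      where open ≈-Reasoning

    2ε̄≈ : two * ε̄ ≈ fromℤ (a ℤ.+ d) - U′ * σ
    2ε̄≈ = begin
      two * (c′ * s + d′)
        ≈⟨ ≈-trans (*-congˡ (+-congʳ (*-congʳ c≈)))
            (solve 4 (λ A U t d → con (+ 2) :* (A :* U :* t :+ d) := U :* (con (+ 2) :* (A :* t)) :+ con (+ 2)
            :* d) ≈-refl A′ U′ s d′) ⟩
      U′ * (two * (A′ * s)) + two * d′
        ≈⟨ +-cong (*-congˡ 2As≈) 2d≈ ⟩
      U′ * (- coeff B q - σ) + (fromℤ (a ℤ.+ d) + coeff B q * U′)
        ≈⟨ solve 4 (λ U B σ T → U :* (:- B :- σ) :+ (T :+ B :* U) := T :- U :* σ) ≈-refl U′ (coeff B q) σ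
            (fromℤ (a ℤ.+ d)) ⟩
      fromℤ (a ℤ.+ d) - U′ * σ ∎
      where open ≈-Reasoning

    ε≉0 : ε ≉ 0#
    ε≉0 = *-≉0ˡ (λ eq → 1≉0 (≈-trans (≈-sym εε̄≈1) eq))

    ε̄≉0 : ε̄ ≉ 0#
    ε̄≉0 = *-≉0ʳ (λ eq → 1≉0 (≈-trans (≈-sym εε̄≈1) eq))

    -- The matrix multiplies the quotient of the distances from the two ends by `ε²`. Positions are
    -- recorded by squared distances, hence the fourth power.
    ρ : Carrier
    ρ = (ε * ε) * (ε * ε)

    private
      γ-apolar : ∀ w → B q ℤ.* B w ≡ + 2 ℤ.* (A w ℤ.* C q ℤ.+ A q ℤ.* C w) →
                 two * coeff C w ≈ - (coeff B w * (s + t) + two * coeff A w * (s * t))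
      γ-apolar w eq = *-cancelˡ-≈ (fromℤ-≉0 A≢0q) (begin
        A′ * (two * γ)
          ≈⟨ solve 4 (λ A k γ x → A :* (k :* γ) := k :* (x :+ A :* γ) :- k :* x) ≈-refl A′ two γ (α * coeff C q) ⟩
        two * (α * coeff C q + A′ * γ) - two * (α * coeff C q)
          ≈⟨ +-congʳ (≈-trans (*-congˡ (≈-trans
              (+-cong (≈-sym (fromℤ-* (A w) (C q))) (≈-sym (fromℤ-* (A q) (C w))))
              (≈-sym (fromℤ-+ (A w ℤ.* C q) (A q ℤ.* C w)))))
               (≈-trans (≈-sym (fromℤ-* (+ 2) (A w ℤ.* C q ℤ.+ A q ℤ.* C w)))
                   (≈-trans (fromℤ-cong (sym eq)) (fromℤ-* (B q) (B w))))) ⟩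
        coeff B q * β - two * (α * coeff C q)
          ≈⟨ +-cong (*-congʳ (≈-trans (≈-sym (-‿involutive _)) (-‿cong (≈-sym (Vieta.sum v)))))
              (-‿cong (*-congˡ (*-congˡ (≈-sym (Vieta.product v))))) ⟩
        - (A′ * (s + t)) * β - two * (α * (A′ * (s * t)))
          ≈⟨ solve 6 (λ A S P α β k → :- (A :* S) :* β :- k :* (α :* (A :* P)) := A :* :-
              (β :* S :+ k :* α :* P)) ≈-refl A′ (s + t) (s * t) α β two ⟩
        A′ * - (β * (s + t) + two * α * (s * t)) ∎)
        where
        open ≈-Reasoning
        α = coeff A w
        β = coeff B w
        γ = coeff C w

    -- A form apolar to `q` has no mixed term in the basis of eigenvectors of `M`, so `M` multiplies
    -- its two remaining coefficients by the squares of the eigenvalues. The coefficient at the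
    -- eigenvector of `t` is `polar w` up to a factor that depends only on `q`.
    polar-action : ∀ w → B q ℤ.* B w ≡ + 2 ℤ.* (A w ℤ.* C q ℤ.+ A q ℤ.* C w) → polar (M ∘ w) ≈ (ε * ε) * polar w
    polar-action w@([ α₀ , β₀ , γ₀ ]) eq = begin
      polar (M ∘ w)
        ≈⟨ +-cong B≈ (*-congʳ (*-congˡ A≈)) ⟩
      (two * α * (a′ * b′) + β * (a′ * d′ + b′ * c′) + two * γ * (c′ * d′)) + two *
          (α * (a′ * a′) + β * (a′ * c′) + γ * (c′ * c′)) * t
        ≈⟨ solve 8 (λ α β γ a b c d t →
             (con (+ 2) :* α :* (a :* b) :+ β :* (a :* d :+ b :* c) :+ con (+ 2) :* γ :* (c :* d)) :+ con (+ 2)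
                 :* (α :* (a :* a) :+ β :* (a :* c) :+ γ :* (c :* c)) :* t :=
             (con (+ 2) :* α :* a :+ β :* c) :* (a :* t :+ b) :+ (β :* a :+ (con (+ 2) :* γ) :* c) :*
                 (c :* t :+ d)) ≈-refl α β γ a′ b′ c′ d′ t ⟩
      (two * α * a′ + β * c′) * (a′ * t + b′) + (β * a′ + (two * γ) * c′) * ε
        ≈⟨ +-cong (*-cong (+-congʳ (*-congˡ a≈)) (+-cong (*-congʳ a≈) b≈))
            (*-congʳ (+-cong (*-congˡ a≈) (*-congʳ (γ-apolar w eq)))) ⟩
      (two * α * (c′ * (s + t) + d′) + β * c′) * ((c′ * (s + t) + d′) * t + - (c′ * (s * t)))
          + (β * (c′ * (s + t) + d′) + - (β * (s + t) + two * α * (s * t)) * c′) * ε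
        ≈⟨ solve 6 (λ α β c d s t → let a = c :* (s :+ t) :+ d ; ε = c :* t :+ d in
             (con (+ 2) :* α :* a :+ β :* c) :* (a :* t :+ :- (c :* (s :* t))) :+
                 (β :* a :+ :- (β :* (s :+ t) :+ con (+ 2) :* α :* (s :* t)) :* c) :* ε :=
             (ε :* ε) :* (β :+ con (+ 2) :* α :* t)) ≈-refl α β c′ d′ s t ⟩
      (ε * ε) * polar w ∎
      where
      open ≈-Reasoning
      α = fromℤ α₀
      β = fromℤ β₀
      γ = fromℤ γ₀
      A≈ : fromℤ (A (M ∘ w)) ≈ α * (a′ * a′) + β * (a′ * c′) + γ * (c′ * c′)
      A≈ = ≈-trans (fromℤ-+ (α₀ ℤ.* (a ℤ.* a) ℤ.+ β₀ ℤ.* (a ℤ.* c)) (γ₀ ℤ.* (c ℤ.* c))) (+-cong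
        (≈-trans (fromℤ-+ (α₀ ℤ.* (a ℤ.* a)) (β₀ ℤ.* (a ℤ.* c)))
          (+-cong (≈-trans (fromℤ-* α₀ (a ℤ.* a)) (*-congˡ (fromℤ-* a a)))
              (≈-trans (fromℤ-* β₀ (a ℤ.* c)) (*-congˡ (fromℤ-* a c)))))
        (≈-trans (fromℤ-* γ₀ (c ℤ.* c)) (*-congˡ (fromℤ-* c c))))
      B≈ : fromℤ (B (M ∘ w)) ≈ two * α * (a′ * b′) + β * (a′ * d′ + b′ * c′) + two * γ * (c′ * d′)
      B≈ = ≈-trans (fromℤ-+ (+ 2 ℤ.* α₀ ℤ.* (a ℤ.* b) ℤ.+ β₀ ℤ.* (a ℤ.* d ℤ.+ b ℤ.* c)) (+ 2 ℤ.* γ₀ ℤ.* (c ℤ.* d)))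
        (+-cong (≈-trans (fromℤ-+ (+ 2 ℤ.* α₀ ℤ.* (a ℤ.* b)) (β₀ ℤ.* (a ℤ.* d ℤ.+ b ℤ.* c)))
          (+-cong (≈-trans (fromℤ-* (+ 2 ℤ.* α₀) (a ℤ.* b)) (*-cong (fromℤ-* (+ 2) α₀) (fromℤ-* a b)))
            (≈-trans (fromℤ-* β₀ (a ℤ.* d ℤ.+ b ℤ.* c))
                (*-congˡ (≈-trans (fromℤ-+ (a ℤ.* d) (b ℤ.* c)) (+-cong (fromℤ-* a d) (fromℤ-* b c)))))))
          (≈-trans (fromℤ-* (+ 2 ℤ.* γ₀) (c ℤ.* d)) (*-cong (fromℤ-* (+ 2) γ₀) (fromℤ-* c d))))

    Q-action : ∀ w → B q ℤ.* B w ≡ + 2 ℤ.* (A w ℤ.* C q ℤ.+ A q ℤ.* C w) → Q (M ∘ w) ≈ ρ * Q w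
    Q-action w eq = ≈-trans (*-cong (polar-action w eq) (polar-action w eq))
      (solve 2 (λ e u → (e :* u) :* (e :* u) := (e :* e) :* (u :* u)) ≈-refl (ε * ε) (polar w))

    module Image {x y} (on : (x +i y) ∈ (s ⇝ t)) where
      open OnGeodesic on
      private
        x₁ = re (möbiusᶜ M (x +i y))
        w = c′ * x + d′
        num = (a′ * x + b′) * w + a′ * c′ * (y * y)

      N : Carrier
      N = w * w + (c′ * y) * (c′ * y)

      private
        N≈ : N ≈ w * w + (c′ * c′) * ((x - s) * (t - x))
        N≈ = +-congˡ (≈-trans (solve 2 (λ c y → (c :* y) :* (c :* y) := (c :* c) :* (y :* y)) ≈-refl c′ y)
            (*-congˡ y²≈))

        num≈ : num ≈ ((c′ * (s + t) + d′) * x + - (c′ * (s * t))) * w + (c′ * (s + t) + d′) * c′ *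
            ((x - s) * (t - x))
        num≈ = +-cong (*-congʳ (+-cong (*-congʳ a≈) b≈)) (*-cong (*-congʳ a≈) y²≈)

        source-identity : num - s * N ≈ (x - s) * (ε * ε)
        source-identity = ≈-trans (+-cong num≈ (-‿cong (*-congˡ N≈)))
          (solve 5 (λ c d s t x → let w = c :* x :+ d ; a = c :* (s :+ t) :+ d ; Y = (x :- s) :* (t :- x) in
            (a :* x :+ :- (c :* (s :* t))) :* w :+ a :* c :* Y :- s :* (w :* w :+ (c :* c) :* Y) :=
            (x :- s) :* ((c :* t :+ d) :* (c :* t :+ d))) ≈-refl c′ d′ s t x)

        target-identity : t * N - num ≈ (t - x) * (ε̄ * ε̄)
        target-identity = ≈-trans (+-cong (*-congˡ N≈) (-‿cong num≈))
          (solve 5 (λ c d s t x → let w = c :* x :+ d ; a = c :* (s :+ t) :+ d ; Y = (x :- s) :* (t :- x) in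
            t :* (w :* w :+ (c :* c) :* Y) :- ((a :* x :+ :- (c :* (s :* t))) :* w :+ a :* c :* Y) :=
            (t :- x) :* ((c :* s :+ d) :* (c :* s :+ d))) ≈-refl c′ d′ s t x)

      -- Adding the identities for the two ends cancels the numerator and expresses a positive
      -- multiple of `N` by positive terms, whether or not `c` vanishes.
      N>0 : 0# < N
      N>0 = *-pos-cancelˡ (sq-pos τ≉0) (pos-resp (begin
        fromSource x * (ε * ε) + toTarget x * (ε̄ * ε̄)
          ≈⟨ solve 5 (λ X T τ E F → X :* τ :* E :+ T :* τ :* F := τ :* (X :* E :+ T :* F)) ≈-refl (x - s)
              (t - x) τ (ε * ε) (ε̄ * ε̄) ⟩
        τ * ((x - s) * (ε * ε) + (t - x) * (ε̄ * ε̄))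
          ≈⟨ *-congˡ (+-cong (≈-sym source-identity) (≈-sym target-identity)) ⟩
        τ * ((num - s * N) + (t * N - num))
          ≈⟨ solve 4 (λ s t n N → (t :- s) :* ((n :- s :* N) :+ (t :* N :- n)) := ((t :- s) :* (t :- s)) :* N)
              ≈-refl s t num N ⟩
        (τ * τ) * N ∎)
        (pos-+ (*-pos fromSource>0 (sq-pos ε≉0)) (*-pos toTarget>0 (sq-pos ε̄≉0))))
        where open ≈-Reasoning

      private
        Nx₁ : N * x₁ ≈ num
        Nx₁ = divide num (pos⇒≉0 N>0)

      source-image : N * fromSource x₁ ≈ fromSource x * (ε * ε)
      source-image = begin
        N * ((x₁ - s) * τ)           ≈⟨ solve 4 (λ N x s τ → N :* ((x :- s) :* τ) := (N :* x :- s :* N) :* τ)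
            ≈-refl N x₁ s τ ⟩
        (N * x₁ - s * N) * τ         ≈⟨ *-congʳ (≈-trans (+-congʳ Nx₁) source-identity) ⟩
        (x - s) * (ε * ε) * τ        ≈⟨ solve 3 (λ x e τ → x :* e :* τ := x :* τ :* e) ≈-refl (x - s) (ε * ε) τ ⟩
        fromSource x * (ε * ε)       ∎
        where open ≈-Reasoning

      target-image : N * toTarget x₁ ≈ toTarget x * (ε̄ * ε̄)
      target-image = begin
        N * ((t - x₁) * τ)           ≈⟨ solve 4 (λ N x t τ → N :* ((t :- x) :* τ) := (t :* N :- N :* x) :* τ)
            ≈-refl N x₁ t τ ⟩
        (t * N - N * x₁) * τ         ≈⟨ *-congʳ (≈-trans (+-congˡ (-‿cong Nx₁)) target-identity) ⟩
        (t - x) * (ε̄ * ε̄) * τ       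
            ≈⟨ solve 3 (λ x e τ → x :* e :* τ := x :* τ :* e) ≈-refl (t - x) (ε̄ * ε̄) τ ⟩
        toTarget x * (ε̄ * ε̄)         ∎
        where open ≈-Reasoning

  module Order (g : Form) (crossing : Crossing g q) {x y} (m : Meeting.Meets g q x y) (on : (x +i y) ∈ (s ⇝ t)) where
    open Meeting g q
    open Meets m
    open OnGeodesic on

    private
      w = jac g q
      k = two * α
      K = (k * k) * toTarget x

      K>0 : 0# < K
      K>0 = *-pos (sq-pos (*-≉0 2≉0 (crossing⇒α≉0 crossing))) toTarget>0

      u≈ : polar w ≈ k * (t - x)
      u≈ = begin
        β + k * t              ≈⟨ +-congʳ (≈-trans (≈-sym (-‿involutive β)) (-‿cong (≈-sym (meets-x m)))) ⟩
        - (k * x) + k * t      ≈⟨ solve 3 (λ k x t → :- (k :* x) :+ k :* t := k :* (t :- x)) ≈-refl k x t ⟩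
        k * (t - x)            ∎
        where open ≈-Reasoning

      Δ≈′ : Δ g q ≈ (k * k) * ((x - s) * (t - x))
      Δ≈′ = ≈-trans (meets-Δ m) (≈-trans
          (solve 2 (λ k y → (k :* y) :* (k :* y) := (k :* k) :* (y :* y)) ≈-refl k y) (*-congˡ y²≈))

    Q>0 : 0# < Q w
    Q>0 = sq-pos (λ u≈0 → *-≉0 (*-≉0 2≉0 (crossing⇒α≉0 crossing)) (*-≉0ˡ (pos⇒≉0 toTarget>0))
        (≈-trans (≈-sym u≈) u≈0))

    -- A cross-multiplied comparison of the quotients `(t - x) / (x - s)` at two points, with
    -- `Q / Δ` standing for the quotient at the meeting point.
    offset : ∀ x₀ → K * ((x₀ - x) * τ) ≈ Q w * fromSource x₀ - Δ g q * toTarget x₀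
    offset x₀ = ≈-sym (≈-trans (+-cong (*-congʳ (*-cong u≈ u≈)) (-‿cong (*-congʳ Δ≈′)))
      (solve 5 (λ k s t x x₀ → (k :* (t :- x)) :* (k :* (t :- x)) :* ((x₀ :- s) :* (t :- s)) :- (k :* k) :*
          ((x :- s) :* (t :- x)) :* ((t :- x₀) :* (t :- s)) :=
        (k :* k) :* ((t :- x) :* (t :- s)) :* ((x₀ :- x) :* (t :- s))) ≈-refl k s t x x₀))

    after⇔ : ∀ x₀ → (0# < (x₀ - x) * τ) ⇔ (Δ g q * toTarget x₀ < Q w * fromSource x₀)
    after⇔ x₀ = mk⇔
      (λ h → 0<-⇒< (pos-resp (offset x₀) (*-pos K>0 h)))
      (λ h → *-pos-cancelˡ K>0 (pos-resp (≈-sym (offset x₀)) (<⇒0<- h)))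

  module Segment {M} (auto : Automorph q M) (1<ρ : 1# < Action.ρ auto) {x₀ y₀} (on₀ : (x₀ +i y₀) ∈ (s ⇝ t)) where
    open Action auto
    open Image on₀
    private
      module z = OnGeodesic on₀
      x₁ = re (möbiusᶜ M (x₀ +i y₀))

      ε²>0 : 0# < ε * ε
      ε²>0 = sq-pos ε≉0

      unit : (ε * ε) * (ε̄ * ε̄) ≈ 1#
      unit = ≈-trans (solve 2 (λ e f → (e :* e) :* (f :* f) := (e :* f) :* (e :* f)) ≈-refl ε ε̄)
        (≈-trans (*-cong εε̄≈1 εε̄≈1) (*-identityˡ 1#))

    scaled : ∀ D Q → (N * (ε * ε)) * (Q * fromSource x₁ - D * toTarget x₁) ≈ ρ * (Q * fromSource x₀) - D *
        toTarget x₀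
    scaled D Q = begin
      (N * (ε * ε)) * (Q * fromSource x₁ - D * toTarget x₁)
        ≈⟨ solve 6 (λ N e Q X D T → (N :* e) :* (Q :* X :- D :* T) := e :* (Q :* (N :* X)) :- e :*
            (D :* (N :* T))) ≈-refl N (ε * ε) Q (fromSource x₁) D (toTarget x₁) ⟩
      (ε * ε) * (Q * (N * fromSource x₁)) - (ε * ε) * (D * (N * toTarget x₁))
        ≈⟨ +-cong (*-congˡ (*-congˡ source-image)) (-‿cong (*-congˡ (*-congˡ target-image))) ⟩
      (ε * ε) * (Q * (fromSource x₀ * (ε * ε))) - (ε * ε) * (D * (toTarget x₀ * (ε̄ * ε̄)))
        ≈⟨ solve 6 (λ e f Q X D T → e :* (Q :* (X :* e)) :- e :* (D :* (T :* f)) := (e :* e) :* (Q :* X) :-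
            (e :* f) :* (D :* T)) ≈-refl (ε * ε) (ε̄ * ε̄) Q (fromSource x₀) D (toTarget x₀) ⟩
      ρ * (Q * fromSource x₀) - ((ε * ε) * (ε̄ * ε̄)) * (D * toTarget x₀)
        ≈⟨ +-congˡ (-‿cong (≈-trans (*-congʳ unit) (*-identityˡ _))) ⟩
      ρ * (Q * fromSource x₀) - D * toTarget x₀ ∎
      where open ≈-Reasoning

    N′>0 : 0# < N * (ε * ε)
    N′>0 = *-pos N>0 ε²>0

    -- The identity `scaled` is applied with the base point's own quotient instead of that of a
    -- meeting point; `ρ > 1` then says that the image is nearer to the target.
    advances : 0# < (x₁ - x₀) * τ
    advances = *-pos-cancelˡ (sq-pos τ≉0) (*-pos-cancelˡ N′>0 (pos-resp (begin
      (ρ - 1#) * (toTarget x₀ * fromSource x₀)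
        ≈⟨ ≈-trans (*-congʳ (+-congˡ (-‿cong (≈-sym fromℤ-1))))
            (solve 3 (λ ρ T X → (ρ :- con 1ℤ) :* (T :* X) := ρ :* (T :* X) :- X :* T) ≈-refl ρ (toTarget x₀)
            (fromSource x₀)) ⟩
      ρ * (toTarget x₀ * fromSource x₀) - fromSource x₀ * toTarget x₀
        ≈⟨ scaled (fromSource x₀) (toTarget x₀) ⟨
      (N * (ε * ε)) * (toTarget x₀ * fromSource x₁ - fromSource x₀ * toTarget x₁)
        ≈⟨ *-congˡ (solve 4 (λ s t x₀ x₁ → ((t :- x₀) :* (t :- s)) :* ((x₁ :- s) :* (t :- s)) :-
            ((x₀ :- s) :* (t :- s)) :* ((t :- x₁) :* (t :- s)) :=
             ((t :- s) :* (t :- s)) :* ((x₁ :- x₀) :* (t :- s))) ≈-refl s t x₀ x₁) ⟩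
      (N * (ε * ε)) * ((τ * τ) * ((x₁ - x₀) * τ)) ∎)
      (*-pos (<⇒0<- 1<ρ) (*-pos z.toTarget>0 z.fromSource>0))))
      where open ≈-Reasoning

    private
      -- Comparisons along the geodesic, which may run in either direction.
      τ-sign : (0# < τ × ∀ {a b} → (0# < (a - b) * τ) ⇔ (b < a)) ⊎ (τ < 0# × ∀ {a b} → (0# < (a - b) * τ) ⇔ (a < b))
      τ-sign with compare 0# τ
      ... | tri< 0<τ _ _ = inj₁ (0<τ , mk⇔ (λ h → 0<-⇒< (*-pos-cancelˡ 0<τ (pos-resp (*-comm _ _) h)))
          (λ h → *-pos (<⇒0<- h) 0<τ))
      ... | tri≈ _ 0≈τ _ = contradiction (≈-sym 0≈τ) τ≉0
      ... | tri> _ _ τ<0 = inj₂ (τ<0 , mk⇔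
        (λ h → 0<-⇒< (*-pos-cancelˡ (neg-pos τ<0) (pos-resp (flip _ _) h)))
        (λ h → pos-resp (≈-sym (flip _ _)) (*-pos (neg-pos τ<0) (<⇒0<- h))))
        where
        flip : ∀ a b → (a - b) * τ ≈ - τ * (b - a)
        flip a b = solve 3 (λ a b τ → (a :- b) :* τ := :- τ :* (b :- a)) ≈-refl a b τ

      ≮⇒≤ : ∀ {a b} → ¬ (b < a) → a ≤ b
      ≮⇒≤ {a} {b} h with compare a b
      ... | tri< a<b _ _ = inj₁ a<b
      ... | tri≈ _ a≈b _ = inj₂ a≈b
      ... | tri> _ _ b<a = contradiction b<a h

      ≤⇒≮ : ∀ {a b} → a ≤ b → ¬ (b < a)
      ≤⇒≮ (inj₁ a<b) b<a = <-asym a<b b<a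
      ≤⇒≮ (inj₂ a≈b) b<a = <-irrefl (≈-sym a≈b) b<a

    Between : Carrier → Set _
    Between x = (x₀ ≤ x × x < x₁) ⊎ (x₁ < x × x ≤ x₀)

    between⇒ : ∀ {x} → Between x → ¬ (0# < (x₀ - x) * τ) × 0# < (x₁ - x) * τ
    between⇒ {x} h with τ-sign | h
    ... | inj₁ (_ , e) | inj₁ (x₀≤x , x<x₁) = (λ k → ≤⇒≮ x₀≤x (Equivalence.to e k)) , Equivalence.from e x<x₁
    ... | inj₂ (_ , e) | inj₂ (x₁<x , x≤x₀) = (λ k → ≤⇒≮ x≤x₀ (Equivalence.to e k)) , Equivalence.from e x₁<x
    ... | inj₁ (_ , e) | inj₂ (x₁<x , x≤x₀) = contradiction (<-trans (Equivalence.to e advances) x₁<x) (≤⇒≮ x≤x₀)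
    ... | inj₂ (_ , e) | inj₁ (x₀≤x , x<x₁) = contradiction (<-trans x<x₁ (Equivalence.to e advances)) (≤⇒≮ x₀≤x)

    ⇒between : ∀ {x} → ¬ (0# < (x₀ - x) * τ) → 0# < (x₁ - x) * τ → Between x
    ⇒between {x} h k with τ-sign
    ... | inj₁ (_ , e) = inj₁ (≮⇒≤ (λ l → h (Equivalence.from e l)) , Equivalence.to e k)
    ... | inj₂ (_ , e) = inj₂ (Equivalence.to e k , ≮⇒≤ (λ l → h (Equivalence.from e l)))

    module _ (g : Form) (crossing : Crossing g q) {x y} (m : Meeting.Meets g q x y) (on : (x +i y) ∈ (s ⇝ t)) where
      open Order g crossing m on
      private
        D = Δ g q
        Q′ = Q (jac g q)

        scaled⇔ : (D * toTarget x₁ < Q′ * fromSource x₁) ⇔ (D * toTarget x₀ < ρ * (Q′ * fromSource x₀))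
        scaled⇔ = mk⇔
          (λ h → 0<-⇒< (pos-resp (scaled D Q′) (*-pos N′>0 (<⇒0<- h))))
          (λ h → 0<-⇒< (*-pos-cancelˡ N′>0 (pos-resp (≈-sym (scaled D Q′)) (<⇒0<- h))))

      -- Lying at or beyond the start is `after⇔` at `x₀`. Lying before the end is `after⇔` at `x₁`,
      -- which `scaled` pulls back to `x₀` at the cost of the factor `ρ`.
      between⇔window : Between x ⇔ InWindow ρ (D * toTarget x₀) (Q′ * fromSource x₀)
      between⇔window = mk⇔
        (λ h → let low , high = between⇒ h in
          (λ k → low (Equivalence.from (after⇔ x₀) k)) , Equivalence.to scaled⇔ (Equivalence.to (after⇔ x₁) high))
        (λ (low , high) → ⇒between (λ k → low (Equivalence.to (after⇔ x₀) k))
          (Equivalence.from (after⇔ x₁) (Equivalence.from scaled⇔ high)))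

-- Automorphs, Pell's equation and minimality.

module Stabilizer where
  open FormAction
  open Signs
  open SignPatterns
  open import Data.Integer.Base using (_+_; _*_; _-_; -_)

  *-cancelˡ : ∀ k {i j} → k ≢ 0ℤ → k * i ≡ k * j → i ≡ j
  *-cancelˡ k {i} {j} k≢0 = ℤₚ.*-cancelˡ-≡ k i j {{ℤ.≢-nonZero k≢0}}

  bézout : ∀ i j → ∃[ x ] ∃[ y ] x * i + y * j ≡ gcd i j
  bézout i j with signed i | signed j
    where
    signed : ∀ i → ∃[ s ] + ℤ.∣ i ∣ ≡ s * i
    signed i with ℤₚ.+∣i∣≡i⊎+∣i∣≡-i i
    ... | inj₁ eq = 1ℤ , trans eq (sym (ℤₚ.*-identityˡ i))
    ... | inj₂ eq = -1ℤ , trans eq (sym (ℤₚ.-1*i≡-i i))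
  ... | s , sᵉ | s′ , s′ᵉ with ℕᵍ.Bézout.identity (ℕᵍ.gcd-GCD ℤ.∣ i ∣ ℤ.∣ j ∣)
  ...   | ℕᵍ.Bézout.+- x y eq = + x * s , - (+ y * s′) , trans (rearrange (+ x) (+ y) s s′ i j)
            (trans (cong₂ (λ k l → + x * k - + y * l) (sym sᵉ) (sym s′ᵉ))
                (trans (cong₂ _-_ (sym (ℤₚ.pos-* x _)) (sym (ℤₚ.pos-* y _)))
              (trans (cong (λ k → + k - + (y ℕ.* ℤ.∣ j ∣)) (sym eq))
                  (difference (ℕᵍ.gcd ℤ.∣ i ∣ ℤ.∣ j ∣) (y ℕ.* ℤ.∣ j ∣)))))
    where
    rearrange : ∀ x y s s′ i j → x * s * i + - (y * s′) * j ≡ x * (s * i) - y * (s′ * j)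
    rearrange = solve-∀
    difference : ∀ m n → + (m ℕ.+ n) - + n ≡ + m
    difference m n = eq′ (+ m) (+ n)
      where
      eq′ : ∀ m n → m + n - n ≡ m
      eq′ = solve-∀
  ...   | ℕᵍ.Bézout.-+ x y eq = - (+ x * s) , + y * s′ , trans (rearrange (+ x) (+ y) s s′ i j)
            (trans (cong₂ (λ k l → + y * l - + x * k) (sym sᵉ) (sym s′ᵉ))
                (trans (cong₂ _-_ (sym (ℤₚ.pos-* y _)) (sym (ℤₚ.pos-* x _)))
              (trans (cong (λ k → + k - + (x ℕ.* ℤ.∣ i ∣)) (sym eq))
                  (difference (ℕᵍ.gcd ℤ.∣ i ∣ ℤ.∣ j ∣) (x ℕ.* ℤ.∣ i ∣)))))
    where
    rearrange : ∀ x y s s′ i j → - (x * s) * i + y * s′ * j ≡ y * (s′ * j) - x * (s * i)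
    rearrange = solve-∀
    difference : ∀ m n → + (m ℕ.+ n) - + n ≡ + m
    difference m n = eq′ (+ m) (+ n)
      where
      eq′ : ∀ m n → m + n - n ≡ m
      eq′ = solve-∀

  bézout₃ : ∀ A B C → gcd (gcd A B) C ≡ 1ℤ → ∃[ x ] ∃[ y ] ∃[ z ] x * A + y * B + z * C ≡ 1ℤ
  bézout₃ A B C coprime = combine (bézout A B) (bézout (gcd A B) C)
    where
    combine : (∃[ x ] ∃[ y ] x * A + y * B ≡ gcd A B) → (∃[ x ] ∃[ y ] x * gcd A B + y * C ≡ gcd (gcd A B) C) →
              ∃[ x ] ∃[ y ] ∃[ z ] x * A + y * B + z * C ≡ 1ℤ
    combine (x , y , eq) (k , z , eq′) = k * x , k * y , z ,
      trans (e k x y z A B C) (trans (cong (λ g → k * g + z * C) eq) (trans eq′ coprime))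
      where
      e : ∀ k x y z A B C → k * x * A + k * y * B + z * C ≡ k * (x * A + y * B) + z * C
      e = solve-∀

  -- Invariance makes (c , d − a , −b) proportional to (A , B , C), and
  -- primitivity makes the factor of proportionality an integer.
  stabilizer : ∀ M q → gcd (gcd (Form.A q) (Form.B q)) (Form.C q) ≡ 1ℤ → det M ≡ 1ℤ → M ∘ q ≡ q → Automorph q M
  stabilizer (mat a b c d) [ A , B , C ] coprime det≡1 fixed = build (bézout₃ A B C coprime)
    where
    M = mat a b c d
    q = [ A , B , C ]
    E₁ : A * (a * a) + B * (a * c) + C * (c * c) ≡ A
    E₁ = cong Form.A fixed
    E₂ : + 2 * A * (a * b) + B * (a * d + b * c) + + 2 * C * (c * d) ≡ B
    E₂ = cong Form.B fixed
    E₃ : A * (b * b) + B * (b * d) + C * (d * d) ≡ C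
    E₃ = cong Form.C fixed
    -- Multiplication by the adjugate matrix turns the invariance, quadratic in the entries, into
    -- three linear equations.
    i₁ : ∀ a b c d A B C → (+ 2 * A * a + B * c) * (a * d - b * c) ≡
      + 2 * d * (A * (a * a) + B * (a * c) + C * (c * c)) - c *
          (+ 2 * A * (a * b) + B * (a * d + b * c) + + 2 * C * (c * d))
    i₁ = solve-∀
    i₂ : ∀ a b c d A B C → (+ 2 * A * b + B * d) * (a * d - b * c) ≡
      d * (+ 2 * A * (a * b) + B * (a * d + b * c) + + 2 * C * (c * d)) - + 2 * c *
          (A * (b * b) + B * (b * d) + C * (d * d))
    i₂ = solve-∀
    i₃ : ∀ a b c d A B C → (B * b + + 2 * C * d) * (a * d - b * c) ≡
      + 2 * a * (A * (b * b) + B * (b * d) + C * (d * d)) - b *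
          (+ 2 * A * (a * b) + B * (a * d + b * c) + + 2 * C * (c * d))
    i₃ = solve-∀
    det-out : ∀ {k l} → k * (a * d - b * c) ≡ l → k ≡ l
    det-out {k} h = trans (sym (ℤₚ.*-identityʳ k)) (trans (cong (k *_) (sym det≡1)) h)
    j₁ : + 2 * A * a + B * c ≡ + 2 * d * A - c * B
    j₁ = det-out (trans (i₁ a b c d A B C) (cong₂ (λ k l → + 2 * d * k - c * l) E₁ E₂))
    j₂ : + 2 * A * b + B * d ≡ d * B - + 2 * c * C
    j₂ = det-out (trans (i₂ a b c d A B C) (cong₂ (λ k l → d * k - + 2 * c * l) E₂ E₃))
    j₃ : B * b + + 2 * C * d ≡ + 2 * a * C - b * B
    j₃ = det-out (trans (i₃ a b c d A B C) (cong₂ (λ k l → + 2 * a * k - b * l) E₃ E₂))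
    2≢0 : + 2 ≢ 0ℤ
    2≢0 ()
    p₁ : A * (d - a) ≡ B * c
    p₁ = *-cancelˡ (+ 2) 2≢0 (trans (k₁ A a B c d) (trans (cong (_- (+ 2 * A * a - B * c)) (sym j₁)) (k₂ A a B c)))
      where
      k₁ : ∀ A a B c d → + 2 * (A * (d - a)) ≡ + 2 * d * A - c * B - (+ 2 * A * a - B * c)
      k₁ = solve-∀
      k₂ : ∀ A a B c → + 2 * A * a + B * c - (+ 2 * A * a - B * c) ≡ + 2 * (B * c)
      k₂ = solve-∀
    p₂ : A * b ≡ - (C * c)
    p₂ = *-cancelˡ (+ 2) 2≢0 (trans (k₁ A b B d) (trans (cong (_- B * d) j₂) (k₂ B c C d)))
      where
      k₁ : ∀ A b B d → + 2 * (A * b) ≡ + 2 * A * b + B * d - B * d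
      k₁ = solve-∀
      k₂ : ∀ B c C d → d * B - + 2 * c * C - B * d ≡ + 2 * - (C * c)
      k₂ = solve-∀
    p₃ : B * b ≡ - (C * (d - a))
    p₃ = *-cancelˡ (+ 2) 2≢0 (trans (k₁ B b C d) (trans (cong (λ k → k + b * B - + 2 * C * d) j₃) (k₂ a b B C d)))
      where
      k₁ : ∀ B b C d → + 2 * (B * b) ≡ B * b + + 2 * C * d + b * B - + 2 * C * d
      k₁ = solve-∀
      k₂ : ∀ a b B C d → + 2 * a * C - b * B + b * B - + 2 * C * d ≡ + 2 * - (C * (d - a))
      k₂ = solve-∀
    p₂′ : - (A * b) ≡ C * c
    p₂′ = trans (cong -_ p₂) (ℤₚ.neg-involutive (C * c))
    p₃′ : - (B * b) ≡ C * (d - a)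
    p₃′ = trans (cong -_ p₃) (ℤₚ.neg-involutive (C * (d - a)))
    u₁ : ∀ x y z A b c d a → A * (x * c + y * (d - a) - z * b) ≡ x * (A * c) + y * (A * (d - a)) - z * (A * b)
    u₁ = solve-∀
    u₂ : ∀ x y z A B C c → x * (A * c) + y * (B * c) - z * - (C * c) ≡ (x * A + y * B + z * C) * c
    u₂ = solve-∀
    u₃ : ∀ x y z B b c d a → B * (x * c + y * (d - a) - z * b) ≡ x * (B * c) + y * (B * (d - a)) - z * (B * b)
    u₃ = solve-∀
    u₄ : ∀ x y z A B C e → x * (A * e) + y * (B * e) - z * - (C * e) ≡ (x * A + y * B + z * C) * e
    u₄ = solve-∀
    u₅ : ∀ x y z C b c d a → - (C * (x * c + y * (d - a) - z * b)) ≡ x * - (C * c) + y * - (C * (d - a)) + z *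
        (C * b)
    u₅ = solve-∀
    u₆ : ∀ x y z A B C b → x * (A * b) + y * (B * b) + z * (C * b) ≡ (x * A + y * B + z * C) * b
    u₆ = solve-∀
    build : ∃[ x ] ∃[ y ] ∃[ z ] x * A + y * B + z * C ≡ 1ℤ → Automorph q M
    build (x , y , z , eq) = record
      { U     = x * c + y * (d - a) - z * b
      ; det≡1 = det≡1
      ; c≡    = sym (trans (u₁ x y z A b c d a)
          (trans (cong₂ (λ k l → x * (A * c) + y * k - z * l) p₁ p₂)
          (trans (u₂ x y z A B C c) (trans (cong (_* c) eq) (ℤₚ.*-identityˡ c)))))
      ; d-a≡  = sym (trans (u₃ x y z B b c d a)
          (trans (cong₂ (λ k l → x * k + y * (B * (d - a)) - z * l) (sym p₁) p₃)
          (trans (u₄ x y z A B C (d - a)) (trans (cong (_* (d - a)) eq) (ℤₚ.*-identityˡ (d - a))))))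
      ; b≡    = sym (trans (u₅ x y z C b c d a)
          (trans (cong₂ (λ k l → x * k + y * l + z * (C * b))
          (trans (cong -_ (sym p₂′)) (ℤₚ.neg-involutive (A * b)))
          (trans (cong -_ (sym p₃′)) (ℤₚ.neg-involutive (B * b))))
          (trans (u₆ x y z A B C b) (trans (cong (_* b) eq) (ℤₚ.*-identityˡ b)))))
      }

  automorph-fixes : ∀ {M q} → Automorph q M → M ∘ q ≡ q
  automorph-fixes {mat a b c d} {[ A , B , C ]} auto = form-≡
    (substituted (λ b c d → A * (a * a) + B * (a * c) + C * (c * c)) A (eᴬ a A B C U))
    (substituted (λ b c d → + 2 * A * (a * b) + B * (a * d + b * c) + + 2 * C * (c * d)) B (eᴮ a A B C U))
    (substituted (λ b c d → A * (b * b) + B * (b * d) + C * (d * d)) C (eᶜ a A B C U))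
    where
    open Automorph auto
    d≡ : d ≡ a + B * U
    d≡ = trans (e a d) (cong (λ k → a + k) d-a≡)
      where
      e : ∀ a d → d ≡ a + (d - a)
      e = solve-∀
    b′ = - (C * U)
    c′ = A * U
    d′ = a + B * U
    substituted : (f : ℤ → ℤ → ℤ → ℤ) → ∀ X → f b′ c′ d′ ≡ X * (a * d′ - b′ * c′) → f b c d ≡ X
    substituted f X eq = begin
      f b c d                   ≡⟨ cong₂ (λ b c → f b c d) b≡ c≡ ⟩
      f b′ c′ d                 ≡⟨ cong (f b′ c′) d≡ ⟩
      f b′ c′ d′                ≡⟨ eq ⟩
      X * (a * d′ - b′ * c′)    ≡⟨ cong₂ (λ b c → X * (a * d′ - b * c)) b≡ c≡ ⟨
      X * (a * d′ - b * c)      ≡⟨ cong (λ d → X * (a * d - b * c)) d≡ ⟨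
      X * (a * d - b * c)       ≡⟨ cong (X *_) det≡1 ⟩
      X * 1ℤ                    ≡⟨ ℤₚ.*-identityʳ X ⟩
      X                         ∎
      where open ≡-Reasoning
    eᴬ : ∀ a A B C U → A * (a * a) + B * (a * (A * U)) + C * (A * U * (A * U)) ≡ A *
        (a * (a + B * U) - - (C * U) * (A * U))
    eᴬ = solve-∀
    eᴮ : ∀ a A B C U → + 2 * A * (a * - (C * U)) + B * (a * (a + B * U) + - (C * U) * (A * U)) + + 2 * C *
        (A * U * (a + B * U)) ≡ B * (a * (a + B * U) - - (C * U) * (A * U))
    eᴮ = solve-∀
    eᶜ : ∀ a A B C U → A * (- (C * U) * - (C * U)) + B * (- (C * U) * (a + B * U)) + C *
        ((a + B * U) * (a + B * U)) ≡ C * (a * (a + B * U) - - (C * U) * (A * U))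
    eᶜ = solve-∀

  trace : Matrix → ℤ
  trace (mat a b c d) = a + d

  automorph-pell : ∀ {M q} (auto : Automorph q M) → let U = Automorph.U auto in
                   trace M * trace M - disc q * (U * U) ≡ + 4
  automorph-pell {mat a b c d} {[ A , B , C ]} auto = begin
    (a + d) * (a + d) - (B * B - + 4 * A * C) * (U * U)
      ≡⟨ e₁ a d A B C U ⟩
    (a + d) * (a + d) - (B * U) * (B * U) - + 4 * (A * U * - (C * U))
      ≡⟨ cong₂ (λ x y → (a + d) * (a + d) - x * x - + 4 * y) (sym d-a≡) (cong₂ _*_ (sym c≡) (sym b≡)) ⟩
    (a + d) * (a + d) - (d - a) * (d - a) - + 4 * (c * b)
      ≡⟨ e₂ a b c d ⟩
    + 4 * (a * d - b * c)
      ≡⟨ cong (+ 4 *_) det≡1 ⟩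
    + 4 ∎
    where
    open ≡-Reasoning
    open Automorph auto
    e₁ : ∀ a d A B C U → (a + d) * (a + d) - (B * B - + 4 * A * C) * (U * U) ≡ (a + d) * (a + d) - (B * U) *
        (B * U) - + 4 * (A * U * - (C * U))
    e₁ = solve-∀
    e₂ : ∀ a b c d → (a + d) * (a + d) - (d - a) * (d - a) - + 4 * (c * b) ≡ + 4 * (a * d - b * c)
    e₂ = solve-∀

  1≢2* : ∀ n → 1ℤ ≢ n * + 2
  1≢2* n eq with () ← ℕₚ.m*n≡1⇒n≡1 ℤ.∣ n ∣ 2 (trans (sym (ℤₚ.abs-* n (+ 2))) (cong ℤ.∣_∣ (sym eq)))

  parity : ∀ i → i ≡ (i ℤ./ℕ 2) * + 2 ⊎ i ≡ 1ℤ + (i ℤ./ℕ 2) * + 2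
  parity i with i ℤ.%ℕ 2 | ℤᵈ.a≡a%ℕn+[a/ℕn]*n i 2 | ℤᵈ.n%ℕd<d i 2
  ... | 0 | eq | _ = inj₁ (trans eq (ℤₚ.+-identityˡ _))
  ... | 1 | eq | _ = inj₂ eq
  ... | ℕ.suc (ℕ.suc _) | _ | ℕ.s≤s (ℕ.s≤s ())

  halve : ∀ i j → i ≡ j * + 2 → (i ℤ./ℕ 2) * + 2 ≡ i
  halve i j eq with parity i
  ... | inj₁ eq′ = sym eq′
  ... | inj₂ eq′ = contradiction
      (trans (e (i ℤ./ℕ 2)) (trans (cong (_- (i ℤ./ℕ 2) * + 2) (trans (sym eq′) eq)) (e′ j (i ℤ./ℕ 2))))
      (1≢2* (j - (i ℤ./ℕ 2)))
    where
    e : ∀ h → 1ℤ ≡ 1ℤ + h * + 2 - h * + 2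
    e = solve-∀
    e′ : ∀ j h → j * + 2 - h * + 2 ≡ (j - h) * + 2
    e′ = solve-∀

  module _ (q : PIBQF) (s : SmallestPellSolution (PIBQF.D q)) where
    open PIBQF q using (form; A; B; C)
    open SmallestPellSolution s
    open PellSolution solution
    private
      a = (t - B * u) ℤ./ℕ 2
      d = (t + B * u) ℤ./ℕ 2

      -- `(t - Bu)(t + Bu) = 4 - 4ACu²` is even, while its factors have equal parity; so both
      -- halvings in `automorph` are exact.
      even : ∃[ j ] t - B * u ≡ j * + 2
      even with parity (t - B * u)
      ... | inj₁ eq = a , eq
      ... | inj₂ eq = contradiction
          (trans (f₁ t u A B C a) (trans
              (cong₂ (λ x k → k - + 4 * A * C * (u * u) - ((t - B * u) * (x + + 2 * (B * u)) - 1ℤ)) eq pell)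
            (trans (cong (λ x → + 4 - + 4 * A * C * (u * u) - (x * (1ℤ + a * + 2 + + 2 * (B * u)) - 1ℤ)) eq)
                (f₂ u A B C a))))
          (1≢2* (+ 2 - + 2 * A * C * (u * u) - (a * (1ℤ + a * + 2 + + 2 * (B * u)) + a + B * u)))
        where
        f₁ : ∀ t u A B C a → 1ℤ ≡ t * t - (B * B - + 4 * A * C) * (u * u) - + 4 * A * C * (u * u)
            - ((t - B * u) * (t - B * u + + 2 * (B * u)) - 1ℤ)
        f₁ = solve-∀
        f₂ : ∀ u A B C a → + 4 - + 4 * A * C * (u * u) - ((1ℤ + a * + 2) * (1ℤ + a * + 2 + + 2 * (B * u)) - 1ℤ) ≡
             (+ 2 - + 2 * A * C * (u * u) - (a * (1ℤ + a * + 2 + + 2 * (B * u)) + a + B * u)) * + 2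
        f₂ = solve-∀

      2a : a * + 2 ≡ t - B * u
      2a = halve (t - B * u) (proj₁ even) (proj₂ even)

      2d : d * + 2 ≡ t + B * u
      2d = halve (t + B * u) (a + B * u)
          (trans (f t u B) (trans (cong (_+ (B * u) * + 2) (sym 2a)) (sym (ℤₚ.*-distribʳ-+ (+ 2) a (B * u)))))
        where
        f : ∀ t u B → t + B * u ≡ t - B * u + B * u * + 2
        f = solve-∀

    pell-automorph : Automorph form (automorph q s)
    pell-automorph = record
      { U     = u
      ; det≡1 = *-cancelˡ (+ 4) (λ ())
          (trans (e₁ a d A C u) (trans (cong₂ (λ x y → x * y + + 4 * A * C * (u * u)) 2a 2d)
          (trans (e₂ t u A B C) pell)))
      ; c≡    = refl
      ; d-a≡  = *-cancelˡ (+ 2) (λ ()) (trans (e₃ a d) (trans (cong₂ _-_ 2d 2a) (e₄ t u B)))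
      ; b≡    = refl
      }
      where
      e₁ : ∀ a d A C u → + 4 * (a * d - - (C * u) * (A * u)) ≡ (a * + 2) * (d * + 2) + + 4 * A * C * (u * u)
      e₁ = solve-∀
      e₂ : ∀ t u A B C → (t - B * u) * (t + B * u) + + 4 * A * C * (u * u) ≡ t * t - (B * B - + 4 * A * C) * (u * u)
      e₂ = solve-∀
      e₃ : ∀ a d → + 2 * (d - a) ≡ d * + 2 - a * + 2
      e₃ = solve-∀
      e₄ : ∀ t u B → t + B * u - (t - B * u) ≡ + 2 * (B * u)
      e₄ = solve-∀

    pell-trace : trace (automorph q s) ≡ t
    pell-trace = *-cancelˡ (+ 2) (λ ()) (trans (e₁ a d) (trans (cong₂ _+_ 2a 2d) (e₂ t (B * u))))
      where
      e₁ : ∀ a d → + 2 * (a + d) ≡ a * + 2 + d * + 2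
      e₁ = solve-∀
      e₂ : ∀ t x → t - x + (t + x) ≡ + 2 * t
      e₂ = solve-∀

module Eigenvalues {r ℓ₁ ℓ₂} (ℝ : RealField r ℓ₁ ℓ₂) (q : PIBQF) where
  open FormAction
  open Signs
  open SignPatterns
  open OrderedField ℝ
  open Roots ℝ
  open Circles ℝ using (coeff)
  open Stabilizer
  open PIBQF q using (form; D; D>0; nonsquare)

  σ : Carrier
  σ = √ (fromℤ D)

  0<σ : 0# < σ
  0<σ = √-pos (fromℤ-pos D>0)

  σ² : σ * σ ≈ fromℤ D
  σ² = √-square (fromℤ-pos D>0)

  open Positions ℝ form (A≢0 {form} nonsquare) 0<σ (vieta form (A≢0 {form} nonsquare) σ²) public

  private
    two = fromℤ (+ 2)

    nonneg : ∀ {i} → 0ℤ ℤ.≤ i → ¬ (fromℤ i < 0#)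
    nonneg {+ ℕ.zero}  _ = <-irrefl ≈-refl
    nonneg {+ ℕ.suc n} _ = <-asym (fromℤ-pos {+ ℕ.suc n} (ℤ.+<+ (ℕ.s≤s ℕ.z≤n)))

    nonneg-+ : ∀ {x y} → ¬ (x < 0#) → ¬ (y < 0#) → ¬ (x + y < 0#)
    nonneg-+ {x} {y} 0≤x 0≤y h with compare x 0#
    ... | tri< x<0 _ _ = 0≤x x<0
    ... | tri≈ _ x≈0 _ = 0≤y (<-respˡ (≈-trans (+-congʳ x≈0) (+-identityˡ y)) h)
    ... | tri> _ _ 0<x = 0≤y (neg-pos⁻¹
        (pos-resp (solve 2 (λ x y → :- (x :+ y) :+ x := :- y) ≈-refl x y) (pos-+ (neg-pos h) 0<x)))

    nonneg-* : ∀ {x y} → ¬ (x < 0#) → 0# < y → ¬ (x * y < 0#)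
    nonneg-* {x} {y} 0≤x 0<y h = 0≤x
        (neg-pos⁻¹ (*-pos-cancelˡ 0<y (pos-resp (solve 2 (λ x y → :- (x :* y) := y :* :- x) ≈-refl x y)
        (neg-pos h))))

  module Generator (S : SmallestPellSolution D) where
    open SmallestPellSolution S
    open PellSolution solution
    open Action (pell-automorph q S) using (ε; ε̄; ρ; εε̄≈1; 2ε≈; 2ε̄≈)

    private
      T′ = fromℤ t
      U′ = fromℤ u
      0<T = fromℤ-pos t>0
      0<U = fromℤ-pos u>0

      2ε : two * ε ≈ T′ + U′ * σ
      2ε = ≈-trans 2ε≈ (+-congʳ (fromℤ-cong (pell-trace q S)))

      2ε̄ : two * ε̄ ≈ T′ - U′ * σ
      2ε̄ = ≈-trans 2ε̄≈ (+-congʳ (fromℤ-cong (pell-trace q S)))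

      0<2ε : 0# < T′ + U′ * σ
      0<2ε = pos-+ 0<T (*-pos 0<U 0<σ)

      0<ε : 0# < ε
      0<ε = *-pos-cancelˡ (fromℤ-pos 0<2) (pos-resp (≈-sym 2ε) 0<2ε)

      ε̄<ε : 0# < ε - ε̄
      ε̄<ε = *-pos-cancelˡ (fromℤ-pos 0<2) (pos-resp
        (≈-trans (solve 2 (λ T x → con (+ 2) :* x := (T :+ x) :- (T :- x)) ≈-refl T′ (U′ * σ))
          (≈-trans (+-cong (≈-sym 2ε) (-‿cong (≈-sym 2ε̄)))
              (solve 3 (λ k e f → k :* e :- k :* f := k :* (e :- f)) ≈-refl two ε ε̄)))
        (*-pos (fromℤ-pos 0<2) (*-pos 0<U 0<σ)))

    ρ>1 : 1# < ρ
    ρ>1 = 0<-⇒< (pos-resp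
      (≈-trans (solve 2 (λ e o → (e :* e :- o) :* (e :* e :+ o) := (e :* e) :* (e :* e) :- o :* o) ≈-refl ε 1#)
          (+-congˡ (-‿cong (*-identityˡ 1#))))
      (*-pos (pos-resp (≈-trans (solve 2 (λ e f → e :* (e :- f) := e :* e :- e :* f) ≈-refl ε ε̄)
          (+-congˡ (-‿cong εε̄≈1))) (*-pos 0<ε ε̄<ε))
        (pos-+ (*-pos 0<ε 0<ε) 0<1)))

    fourth-powers : ∀ {x T₁ U₁} → two * x * (two * x) ≈ (fromℤ T₁ + fromℤ U₁ * σ) * (fromℤ T₁ + fromℤ U₁ * σ) →
                    PellSolution D T₁ U₁ → ¬ ((x * x) * (x * x) < ρ)
    fourth-powers {x} {T₁} {U₁} eq pell₁ h = f≮e (square-<⁻¹ 0<f 0<2ε (<-respˡ eq (<-respʳ (*-cong 2ε 2ε) 2x²<2ε²)))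
      where
      f = fromℤ T₁ + fromℤ U₁ * σ
      0<f : 0# < f
      0<f = pos-+ (fromℤ-pos (PellSolution.t>0 pell₁)) (*-pos (fromℤ-pos (PellSolution.u>0 pell₁)) 0<σ)
      x≉0 : x ≉ 0#
      x≉0 x≈0 = *-≉0 (pos⇒≉0 0<f) (pos⇒≉0 0<f)
          (≈-trans (≈-sym eq) (≈-trans (*-congˡ (≈-trans (*-congˡ x≈0) (zeroʳ two))) (zeroʳ _)))
      x²<ε² : x * x < ε * ε
      x²<ε² = square-<⁻¹ (sq-pos x≉0) (*-pos 0<ε 0<ε) h
      2x²<2ε² : two * x * (two * x) < two * ε * (two * ε)
      2x²<2ε² = 0<-⇒< (pos-resp (solve 3
          (λ k e x → k :* k :* (e :* e :- x :* x) := k :* e :* (k :* e) :- k :* x :* (k :* x)) ≈-refl two ε x)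
        (*-pos (sq-pos 2≉0) (<⇒0<- x²<ε²)))
      f≮e : ¬ (f < T′ + U′ * σ)
      f≮e f<e = nonneg-+ (nonneg (ℤₚ.i≤j⇒0≤j-i (proj₁ (smallest pell₁))))
          (nonneg-* (nonneg (ℤₚ.i≤j⇒0≤j-i (proj₂ (smallest pell₁)))) 0<σ)
        (<-respˡ (≈-trans (solve 5 (λ T U T₁ U₁ σ → (T₁ :+ U₁ :* σ) :- (T :+ U :* σ) := (T₁ :- T) :+ (U₁ :- U)
            :* σ) ≈-refl T′ U′ (fromℤ T₁) (fromℤ U₁) σ)
            (+-cong (difference T₁ t) (*-congʳ (difference U₁ u))))
          (neg-pos⁻¹ (pos-resp (solve 2 (λ e f → e :- f := :- (f :- e)) ≈-refl (T′ + U′ * σ) f) (<⇒0<- f<e))))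
        where
        difference : ∀ i j → fromℤ i - fromℤ j ≈ fromℤ (i ℤ.- j)
        difference i j = ≈-sym (≈-trans (fromℤ-+ i (ℤ.- j)) (+-congˡ (fromℤ-neg j)))

    -- With `U = 0` the eigenvalue is a sign. Otherwise trace and `U` give, up to signs, a positive
    -- Pell solution: if their signs agree it belongs to the eigenvalue itself, if not to its
    -- conjugate, which is its inverse.
    compare-eigenvalues : ∀ {N} (auto : Automorph form N) → let ρ′ = Action.ρ auto in
      ρ′ ≈ 1# ⊎ ¬ (ρ′ < ρ) ⊎ (∃[ κ ] κ * ρ′ ≈ 1# × ¬ (κ < ρ))
    compare-eigenvalues {N} auto with Automorph.U auto ℤₚ.≟ 0ℤ
    ... | yes U≡0 = inj₁ ρ′≈1
      where
      module N = Action auto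
      T₀ = trace N
      2ε′ : two * N.ε ≈ fromℤ T₀
      2ε′ = ≈-trans N.2ε≈ (≈-trans (+-congˡ (≈-trans (*-congʳ (fromℤ-cong U≡0)) (zeroˡ σ))) (+-identityʳ _))
      T²≡4 : T₀ ℤ.* T₀ ≡ + 4
      T²≡4 = trans (trans (e (T₀ ℤ.* T₀) D) (cong (λ U → T₀ ℤ.* T₀ ℤ.- D ℤ.* (U ℤ.* U)) (sym U≡0)))
          (automorph-pell auto)
        where
        e : ∀ x D → x ≡ x ℤ.- D ℤ.* (0ℤ ℤ.* 0ℤ)
        e = solve-∀
      ε²≈1 : N.ε * N.ε ≈ 1#
      ε²≈1 = *-cancelˡ-≈ (pos⇒≉0 (fromℤ-pos 0<4))
          (≈-trans (solve 1 (λ e → con (+ 4) :* (e :* e) := (con (+ 2) :* e) :* (con (+ 2) :* e)) ≈-refl N.ε)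
        (≈-trans (*-cong 2ε′ 2ε′) (≈-trans (≈-sym (fromℤ-* T₀ T₀))
            (≈-trans (fromℤ-cong T²≡4) (≈-sym (*-identityʳ _))))))
      ρ′≈1 : N.ρ ≈ 1#
      ρ′≈1 = ≈-trans (*-cong ε²≈1 ε²≈1) (*-identityˡ 1#)
    ... | no U≢0 = inj₂ by-signs
      where
      module N = Action auto
      T₀ = trace N
      U₀ = Automorph.U auto
      T²≡ : T₀ ℤ.* T₀ ≡ + 4 ℤ.+ D ℤ.* (U₀ ℤ.* U₀)
      T²≡ = trans (e (T₀ ℤ.* T₀) (D ℤ.* (U₀ ℤ.* U₀))) (cong (ℤ._+ D ℤ.* (U₀ ℤ.* U₀)) (automorph-pell auto))
        where
        e : ∀ x y → x ≡ x ℤ.- y ℤ.+ y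
        e = solve-∀
      T≢0 : T₀ ≢ 0ℤ
      T≢0 T≡0 = 0<⇒≢0 (0<+ 0<4 (0<* D>0 (0<i*i U≢0))) (trans (sym T²≡) (cong₂ ℤ._*_ T≡0 T≡0))
      pell′ : ∀ T₁ U₁ → T₁ ℤ.* T₁ ≡ T₀ ℤ.* T₀ → U₁ ℤ.* U₁ ≡ U₀ ℤ.* U₀ → T₁ ℤ.* T₁ ℤ.- D ℤ.* (U₁ ℤ.* U₁) ≡ + 4
      pell′ T₁ U₁ eq eq′ = trans (cong₂ (λ x y → x ℤ.- D ℤ.* y) eq eq′) (automorph-pell auto)
      sq-neg : ∀ i → ℤ.- i ℤ.* ℤ.- i ≡ i ℤ.* i
      sq-neg = solve-∀
      conjugate : N.ρ * ((N.ε̄ * N.ε̄) * (N.ε̄ * N.ε̄)) ≈ 1#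
      conjugate = ≈-trans (solve 2 (λ e f → (e :* e) :* (e :* e) :* ((f :* f) :* (f :* f)) :=
          ((e :* f) :* (e :* f)) :* ((e :* f) :* (e :* f))) ≈-refl N.ε N.ε̄)
        (≈-trans (*-cong (*-cong N.εε̄≈1 N.εε̄≈1) (*-cong N.εε̄≈1 N.εε̄≈1))
            (≈-trans (*-cong (*-identityˡ 1#) (*-identityˡ 1#)) (*-identityˡ 1#)))
      by-signs : ¬ (N.ρ < ρ) ⊎ (∃[ κ ] κ * N.ρ ≈ 1# × ¬ (κ < ρ))
      by-signs with sign-of T₀ T≢0 | sign-of U₀ U≢0
      ... | inj₁ 0<T | inj₁ 0<U = inj₁ (fourth-powers {N.ε} {T₀} {U₀} (*-cong N.2ε≈ N.2ε≈)
              record { t>0 = 0<T ; u>0 = 0<U ; pell = automorph-pell auto })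
      ... | inj₂ T<0 | inj₂ U<0 = inj₁ (fourth-powers {N.ε} {ℤ.- T₀} {ℤ.- U₀}
              (≈-trans (*-cong N.2ε≈ N.2ε≈) (≈-trans
                  (solve 3 (λ T U σ → (T :+ U :* σ) :* (T :+ U :* σ) := (:- T :+ :- U :* σ) :*
                  (:- T :+ :- U :* σ)) ≈-refl (fromℤ T₀) (fromℤ U₀) σ)
                (*-cong negated negated)))
              record { t>0 = 0<- T<0 ; u>0 = 0<- U<0 ; pell = pell′ (ℤ.- T₀) (ℤ.- U₀) (sq-neg T₀) (sq-neg U₀) })
        where
        negated : - fromℤ T₀ + - fromℤ U₀ * σ ≈ fromℤ (ℤ.- T₀) + fromℤ (ℤ.- U₀) * σ
        negated = ≈-sym (+-cong (fromℤ-neg T₀) (*-congʳ (fromℤ-neg U₀)))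
      ... | inj₁ 0<T | inj₂ U<0 = inj₂ (_ , ≈-trans (*-comm _ _) conjugate , fourth-powers {N.ε̄} {T₀} {ℤ.- U₀}
              (*-cong negated negated) record { t>0 = 0<T ; u>0 = 0<- U<0 ; pell = pell′ T₀ (ℤ.- U₀) refl
                  (sq-neg U₀) })
        where
        negated : two * N.ε̄ ≈ fromℤ T₀ + fromℤ (ℤ.- U₀) * σ
        negated = ≈-trans N.2ε̄≈ (+-congˡ (≈-trans (-‿distribˡ-* _ _) (*-congʳ (≈-sym (fromℤ-neg U₀)))))
      ... | inj₂ T<0 | inj₁ 0<U = inj₂ (_ , ≈-trans (*-comm _ _) conjugate , fourth-powers {N.ε̄} {ℤ.- T₀} {U₀}
              (≈-trans (*-cong N.2ε̄≈ N.2ε̄≈)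
                  (≈-trans (solve 3 (λ T U σ → (T :- U :* σ) :* (T :- U :* σ) := (:- T :+ U :* σ) :*
                  (:- T :+ U :* σ)) ≈-refl (fromℤ T₀) (fromℤ U₀) σ)
                (*-cong negated negated)))
              record { t>0 = 0<- T<0 ; u>0 = 0<U ; pell = pell′ (ℤ.- T₀) U₀ (sq-neg T₀) refl })
        where
        negated : - fromℤ T₀ + fromℤ U₀ * σ ≈ fromℤ (ℤ.- T₀) + fromℤ U₀ * σ
        negated = ≈-sym (+-congʳ (fromℤ-neg T₀))

-- Matching crossings with intersections.

module CountIntersections {r ℓ₁ ℓ₂} (ℝ : RealField r ℓ₁ ℓ₂) (q₁ q₂ : PIBQF)
  {𝒯₁ : Topograph (PIBQF.form q₁)} {𝒯₂ : Topograph (PIBQF.form q₂)} {ℛ₁ : River 𝒯₁} {ℛ₂ : River 𝒯₂}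
  (P₁ : PeriodTranslation ℛ₁) (P₂ : PeriodTranslation ℛ₂) where
  open FormAction
  open Tree
  open ModularGroup
  open IntegerSequences
  open SignPatterns

  open OrderedField ℝ
  open Geometry ℝ
  open VectorSigns ℝ using (IsRoot; root-neg)
  open Roots ℝ
  open Circles ℝ
  open GeometricSequences ℝ
  module Crossings = CountCrossings ℝ q₁ q₂ P₁ P₂
  open Crossings using (IsCrossing; crosses⇒crossing; crossing⇒crosses; module River₁; module Translations₁; module Translations₂; module 𝒯₁; module 𝒯₂)
  open PeriodTranslation P₁ using () renaming (τ to τ₁)
  open PeriodTranslation P₂ using () renaming (τ to τ₂)
  open PlaneIso using (to; from)
  open Stabilizer
  module q₁ = PIBQF q₁
  module q₂ = PIBQF q₂

  private
    σ₁ : Carrier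
    σ₁ = √ (fromℤ q₁.D)

    0<σ₁ : 0# < σ₁
    0<σ₁ = √-pos (fromℤ-pos q₁.D>0)

  module Conjugate (e : Edge) where
    g : Form
    g = 𝒯₁.f e

    A≢0ᵍ : Form.A g ≢ 0ℤ
    A≢0ᵍ = A≢0 {g} (River₁.anisotropic e)

    disc≡ : disc g ≡ q₁.D
    disc≡ = trans (Labelling.f-disc (labelling 𝒯₁) e 𝒯₁.base) (cong disc 𝒯₁.f-base)

    rootᵍ : IsRoot σ₁ g
    rootᵍ = ≈-trans (√-square (fromℤ-pos q₁.D>0)) (fromℤ-cong (sym disc≡))

    vietaᵍ : Vieta g σ₁ (rootOf (- σ₁) g) (rootOf σ₁ g)
    vietaᵍ = vieta g A≢0ᵍ rootᵍ

  -- The edge of the first tree on which the base of the second lies after `b` periods. Its form is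
  -- that of `q₁` seen from `q₂`, and varying `b` runs through an orbit of translates under the
  -- stabilizer of `q₂`.
  edgeOf : PlaneIso → ℤ → Edge
  edgeOf φ b = to φ ((τ₂ ^ b) 𝒯₂.base)

  G : PlaneIso → ℤ → Form
  G φ b = 𝒯₁.f (edgeOf φ b)

  w : PlaneIso → ℤ → Form
  w φ b = jac (G φ b) q₂.form

  f₂-orbit : ∀ b → 𝒯₂.f ((τ₂ ^ b) 𝒯₂.base) ≡ q₂.form
  f₂-orbit b = trans (Translations₂.τ^-forms b 𝒯₂.base) 𝒯₂.f-base

  act-matrix : ∀ (𝒽 : Labelling) {v M} → (∀ q → actᶠ v q ≡ M • q) → ∀ e → Labelling.f 𝒽 (act v e) ≡ M ∘
      Labelling.f 𝒽 e
  act-matrix 𝒽 {v} {M} eq e = trans (Labelling.f-act 𝒽 v e) (trans (eq (Labelling.f 𝒽 e)) (•-∘ M (Labelling.f 𝒽 e)))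

  crossing-orbit : ∀ φ → (∀ e → IsCrossing φ e) → ∀ b → Crossing (G φ b) q₂.form
  crossing-orbit φ c b = subst (Crossing (G φ b))
      (trans (cong 𝒯₂.f (PlaneIso.strictlyInverseʳ φ ((τ₂ ^ b) 𝒯₂.base))) (f₂-orbit b)) (c (edgeOf φ b))

  module _ (φ : PlaneIso) where
    private
      𝓌 = jacobian (pullback (labelling 𝒯₁) φ) (labelling 𝒯₂)

      at : ∀ b → Labelling.f 𝓌 ((τ₂ ^ b) 𝒯₂.base) ≡ w φ b
      at b = cong (jac (G φ b)) (f₂-orbit b)

    Δ-constant : ∀ b b′ → Δ (G φ b) q₂.form ≈ Δ (G φ b′) q₂.form
    Δ-constant b b′ = -‿cong (fromℤ-cong (trans (cong disc (sym (at b)))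
      (trans (Labelling.f-disc 𝓌 ((τ₂ ^ b) 𝒯₂.base) ((τ₂ ^ b′) 𝒯₂.base)) (cong disc (at b′)))))

    w-act : ∀ {v M b k} → (∀ q → actᶠ v q ≡ M • q) → act v ((τ₂ ^ b) 𝒯₂.base) ≡ (τ₂ ^ k) 𝒯₂.base → w φ k ≡ M ∘ w φ b
    w-act {v} {M} {b} {k} eq h = trans (sym (at k)) (trans (cong (Labelling.f 𝓌) (sym h))
      (trans (act-matrix 𝓌 {v} {M} eq ((τ₂ ^ b) 𝒯₂.base)) (cong (M ∘_) (at b))))

  -- The matrix of the translation τ₂.
  translation-word : List Move
  translation-word = proj₁ (connected 𝒯₂.base (to τ₂ 𝒯₂.base))

  N : Matrix
  N = proj₁ (matrixOf translation-word)

  actᶠ-N : ∀ q → actᶠ translation-word q ≡ N • q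
  actᶠ-N = proj₂ (proj₂ (matrixOf translation-word))

  act-translation : ∀ b → act translation-word ((τ₂ ^ b) 𝒯₂.base) ≡ (τ₂ ^ ℤ.suc b) 𝒯₂.base
  act-translation b = begin
    act v ((τ₂ ^ b) 𝒯₂.base)          ≡⟨ to-act (power τ₂ b) v 𝒯₂.base ⟨
    (τ₂ ^ b) (act v 𝒯₂.base)          ≡⟨ cong (τ₂ ^ b) (proj₂ (connected 𝒯₂.base (to τ₂ 𝒯₂.base))) ⟩
    (τ₂ ^ b) ((τ₂ ^ 1ℤ) 𝒯₂.base)      ≡⟨ ^-+ τ₂ b 1ℤ 𝒯₂.base ⟨
    (τ₂ ^ (b ℤ.+ 1ℤ)) 𝒯₂.base         ≡⟨ cong (λ k → (τ₂ ^ k) 𝒯₂.base) (ℤₚ.+-comm b 1ℤ) ⟩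
    (τ₂ ^ ℤ.suc b) 𝒯₂.base            ∎
    where
    open ≡-Reasoning
    v = translation-word

  N-automorph : Automorph q₂.form N
  N-automorph = stabilizer N q₂.form q₂.coprime (proj₁ (proj₂ (matrixOf translation-word))) (begin
    N ∘ q₂.form                          ≡⟨ cong (N ∘_) 𝒯₂.f-base ⟨
    N ∘ 𝒯₂.f 𝒯₂.base                     ≡⟨ act-matrix (labelling 𝒯₂) {translation-word} {N} actᶠ-N 𝒯₂.base ⟨
    𝒯₂.f (act translation-word 𝒯₂.base)  ≡⟨ cong 𝒯₂.f (proj₂ (connected 𝒯₂.base (to τ₂ 𝒯₂.base))) ⟩
    𝒯₂.f (to τ₂ 𝒯₂.base)                 ≡⟨ PeriodTranslation.preserves-forms P₂ 𝒯₂.base ⟩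
    𝒯₂.f 𝒯₂.base                         ≡⟨ 𝒯₂.f-base ⟩
    q₂.form                              ∎)
    where open ≡-Reasoning

  module Window (S : SmallestPellSolution q₂.D) (z : ℂ) (z∈ : z ∈ geodesic q₂) where
    open Eigenvalues ℝ q₂
    open Generator S
    open OnGeodesic z∈ using () renaming (fromSource>0 to source>0; toTarget>0 to target>0)

    γ : Matrix
    γ = automorph q₂ S

    γ-automorph : Automorph q₂.form γ
    γ-automorph = pell-automorph q₂ S

    ρ : Carrier
    ρ = Action.ρ γ-automorph

    γ-word : ActsAsWord γ
    γ-word = word γ (Automorph.det≡1 γ-automorph)

    -- γ is a power of N, up to sign.
    γ-index : ∃[ k ] act (proj₁ γ-word) 𝒯₂.base ≡ (τ₂ ^ k) 𝒯₂.base
    γ-index = Translations₂.same-form (begin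
      𝒯₂.f 𝒯₂.base                       ≡⟨ 𝒯₂.f-base ⟩
      q₂.form                            ≡⟨ automorph-fixes γ-automorph ⟨
      γ ∘ q₂.form                        ≡⟨ cong (γ ∘_) 𝒯₂.f-base ⟨
      γ ∘ 𝒯₂.f 𝒯₂.base                   ≡⟨ act-matrix (labelling 𝒯₂) {proj₁ γ-word} {γ} (proj₂ γ-word) 𝒯₂.base ⟨
      𝒯₂.f (act (proj₁ γ-word) 𝒯₂.base)  ∎)
      where open ≡-Reasoning

    module Point (φ : PlaneIso) (c : ∀ e → IsCrossing φ e) (b : ℤ) where
      open Conjugate (edgeOf φ b) public
      private
        A≢0₂ : Form.A q₂.form ≢ 0ℤ
        A≢0₂ = A≢0 {q₂.form} q₂.nonsquare

        vieta₂ : Vieta q₂.form σ (rootOf (- σ) q₂.form) (rootOf σ q₂.form)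
        vieta₂ = vieta q₂.form A≢0₂ σ²

      open Meeting g q₂.form public using (Meets; meets-unique)

      crossing : Crossing g q₂.form
      crossing = crossing-orbit φ c b

      α≉0 : Meeting.α g q₂.form ≉ 0#
      α≉0 = Meeting.crossing⇒α≉0 g q₂.form crossing

      meets⇒on : ∀ {x y} → Meets x y → (x +i y) ∈ geodesicOf σ₁ g × (x +i y) ∈ geodesic q₂
      meets⇒on = on-both⁻¹ vietaᵍ vieta₂ A≢0ᵍ A≢0₂

      transverse : ∀ {x y} → Meets x y → TransverseAt (x +i y) (geodesicOf σ₁ g) (geodesic q₂)
      transverse m = α≉0⇒transverse vietaᵍ vieta₂ A≢0ᵍ A≢0₂ (Meeting.Meets.y>0 m) α≉0

      x y : Carrier
      x = proj₁ (Meeting.meeting-point g q₂.form crossing)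
      y = proj₁ (proj₂ (Meeting.meeting-point g q₂.form crossing))

      meets : Meets x y
      meets = proj₂ (proj₂ (Meeting.meeting-point g q₂.form crossing))

    module Orbit (φ : PlaneIso) (c : ∀ e → IsCrossing φ e) where

      -- The base point's side of the comparison of quotients; `position b` is the side of the
      -- `b`-th translate. `Δ` does not depend on `b`, so one window decides which translate meets
      -- the segment.
      W : Carrier
      W = Δ (G φ 0ℤ) q₂.form * toTarget (re z)

      position : ℤ → Carrier
      position b = Q (w φ b) * fromSource (re z)

      W>0 : 0# < W
      W>0 = *-pos (Meeting.crossing⇒Δ>0 (G φ 0ℤ) q₂.form (crossing-orbit φ c 0ℤ)) target>0

      position>0 : ∀ b → 0# < position b
      position>0 b = *-pos (Order.Q>0 g crossing meets (proj₂ (meets⇒on meets))) source>0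
        where open Point φ c b

      position-action : ∀ {M b k} (auto : Automorph q₂.form M) → w φ k ≡ M ∘ w φ b → position k ≈ Action.ρ auto
          * position b
      position-action {M} {b} {k} auto eq = ≈-trans (*-congʳ (≈-trans (Q-cong eq)
        (Action.Q-action auto (w φ b) (Apolarity.apolarʳ (G φ b) q₂.form)))) (*-assoc _ _ _)
        where
        Q-cong : ∀ {v v′} → v ≡ v′ → Q v ≈ Q v′
        Q-cong refl = ≈-refl

      position-suc : ∀ b → position (ℤ.suc b) ≈ Action.ρ N-automorph * position b
      position-suc b = position-action {N} {b} {ℤ.suc b} N-automorph
          (w-act φ {translation-word} {N} {b} {ℤ.suc b} actᶠ-N (act-translation b))

      position-γ : position (proj₁ γ-index) ≈ ρ * position 0ℤ
      position-γ = position-action {γ} {0ℤ} {proj₁ γ-index} γ-automorph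
        (w-act φ {proj₁ γ-word} {γ} {0ℤ} {proj₁ γ-index} (proj₂ γ-word) (proj₂ γ-index))

      private
        windows = power-windows ρ>1 (compare-eigenvalues N-automorph) W>0 position position>0 position-suc
            (proj₁ γ-index) position-γ

      index : ∃[ b ] InWindow ρ W (position b)
      index = proj₁ windows

      unique : ∀ {i j} → InWindow ρ W (position i) → InWindow ρ W (position j) → i ≡ j
      unique = proj₂ windows

      module _ (b : ℤ) where
        open Point φ c b
        open Segment γ-automorph ρ>1 z∈

        private
          W≈ : Δ g q₂.form * toTarget (re z) ≈ W
          W≈ = *-congʳ (Δ-constant φ b 0ℤ)

        window⇒between : InWindow ρ W (position b) → ∀ {x y} → Meets x y → Between x
        window⇒between (low , high) m = Equivalence.from (between⇔window g crossing m (proj₂ (meets⇒on m)))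
          ((λ h → low (<-respˡ W≈ h)) , <-respˡ (≈-sym W≈) high)

        between⇒window : ∀ {x y} → Meets x y → Between x → InWindow ρ W (position b)
        between⇒window m between =
          let low , high = Equivalence.to (between⇔window g crossing m (proj₂ (meets⇒on m))) between in
          (λ h → low (<-respˡ (≈-sym W≈) h)) , <-respˡ W≈ high

    geodesic-translate : ∀ e → IsTranslate (geodesic q₁) (geodesicOf σ₁ (𝒯₁.f e))
    geodesic-translate e = M , det≡1 ,
      (≈-sym (transport (- σ₁) (root-neg g rootᵍ)) , ≈-sym (transport σ₁ rootᵍ))
      where
      open Conjugate e
      v = proj₁ (connected e 𝒯₁.base)
      M = proj₁ (matrixOf v)
      det≡1 = proj₁ (proj₂ (matrixOf v))
      M∘g : M ∘ g ≡ q₁.form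
      M∘g = trans (sym (act-matrix (labelling 𝒯₁) {v} {M} (proj₂ (proj₂ (matrixOf v))) e))
          (trans (cong 𝒯₁.f (proj₂ (connected e 𝒯₁.base))) 𝒯₁.f-base)
      transport : ∀ σ → IsRoot σ g → möbius M (rootOf σ q₁.form) ≈ rootOf σ g
      transport σ σ² = subst (λ q → möbius M (rootOf σ q) ≈ rootOf σ g) M∘g
        (möbius-rootOf M g σ det≡1 A≢0ᵍ (subst (λ q → Form.A q ≢ 0ℤ) (sym M∘g) (A≢0 {q₁.form} q₁.nonsquare)) σ²)

    -- The action on forms is inverse to that on roots: the form of the translate by `M` is
    -- `M⁻¹ ∘ q₁`, and a word for `M⁻¹` leads from the base edge to an edge carrying it.
    translate-geodesic : ∀ {ℓ} → IsTranslate (geodesic q₁) ℓ → ∃[ e ] ℓ ≈ᵍ geodesicOf σ₁ (𝒯₁.f e)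
    translate-geodesic (M@(mat a b c d) , det≡1 , s≈ , t≈) = e ,
      ≈-trans s≈ (transport (- σ₁) (root-neg g rootᵍ)) , ≈-trans t≈ (transport σ₁ rootᵍ)
      where
      M⁻¹ = mat d (ℤ.- b) (ℤ.- c) a
      det′≡1 : det M⁻¹ ≡ 1ℤ
      det′≡1 = trans (eq a b c d) det≡1
        where
        eq : ∀ a b c d → d ℤ.* a ℤ.- ℤ.- b ℤ.* ℤ.- c ≡ a ℤ.* d ℤ.- b ℤ.* c
        eq = solve-∀
      v = proj₁ (word M⁻¹ det′≡1)
      e = act v 𝒯₁.base
      open Conjugate e
      M∘g : M ∘ g ≡ q₁.form
      M∘g = begin
        M ∘ g                      ≡⟨ •-∘ M g ⟨
        M • g                      ≡⟨ cong (M •_)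
            (trans (Labelling.f-act (labelling 𝒯₁) v 𝒯₁.base)
            (trans (proj₂ (word M⁻¹ det′≡1) _) (cong (M⁻¹ •_) 𝒯₁.f-base))) ⟩
        M • M⁻¹ • q₁.form          ≡⟨ •-• M M⁻¹ q₁.form ⟩
        (M⁻¹ ⊗ M) • q₁.form        ≡⟨ cong (_• q₁.form)
            (matrix-≡ (trans (e₁ a b c d) det≡1) (e₂ b d) (e₃ a c) (trans (e₄ a b c d) det≡1)) ⟩
        mat 1ℤ 0ℤ 0ℤ 1ℤ • q₁.form  ≡⟨ identity-• q₁.form ⟩
        q₁.form                    ∎
        where
        open ≡-Reasoning
        e₁ : ∀ a b c d → d ℤ.* a ℤ.+ ℤ.- b ℤ.* c ≡ a ℤ.* d ℤ.- b ℤ.* c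
        e₁ = solve-∀
        e₂ : ∀ b d → d ℤ.* b ℤ.+ ℤ.- b ℤ.* d ≡ 0ℤ
        e₂ = solve-∀
        e₃ : ∀ a c → ℤ.- c ℤ.* a ℤ.+ a ℤ.* c ≡ 0ℤ
        e₃ = solve-∀
        e₄ : ∀ a b c d → ℤ.- c ℤ.* b ℤ.+ a ℤ.* d ≡ a ℤ.* d ℤ.- b ℤ.* c
        e₄ = solve-∀
      transport : ∀ σ → IsRoot σ g → möbius M (rootOf σ q₁.form) ≈ rootOf σ g
      transport σ σ² = subst (λ q → möbius M (rootOf σ q) ≈ rootOf σ g) M∘g
        (möbius-rootOf M g σ det≡1 A≢0ᵍ (subst (λ q → Form.A q ≢ 0ℤ) (sym M∘g) (A≢0 {q₁.form} q₁.nonsquare)) σ²)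

    intersection : ∀ φ → (∀ e → IsCrossing φ e) → Intersection q₁ q₂ z (möbiusᶜ γ z)
    intersection φ c = record
      { ℓ            = geodesicOf σ₁ g
      ; P            = x +i y
      ; is-translate = geodesic-translate (edgeOf φ b)
      ; on-translate = proj₁ (meets⇒on meets)
      ; on-segment   = record { on-geodesic = proj₂ (meets⇒on meets) ; between = window⇒between b (proj₂ index)
          meets }
      ; transverse   = transverse meets
      }
      where
      open Orbit φ c
      b = proj₁ index
      open Point φ c b

    same-geodesic : ∀ e e′ → geodesicOf σ₁ (𝒯₁.f e) ≈ᵍ geodesicOf σ₁ (𝒯₁.f e′) → 𝒯₁.f e ≡ 𝒯₁.f e′
    same-geodesic e e′ (s≈ , t≈) = vieta-unique (pos⇒≉0 0<σ₁)
      (vieta-cong s≈ t≈ (Conjugate.vietaᵍ e)) (Conjugate.vietaᵍ e′)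

    -- Edges of the first topograph with equal forms differ by a power of `τ₁`. The two
    -- superimpositions, suitably translated, then agree on one edge and so on all.
    same-form⇒same-crossing : ∀ φ φ′ b b′ → G φ b ≡ G φ′ b′ → SameModulo τ₁ τ₂ φ φ′
    same-form⇒same-crossing φ φ′ b b′ eq = translate (Translations₁.same-form eq)
      where
      translate : ∃[ a ] edgeOf φ′ b′ ≡ (τ₁ ^ a) (edgeOf φ b) → SameModulo τ₁ τ₂ φ φ′
      translate (a , h) = a , b ℤ.+ (ℤ.- b′) , λ e → begin
        to φ′ e                                                   ≡⟨ cong (to φ′) (^-neg′ τ₂ b′ e) ⟨
        to φ′ ((τ₂ ^ b′) ((τ₂ ^ (ℤ.- b′)) e))                    
            ≡⟨ to-≗ (φ′ ∙ power τ₂ b′) (power τ₁ a ∙ φ ∙ power τ₂ b) {𝒯₂.base} h ((τ₂ ^ (ℤ.- b′)) e) ⟩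
        (τ₁ ^ a) (to φ ((τ₂ ^ b) ((τ₂ ^ (ℤ.- b′)) e)))           
            ≡⟨ cong (λ e → (τ₁ ^ a) (to φ e)) (^-+ τ₂ b (ℤ.- b′) e) ⟨
        (τ₁ ^ a) (to φ ((τ₂ ^ (b ℤ.+ (ℤ.- b′))) e))               ∎
        where open ≡-Reasoning

    module _ {n} (count : HasCardinality (crossings P₁ P₂) n) where
      private
        module B = Bijection count

        iso : Fin n → PlaneIso
        iso k = proj₁ (B.to k)

        c : ∀ k e → IsCrossing (iso k) e
        c k = crosses⇒crossing (iso k) (proj₂ (B.to k))

        bᵏ : Fin n → ℤ
        bᵏ k = proj₁ (Orbit.index (iso k) (c k))

        I : Fin n → Intersection q₁ q₂ z (möbiusᶜ γ z)
        I k = intersection (iso k) (c k)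

        I-injective : ∀ {k l} → geodesicOf σ₁ (G (iso k) (bᵏ k)) ≈ᵍ geodesicOf σ₁ (G (iso l) (bᵏ l)) → k ≡ l
        I-injective {k} {l} ℓ≈ = B.injective (same-form⇒same-crossing (iso k) (iso l) (bᵏ k) (bᵏ l)
          (same-geodesic (edgeOf (iso k) (bᵏ k)) (edgeOf (iso l) (bᵏ l)) ℓ≈))

        module Preimage (J : Intersection q₁ q₂ z (möbiusᶜ γ z)) where
          module J = Intersection J

          private
            found = translate-geodesic J.is-translate
            e = proj₁ found
            open Conjugate e
            A≢0₂ = A≢0 {q₂.form} q₂.nonsquare
            vieta₂ = vieta q₂.form A≢0₂ σ²
            vietaʲ : Vieta g σ₁ (OrientedGeodesic.source J.ℓ) (OrientedGeodesic.target J.ℓ)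
            vietaʲ = vieta-cong (≈-sym (proj₁ (proj₂ found))) (≈-sym (proj₂ (proj₂ found))) vietaᵍ

          meetsʲ : Meeting.Meets g q₂.form (re J.P) (im J.P)
          meetsʲ = on-both vietaʲ vieta₂ A≢0ᵍ A≢0₂ J.on-translate (InSegment.on-geodesic J.on-segment)

          φ : PlaneIso
          -- The superimposition in which the base edge of `q₂` lies on the edge whose form has the
          -- given translate as its geodesic.
          φ = carry 𝒯₂.base e

          G-φ : G φ 0ℤ ≡ g
          G-φ = cong 𝒯₁.f (to-carry 𝒯₂.base e)

          cᵠ : ∀ e → IsCrossing φ e
          cᵠ = Crossings.crossing-everywhere φ {e} (subst (Crossing g)
            (sym (trans (cong 𝒯₂.f (to-from φ (to-carry 𝒯₂.base e))) 𝒯₂.f-base))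
            (Meeting.meets⇒crossing g q₂.form meetsʲ (transverse⇒α≉0 vietaʲ vieta₂ A≢0ᵍ A≢0₂ J.transverse)))

          preimage : ∃[ k ] SameModulo τ₁ τ₂ (iso k) φ
          preimage = let k , h = B.surjective (φ , crossing⇒crosses φ {e} (cᵠ e)) in k , h refl

          module _ (k : Fin n) (same : SameModulo τ₁ τ₂ (iso k) φ) where
            private
              b = proj₁ (proj₂ same)
              same-g : G (iso k) b ≡ g
              same-g = trans (sym (Translations₁.τ^-forms (proj₁ same) (edgeOf (iso k) b)))
                (trans (cong 𝒯₁.f (sym (proj₂ (proj₂ same) 𝒯₂.base))) G-φ)

              -- The representative `iso k` may differ from `φ` by periods of `q₂`, and its
              -- translate with index `b` is the given one. As this translate meets the segment,
              -- uniqueness in the window identifies `b` with the chosen index.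
              b≡ : bᵏ k ≡ b
              b≡ = Orbit.unique (iso k) (c k) (proj₂ (Orbit.index (iso k) (c k)))
                (Orbit.between⇒window (iso k) (c k) b
                  (subst (λ q → Meeting.Meets q q₂.form (re J.P) (im J.P)) (sym same-g) meetsʲ)
                      (InSegment.between J.on-segment))

              g≡ : G (iso k) (bᵏ k) ≡ g
              g≡ = trans (cong (G (iso k)) b≡) same-g

              ℓ≈ : geodesicOf σ₁ (G (iso k) (bᵏ k)) ≈ᵍ geodesicOf σ₁ g
              ℓ≈ = subst (λ q → geodesicOf σ₁ (G (iso k) (bᵏ k)) ≈ᵍ geodesicOf σ₁ q) g≡ (≈-refl , ≈-refl)

            I≈J : Intersection.ℓ (I k) ≈ᵍ J.ℓ × Intersection.P (I k) ≈ᶜ J.P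
            I≈J = (≈-trans (proj₁ ℓ≈) (≈-sym (proj₁ (proj₂ found))) , ≈-trans (proj₂ ℓ≈)
                (≈-sym (proj₂ (proj₂ found)))) ,
              Point.meets-unique (iso k) (c k) (bᵏ k) (Point.α≉0 (iso k) (c k) (bᵏ k))
                  (Point.meets (iso k) (c k) (bᵏ k))
                (subst (λ q → Meeting.Meets q q₂.form (re J.P) (im J.P)) (sym g≡) meetsʲ)

      intersections-cardinality : HasCardinality (intersections q₁ q₂ z (möbiusᶜ γ z)) n
      intersections-cardinality = record
        { to        = I
        ; cong      = λ { refl → (≈-refl , ≈-refl) , (≈-refl , ≈-refl) }
        ; bijective = (λ (ℓ≈ , _) → I-injective ℓ≈) ,
            λ J → let k , same = Preimage.preimage J in k , λ { refl → Preimage.I≈J J k same }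
        }

theorem5 : ∀ {c ℓ₁ ℓ₂} (ℝ : RealField c ℓ₁ ℓ₂) (q₁ q₂ : PIBQF)
    (𝒯₁ : Topograph (PIBQF.form q₁)) (𝒯₂ : Topograph (PIBQF.form q₂))
    (ℛ₁ : River 𝒯₁) (ℛ₂ : River 𝒯₂)
    (P₁ : PeriodTranslation ℛ₁) (P₂ : PeriodTranslation ℛ₂) →
    Σ[ n ∈ ℕ ] Geometry.IntersectionNumber ℝ q₁ q₂ n × HasCardinality (crossings P₁ P₂) n
theorem5 ℝ q₁ q₂ 𝒯₁ 𝒯₂ ℛ₁ ℛ₂ P₁ P₂ = number ,
  (λ S z z∈ → CountIntersections.Window.intersections-cardinality ℝ q₁ q₂ P₁ P₂ S z z∈ cardinality) , cardinality
  where open CountCrossings ℝ q₁ q₂ P₁ P₂
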